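{- The following problem is in NP: given a graph $G$ and an integer $k \le |V(G)|^c$ (where $c$ is a fixed constant), decide whether $G$ admits a Helly $B_k$-EPG representation.
   Context: A grid is the set of integer points of the plane; a grid edge joins two grid points at distance $1$. A path in the grid is a sequence of distinct grid edges in which consecutive edges share exactly one grid point and non-consecutive edges share none; a bend is a pair of consecutive edges of the path with different directions (horizontal/vertical). An EPG representation of a graph $G$ is a family $(P_v)_{v\in V(G)}$ of grid paths such that distinct $u,v$ are adjacent iff $P_u,P_v$ share a grid edge; it is a $B_k$-EPG representation if every path has at most $k$ bends. It is Helly if every subfamily of pairwise edge-intersecting paths has a grid edge common to all its members. -}

module Defs where

open import Data.Bool.Base using (Bool; true; false; T)
open import Data.Fin.Base using (Fin; toℕ)
open import Data.Fin.Subset using (Subset) renaming (_∈_ to _∈ₛ_)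
open import Data.Integer.Base using (ℤ; 1ℤ) renaming (_+_ to _+ℤ_)
open import Data.List.Base using (List; []; _∷_; _++_; length; map; lookup; concat; tabulate; replicate)
open import Data.List.Membership.Propositional using (_∈_)
open import Data.List.Relation.Unary.Unique.Propositional using (Unique)
open import Data.Maybe.Base using (Maybe; just; nothing)
open import Data.Nat.Base using (ℕ; zero; suc; _+_; _*_; _^_; _≤_; _<_)
open import Data.Nat.Binary.Base using (ℕᵇ; zero; 2[1+_]; 1+[2_]; fromℕ)
open import Data.Product.Base using (Σ; _×_; _,_; ∃; ∃-syntax; proj₁)
open import Data.Product using (∃!)
open import Data.Sum.Base using (_⊎_)
open import Data.Vec.Base as Vec using (Vec)
open import Function.Bundles using (_⇔_; _↔_; _↣_; Injection)
open import Level using (0ℓ)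
open import Relation.Binary.PropositionalEquality.Core using (_≡_; _≢_)
open import Relation.Nullary.Negation.Core using (¬_)
open import Relation.Unary using (Pred)

------------------------------------------------------------------------
-- Graphs and EPG representations

record Graph : Set where
  field
    order      : ℕ
    adj        : Fin order → Fin order → Bool
    adj-sym    : ∀ u v → adj u v ≡ adj v u
    adj-irrefl : ∀ v → adj v v ≡ false

  Vertex : Set
  Vertex = Fin order

Point : Set
Point = ℤ × ℤ

data Direction : Set where
  horizontal vertical : Direction

-- A grid edge is an unordered pair of points at distance 1.  It is stored as
-- its direction and its left (resp. lower) endpoint, so that each edge has
-- exactly one representation and _≡_ is equality of edges.
record GridEdge : Set where
  constructor edge
  field
    direction : Direction
    source    : Point

  target : Point
  target with direction | source
  ... | horizontal | (x , y) = (x +ℤ 1ℤ , y)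
  ... | vertical   | (x , y) = (x , y +ℤ 1ℤ)

open GridEdge

_isEndOf_ : Point → GridEdge → Set
p isEndOf e = p ≡ source e ⊎ p ≡ target e

SharedPoint : GridEdge → GridEdge → Point → Set
SharedPoint e f p = p isEndOf e × p isEndOf f

record IsPath (es : List GridEdge) : Set where
  field
    distinct       : Unique es
    consecutive    : ∀ i j → toℕ j ≡ suc (toℕ i) →
                     ∃! _≡_ (SharedPoint (lookup es i) (lookup es j))
    nonconsecutive : ∀ i j → suc (toℕ i) < toℕ j →
                     ¬ ∃ (SharedPoint (lookup es i) (lookup es j))

turn : Direction → Direction → ℕ
turn horizontal horizontal = 0
turn horizontal vertical   = 1
turn vertical   horizontal = 1
turn vertical   vertical   = 0

bends : List GridEdge → ℕ
bends []           = 0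
bends (e ∷ [])     = 0
bends (e ∷ f ∷ es) = turn (direction e) (direction f) + bends (f ∷ es)

ShareEdge : List GridEdge → List GridEdge → Set
ShareEdge es fs = ∃[ e ] (e ∈ es × e ∈ fs)

module _ (G : Graph) where
  open Graph G

  record IsEPG (P : Vertex → List GridEdge) : Set where
    field
      path     : ∀ v → IsPath (P v)
      adjacent : ∀ u v → u ≢ v → T (adj u v) ⇔ ShareEdge (P u) (P v)

  record IsBEPG (k : ℕ) (P : Vertex → List GridEdge) : Set where
    field
      isEPG     : IsEPG P
      bends≤k   : ∀ v → bends (P v) ≤ k

  Helly : (Vertex → List GridEdge) → Set
  Helly P = (S : Subset order) →
            (∀ u v → u ∈ₛ S → v ∈ₛ S → u ≢ v → ShareEdge (P u) (P v)) →
            ∃[ e ] (∀ v → v ∈ₛ S → e ∈ P v)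

  HasHellyBEPG : ℕ → Set
  HasHellyBEPG k = ∃[ P ] (IsBEPG k P × Helly P)

------------------------------------------------------------------------
-- Multitape Turing machines

Word : Set
Word = List Bool

Language : Set₁
Language = Pred Word 0ℓ

data Move : Set where
  left stay right : Move

Finite : Set → Set
Finite A = ∃[ n ] (A ↔ Fin n)

-- A deterministic machine with two input tapes and any fixed number of work
-- tapes.  It has halted as soon as its state has a verdict.  The injection
-- `symbol` makes the two bits and the blank (nothing) distinct tape symbols.
record TuringMachine : Set₁ where
  field
    workTapes    : ℕ
    State        : Set
    State-finite : Finite State
    Sym          : Set
    Sym-finite   : Finite Sym
    symbol       : Maybe Bool ↣ Sym
    start        : State
    verdict      : State → Maybe Bool
    δ            : State → Vec Sym (2 + workTapes) →
                   State × Vec (Sym × Move) (2 + workTapes)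

module Execution (M : TuringMachine) where
  open TuringMachine M

  blank : Sym
  blank = Injection.to symbol nothing

  bit : Bool → Sym
  bit b = Injection.to symbol (just b)

  -- Two-way infinite tape; the lists run outwards from the head, and all
  -- cells beyond them are blank.
  record Tape : Set where
    constructor tape
    field
      leftCells  : List Sym
      scanned    : Sym
      rightCells : List Sym

  moveTape : Move → Tape → Tape
  moveTape stay  t                    = t
  moveTape left  (tape []       s rs) = tape [] blank (s ∷ rs)
  moveTape left  (tape (l ∷ ls) s rs) = tape ls l (s ∷ rs)
  moveTape right (tape ls s [])       = tape (s ∷ ls) blank []
  moveTape right (tape ls s (r ∷ rs)) = tape (s ∷ ls) r rs

  writeMove : Sym × Move → Tape → Tape
  writeMove (s , m) (tape ls _ rs) = moveTape m (tape ls s rs)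

  inputTape : Word → Tape
  inputTape []      = tape [] blank []
  inputTape (b ∷ w) = tape [] (bit b) (map bit w)

  Config : Set
  Config = State × Vec Tape (2 + workTapes)

  initial : Word → Word → Config
  initial x u = start , inputTape x Vec.∷ inputTape u Vec.∷ Vec.replicate workTapes (inputTape [])

  step : Config → Config
  step (q , ts) with verdict q
  ... | just _  = q , ts
  ... | nothing with δ q (Vec.map Tape.scanned ts)
  ...   | q′ , actions = q′ , Vec.zipWith writeMove actions ts

  run : ℕ → Config → Config
  run zero    c = c
  run (suc t) c = run t (step c)

  HaltsWithin : ℕ → Word → Word → Bool → Set
  HaltsWithin t x u b = verdict (proj₁ (run t (initial x u))) ≡ just b

  Accepts : Word → Word → Set
  Accepts x u = ∃[ t ] HaltsWithin t x u true

------------------------------------------------------------------------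
-- NP

-- Coefficients, constant term first.
Polynomial : Set
Polynomial = List ℕ

⟦_⟧ : Polynomial → ℕ → ℕ
⟦ [] ⟧    n = 0
⟦ a ∷ p ⟧ n = a + n * ⟦ p ⟧ n

PolynomialTime : TuringMachine → Set
PolynomialTime M =
  ∃[ q ] (∀ x u → ∃[ b ] HaltsWithin (⟦ q ⟧ (length x + length u)) x u b)
  where open Execution M

InNP : Language → Set₁
InNP L =
  Σ TuringMachine λ V → PolynomialTime V ×
  ∃[ p ] (∀ x → L x ⇔ (∃[ u ] (length u ≤ ⟦ p ⟧ (length x) × Execution.Accepts V x u)))

------------------------------------------------------------------------
-- The decision problem

-- Bijective base-2 numeral, least significant digit first: false is the
-- digit 1 and true is the digit 2.
digits : ℕᵇ → Word
digits zero     = []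
digits 2[1+ n ] = true ∷ digits n
digits 1+[2 n ] = false ∷ digits n

-- The order n in unary, a terminating false, the rows of the n × n adjacency
-- matrix, and k in binary.
encode : Graph → ℕ → Word
encode G k =
  replicate order true ++ false ∷
  concat (tabulate λ u → tabulate λ v → adj u v) ++
  digits (fromℕ k)
  where open Graph G

HellyBEPGProblem : ℕ → Language
HellyBEPGProblem c w =
  ∃[ G ] ∃[ k ] (w ≡ encode G k × k ≤ Graph.order G ^ c × HasHellyBEPG G k)

{-# OPTIONS --safe #-}

-- A representation can be compressed: if some column contains no endpoint and
-- no turn of any path, then every path that meets it crosses it horizontally,
-- so the points in this column can be deleted and the columns beyond it moved
-- one step to the left.  Edges are merged only with edges of the same paths,
-- hence adjacency, the Helly property and the numbers of bends survive.  Once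
-- no such column or row is left, all coordinates are below n (2 + k), and with
-- k ≤ n ^ c the coordinates of all points of all paths form a certificate of
-- polynomial size.  By Berge's criterion the Helly property needs to be checked
-- only for triples of edges: the paths through at least two of them must have a
-- common edge.  The certificate conditions then become a formula with bounded
-- quantifiers over numbers that are polynomial in the length of the instance,
-- and such formulas are evaluated in polynomial time by nested loops over
-- counters, a counter being the position of a head on a tape with one mark.

module Submission where

open import Defs
open import Algebra.Properties.AbelianGroup using (∙-cancelˡ)
open import Data.Bool.Base using (Bool; true; false; T; not; if_then_else_)
open import Data.Empty using (⊥-elim)
open import Data.Fin using (#_)
open import Data.Fin.Base using (Fin; zero; suc; toℕ; fromℕ<; remQuot)
import Data.Fin.Properties as Fin
open import Data.Fin.Subset using (Subset; ⁅_⁆) renaming (_∈_ to _∈ₛ_)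
open import Data.Fin.Subset.Properties using (nonempty?; x∈⁅x⁆; x∈⁅y⁆⇒x≡y) renaming (_∈?_ to _∈ₛ?_)
open import Data.Integer.Base as ℤ using (ℤ; 0ℤ; 1ℤ) renaming (+_ to pos)
import Data.Integer.Properties as ℤ
open import Data.List.Base as List using (List; []; _∷_; _++_; length; map; replicate; concat; tabulate; upTo; cartesianProduct; filter; allFin)
open import Data.List.Membership.Propositional using (_∈_; _∉_)
open import Data.List.Membership.Propositional.Properties
  using (∈-map⁺; ∈-map⁻; ∈-++⁺ʳ; ∈-concat⁺′; ∈-tabulate⁺; ∈-upTo⁺; ∈-upTo⁻; ∈-cartesianProduct⁺; ∈-filter⁺; ∈-filter⁻; ∈-allFin; ∈-lookup)
import Data.List.Properties as List
open import Data.List.Relation.Unary.All as All using (All; []; _∷_)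
import Data.List.Relation.Unary.All.Properties as All
open import Data.List.Relation.Unary.AllPairs using ([]; _∷_)
open import Data.List.Relation.Unary.Any as Any using (here; there)
import Data.List.Relation.Unary.Any.Properties as Any
open import Data.List.Relation.Unary.Linked as Linked using (Linked; []; [-]; _∷_)
import Data.List.Relation.Unary.Linked.Properties as Linked
open import Data.List.Relation.Unary.Unique.Propositional using (Unique)
import Data.List.Relation.Unary.Unique.Propositional.Properties as Unique
open import Data.Maybe.Base using (Maybe; just; nothing)
open import Data.Maybe.Properties using (just-injective)
open import Data.Nat.Base using (ℕ; zero; suc; _+_; _*_; _∸_; _^_; _≤_; _<_; _⊓_; _≡ᵇ_; _<ᵇ_; ⌊_/2⌋; pred; z≤n; s≤s; s≤s⁻¹)
open import Data.Nat.Binary.Base as ℕᵇ using (ℕᵇ; 2[1+_]; 1+[2_]; fromℕ)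
open import Data.Nat.Binary.Properties using (fromℕ-toℕ; toℕ-fromℕ)
open import Data.Nat.DivMod
  using (_/_; _%_; +-distrib-/-∣ʳ; m<n⇒m/n≡0; m*n/n≡m; [m+kn]%n≡m%n; m<n⇒m%n≡m; /-monoˡ-≤)
open import Data.Nat.Divisibility using (n∣m*n)
import Data.Nat.Properties as ℕ
open import Data.List.Membership.DecPropositional ℕ._≟_ using (_∈?_)
open import Data.Nat.Solver using (module +-*-Solver)
open +-*-Solver using (solve; _:=_; _:+_; _:*_; con)
open import Data.Product using (∃!)
open import Data.Product.Base using (Σ; _×_; _,_; ∃; ∃-syntax; proj₁; proj₂; -,_; swap)
open import Data.Product.Properties using (≡-dec)
open import Data.Sum.Base as Sum using (_⊎_; inj₁; inj₂; [_,_]′)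
open import Data.Sum.Function.Propositional using (_⊎-↔_)
open import Data.Unit.Base using (⊤; tt)
open import Data.Vec.Base as Vec using (Vec; []; _∷_)
import Data.Vec.Properties as Vec
open import Function.Base using (_∘_; id; _$_; case_of_)
open import Function.Bundles using (_⇔_; Equivalence; Inverse; mk⇔; mk↔ₛ′)
open import Function.Construct.Identity using (↣-id)
open import Function.Properties.Inverse using (↔-sym; ↔-trans)
open import Relation.Binary.Definitions using (tri<; tri≈; tri>)
open import Relation.Binary.PropositionalEquality
  using (_≡_; _≢_; _≗_; refl; sym; trans; cong; cong₂; subst; subst₂; module ≡-Reasoning)
open import Relation.Nullary using (¬_; Dec; yes; no; contradiction)
open import Relation.Nullary.Decidable using (does; dec-true; dec-false; decidable-stable; ¬?; _×-dec_; _⊎-dec_)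

-- Counter programs on Turing machines

-- Machines are met only once, in the simulation of counter programs; all later conditions are
-- written in a small language of terms. Its only loop is a bounded sum: products, truth values and
-- quantifiers are built from sums and truncated subtraction, so one compiler and one pair of
-- polynomial bounds, for values and for time, serve every condition. The language has no recursion,
-- and this shapes the certificate. Numbers are stored in unary, so that reading one is a sum of
-- bits, which is affordable because `k ≤ n ^ c`. The binary `k` of the instance is decoded by
-- letting the certificate list the values of all suffixes of its numeral, each checked against the
-- next. Edge lists are replaced by sequences of points, because the conditions on shared points
-- then become distinctness of points. Contraction merges edges, so families are compared not by
-- bijections of edges but by a weaker relation that still transports adjacency and the Helly
-- property.

cell : Word → ℕ → Maybe Bool
cell []      _       = nothing
cell (b ∷ w) zero    = just b
cell (b ∷ w) (suc i) = cell w i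

-- A counter is the distance of a head from the only non-blank cell of its
-- tape, so that the heads of the input tapes are handled like counters.
counterCell : ℕ → Maybe Bool
counterCell zero    = just true
counterCell (suc _) = nothing

contents : Word → Word → ℕ → ℕ → Maybe Bool
contents x u 0             = cell x
contents x u 1             = cell u
contents x u (suc (suc _)) = counterCell

Store : Set
Store = ℕ → ℕ

unit : ℕ → ℕ → ℕ → ℕ
unit r v i = if i ≡ᵇ r then v else 0

add : ℕ → ℕ → Store → Store
add r v ρ i = unit r v i + ρ i

data Program : Set where
  inc dec    : ℕ → Program
  _⨾_        : Program → Program → Program
  when while : ℕ → (Maybe Bool → Bool) → Program → Program

infixr 5 _⨾_

-- A sum bounds all register numbers as a maximum would, and an upper bound on a sum splits at once
-- into bounds on its parts.
registers : Program → ℕ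
registers (inc r)       = suc r
registers (dec r)       = suc r
registers (p ⨾ q)       = registers p + registers q
registers (when r P p)  = suc r + registers p
registers (while r P p) = suc r + registers p

-- `F r i` is the symbol in cell `i` of tape `r`. Programs only move heads, so the contents are a
-- parameter and the head positions are the whole store.
module Evaluation (F : ℕ → ℕ → Maybe Bool) where

  infix 4 _⊢_⇓_/_
  infixr 5 _then_

  -- The last index counts machine steps exactly. `dec` is derivable only at a positive counter, so
  -- no head passes to the left of its origin. `respect` is a rule because stores are functions and
  -- can be compared only pointwise.
  data _⊢_⇓_/_ : Program → Store → Store → ℕ → Set where
    inc     : ∀ {r ρ} → inc r ⊢ ρ ⇓ add r 1 ρ / 1
    dec     : ∀ {r ρ} → dec r ⊢ add r 1 ρ ⇓ ρ / 1
    _then_  : ∀ {p q ρ ρ′ ρ″ s t} → p ⊢ ρ ⇓ ρ′ / s → q ⊢ ρ′ ⇓ ρ″ / t →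
              p ⨾ q ⊢ ρ ⇓ ρ″ / (s + t)
    when₀   : ∀ {r P p ρ} → P (F r (ρ r)) ≡ false → when r P p ⊢ ρ ⇓ ρ / 1
    when₁   : ∀ {r P p ρ ρ′ t} → P (F r (ρ r)) ≡ true → p ⊢ ρ ⇓ ρ′ / t →
              when r P p ⊢ ρ ⇓ ρ′ / suc t
    while₀  : ∀ {r P p ρ} → P (F r (ρ r)) ≡ false → while r P p ⊢ ρ ⇓ ρ / 1
    while₁  : ∀ {r P p ρ ρ′ ρ″ s t} → P (F r (ρ r)) ≡ true → p ⊢ ρ ⇓ ρ′ / s →
              while r P p ⊢ ρ′ ⇓ ρ″ / t → while r P p ⊢ ρ ⇓ ρ″ / suc (s + t)
    respect : ∀ {p ρ ρ₁ ρ₂ ρ′ t} → ρ ≗ ρ₁ → p ⊢ ρ₁ ⇓ ρ₂ / t → ρ₂ ≗ ρ′ → p ⊢ ρ ⇓ ρ′ / t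

-- Programs as finite-state machines

ControlPoint : Program → Set
ControlPoint (inc r)       = ⊤
ControlPoint (dec r)       = ⊤
ControlPoint (p ⨾ q)       = ControlPoint p ⊎ ControlPoint q
ControlPoint (when r P p)  = ⊤ ⊎ ControlPoint p
ControlPoint (while r P p) = ⊤ ⊎ ControlPoint p

startOf : ∀ p → ControlPoint p
startOf (inc r)       = tt
startOf (dec r)       = tt
startOf (p ⨾ q)       = inj₁ (startOf p)
startOf (when r P p)  = inj₁ tt
startOf (while r P p) = inj₁ tt

⊤-finite : Finite ⊤
⊤-finite = 1 , mk↔ₛ′ (λ _ → zero) (λ _ → tt) (λ { zero → refl }) (λ _ → refl)

⊎-finite : ∀ {A B} → Finite A → Finite B → Finite (A ⊎ B)
⊎-finite (m , f) (n , g) = m + n , ↔-trans (f ⊎-↔ g) (↔-sym Fin.+↔⊎)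

Bool-finite : Finite Bool
Bool-finite = 2 , ↔-sym Fin.2↔Bool

Maybe-finite : ∀ {A} → Finite A → Finite (Maybe A)
Maybe-finite {A} (n , f) = suc n , mk↔ₛ′ to from to-from from-to
  where
  open Inverse f using () renaming (to to to₀; from to from₀)
  to : Maybe A → Fin (suc n)
  to nothing  = zero
  to (just a) = suc (to₀ a)
  from : Fin (suc n) → Maybe A
  from zero    = nothing
  from (suc i) = just (from₀ i)
  to-from : ∀ i → to (from i) ≡ i
  to-from zero    = refl
  to-from (suc i) = cong suc (Inverse.strictlyInverseˡ f i)
  from-to : ∀ a → from (to a) ≡ a
  from-to nothing  = refl
  from-to (just a) = cong just (Inverse.strictlyInverseʳ f a)

ControlPoint-finite : ∀ p → Finite (ControlPoint p)
ControlPoint-finite (inc r)       = ⊤-finite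
ControlPoint-finite (dec r)       = ⊤-finite
ControlPoint-finite (p ⨾ q)       = ⊎-finite (ControlPoint-finite p) (ControlPoint-finite q)
ControlPoint-finite (when r P p)  = ⊎-finite ⊤-finite (ControlPoint-finite p)
ControlPoint-finite (while r P p) = ⊎-finite ⊤-finite (ControlPoint-finite p)

module _ {M : ℕ} where

  Actions : Set
  Actions = Vec (Maybe Bool × Move) M

  idle : Vec (Maybe Bool) M → Actions
  idle = Vec.map (_, stay)

  moving : ℕ → Move → Vec (Maybe Bool) M → Actions
  moving r m ss = Vec.tabulate λ i → Vec.lookup ss i , (if toℕ i ≡ᵇ r then m else stay)

symbolAt : ∀ {M} → ℕ → Vec (Maybe Bool) M → Maybe Bool
symbolAt r       []       = nothing
symbolAt zero    (s ∷ ss) = s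
symbolAt (suc r) (s ∷ ss) = symbolAt r ss

-- nothing is the exit of the program.
transition : ∀ {M} p → ControlPoint p → Vec (Maybe Bool) M → Maybe (ControlPoint p) × Actions {M}
transition (inc r) _ ss = nothing , moving r right ss
transition (dec r) _ ss = nothing , moving r left ss
transition (p ⨾ q) (inj₁ s) ss with transition p s ss
... | just s′ , as = just (inj₁ s′) , as
... | nothing , as = just (inj₂ (startOf q)) , as
transition (p ⨾ q) (inj₂ s) ss with transition q s ss
... | just s′ , as = just (inj₂ s′) , as
... | nothing , as = nothing , as
transition (when r P p) (inj₁ _) ss =
  (if P (symbolAt r ss) then just (inj₂ (startOf p)) else nothing) , idle ss
transition (when r P p) (inj₂ s) ss with transition p s ss
... | just s′ , as = just (inj₂ s′) , as
... | nothing , as = nothing , as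
transition (while r P p) (inj₁ _) ss =
  (if P (symbolAt r ss) then just (inj₂ (startOf p)) else nothing) , idle ss
transition (while r P p) (inj₂ s) ss with transition p s ss
... | just s′ , as = just (inj₂ s′) , as
... | nothing , as = just (inj₁ tt) , as

isBlank : Maybe Bool → Bool
isBlank nothing  = true
isBlank (just _) = false

-- The state `inj₂ (inj₁ false)` marks the origin of every work tape before the program starts, and
-- `inj₂ (inj₁ true)` gives the verdict after it: the result counter is nonzero exactly when its
-- head is off the mark, hence on a blank.
machine : (p : Program) (result K : ℕ) → TuringMachine
machine p result K = record
  { workTapes    = K
  ; State        = Bool ⊎ (Bool ⊎ ControlPoint p)
  ; State-finite = ⊎-finite Bool-finite (⊎-finite Bool-finite (ControlPoint-finite p))
  ; Sym          = Maybe Bool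
  ; Sym-finite   = Maybe-finite Bool-finite
  ; symbol       = ↣-id _
  ; start        = inj₂ (inj₁ false)
  ; verdict      = verdict
  ; δ            = δ
  }
  where
  verdict : Bool ⊎ (Bool ⊎ ControlPoint p) → Maybe Bool
  verdict (inj₁ b) = just b
  verdict (inj₂ _) = nothing

  δ : Bool ⊎ (Bool ⊎ ControlPoint p) → Vec (Maybe Bool) (2 + K) →
      (Bool ⊎ (Bool ⊎ ControlPoint p)) × Vec (Maybe Bool × Move) (2 + K)
  δ (inj₁ b)                ss           = inj₁ b , idle ss
  δ (inj₂ (inj₁ false))     (a ∷ b ∷ ss) =
    inj₂ (inj₂ (startOf p)) , (a , stay) ∷ (b , stay) ∷ Vec.replicate K (just true , stay)
  δ (inj₂ (inj₁ true))      ss           = inj₁ (isBlank (symbolAt result ss)) , idle ss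
  δ (inj₂ (inj₂ s))         ss with transition p s ss
  ... | just s′ , as = inj₂ (inj₂ s′) , as
  ... | nothing , as = inj₂ (inj₁ true) , as

-- Simulation of evaluations by machine runs

module Simulation (p₀ : Program) (result K : ℕ) where

  open Execution (machine p₀ result K)

  -- The list to the right of a head is not determined by the contents, since blanks at its end may
  -- be listed or not. To the left exactly the cells down to the origin are listed, which is why
  -- `HeadAt` has an equation there.
  data Ahead (f : ℕ → Maybe Bool) : ℕ → List (Maybe Bool) → Set where
    []  : ∀ {i} → (∀ j → i ≤ j → f j ≡ nothing) → Ahead f i []
    _∷_ : ∀ {i a as} → a ≡ f i → Ahead f (suc i) as → Ahead f i (a ∷ as)

  behind : (ℕ → Maybe Bool) → ℕ → List (Maybe Bool)
  behind f zero    = []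
  behind f (suc i) = f i ∷ behind f i

  HeadAt : (ℕ → Maybe Bool) → ℕ → Tape → Set
  HeadAt f i (tape ls s rs) = ls ≡ behind f i × s ≡ f i × Ahead f (suc i) rs

  HeadAt-right : ∀ {f i t} → HeadAt f i t → HeadAt f (suc i) (moveTape right t)
  HeadAt-right {t = tape ls s []}       (refl , refl , [] b)   =
    refl , sym (b _ ℕ.≤-refl) , [] λ j h → b j (ℕ.≤-trans (ℕ.n≤1+n _) h)
  HeadAt-right {t = tape ls s (r ∷ rs)} (refl , refl , e ∷ as) = refl , e , as

  HeadAt-left : ∀ {f i t} → HeadAt f (suc i) t → HeadAt f i (moveTape left t)
  HeadAt-left (refl , e , as) = refl , refl , e ∷ as

  Tapes : Set
  Tapes = Vec Tape (2 + K)

  scan : Tapes → Vec (Maybe Bool) (2 + K)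
  scan = Vec.map Tape.scanned

  act : Actions → Tapes → Tapes
  act = Vec.zipWith writeMove

  module _ (F : ℕ → ℕ → Maybe Bool) where

    open Evaluation F

    record Represents (ts : Tapes) (ρ : Store) : Set where
      constructor represents
      field heads : ∀ i → HeadAt (F (toℕ i)) (ρ (toℕ i)) (Vec.lookup ts i)

    -- The final transition yields `nothing` but its actions are still carried out, so an enclosing
    -- program can redirect the control without an extra step.
    data Exits (p : Program) : ControlPoint p → Tapes → ℕ → Tapes → Set where
      exit : ∀ {s ts as} → transition p s (scan ts) ≡ (nothing , as) →
             Exits p s ts 1 (act as ts)
      next : ∀ {s s′ ts as t ts′} → transition p s (scan ts) ≡ (just s′ , as) →
             Exits p s′ (act as ts) t ts′ → Exits p s ts (suc t) ts′

    act-idle : ∀ ts → act (idle (scan ts)) ts ≡ ts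
    act-idle ts = go ts
      where
      go : ∀ {n} (ts : Vec Tape n) →
           Vec.zipWith writeMove (Vec.map (_, stay) (Vec.map Tape.scanned ts)) ts ≡ ts
      go []       = refl
      go (t ∷ ts) = cong (t ∷_) (go ts)

    lookup-moving : ∀ r m ts i → Vec.lookup (act (moving r m (scan ts)) ts) i ≡
                    moveTape (if toℕ i ≡ᵇ r then m else stay) (Vec.lookup ts i)
    lookup-moving r m ts i = begin
      Vec.lookup (act (moving r m (scan ts)) ts) i
        ≡⟨ Vec.lookup-zipWith writeMove i (moving r m (scan ts)) ts ⟩
      writeMove (Vec.lookup (moving r m (scan ts)) i) (Vec.lookup ts i)
        ≡⟨ cong (λ a → writeMove a (Vec.lookup ts i)) (Vec.lookup∘tabulate (λ i → Vec.lookup (scan ts) i , (if toℕ i ≡ᵇ r then m else stay)) i) ⟩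
      writeMove (Vec.lookup (scan ts) i , move) (Vec.lookup ts i)
        ≡⟨ cong (λ s → writeMove (s , move) (Vec.lookup ts i)) (Vec.lookup-map i Tape.scanned ts) ⟩
      moveTape move (Vec.lookup ts i) ∎
      where
      open ≡-Reasoning
      move = if toℕ i ≡ᵇ r then m else stay

    inc-represents : ∀ {r ts ρ} → Represents ts ρ →
                     Represents (act (moving r right (scan ts)) ts) (add r 1 ρ)
    inc-represents {r} {ts} {ρ} (represents R) = represents go
      where
      go : ∀ i → HeadAt (F (toℕ i)) (add r 1 ρ (toℕ i))
                        (Vec.lookup (act (moving r right (scan ts)) ts) i)
      go i rewrite lookup-moving r right ts i with toℕ i ≡ᵇ r
      ... | true  = HeadAt-right (R i)
      ... | false = R i

    dec-represents : ∀ {r ts ρ} → Represents ts (add r 1 ρ) →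
                     Represents (act (moving r left (scan ts)) ts) ρ
    dec-represents {r} {ts} {ρ} (represents R) = represents go
      where
      go : ∀ i → HeadAt (F (toℕ i)) (ρ (toℕ i)) (Vec.lookup (act (moving r left (scan ts)) ts) i)
      go i rewrite lookup-moving r left ts i with toℕ i ≡ᵇ r | R i
      ... | true  | h = HeadAt-left h
      ... | false | h = h

    ≗-represents : ∀ {ts ρ ρ′} → ρ ≗ ρ′ → Represents ts ρ → Represents ts ρ′
    ≗-represents {ts} e (represents R) = represents λ i →
      subst (λ n → HeadAt (F (toℕ i)) n (Vec.lookup ts i)) (e (toℕ i)) (R i)

    symbolAt-scan : ∀ {ts ρ r} → r < 2 + K → Represents ts ρ → symbolAt r (scan ts) ≡ F r (ρ r)
    symbolAt-scan {ts} {ρ} {r} r< (represents R) = trans (go (scan ts) r<) (trans (Vec.lookup-map _ _ ts)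
      (trans (proj₁ (proj₂ (R (fromℕ< r<)))) (cong (λ i → F i (ρ i)) (Fin.toℕ-fromℕ< r<))))
      where
      go : ∀ {n r} (ss : Vec (Maybe Bool) n) (r< : r < n) → symbolAt r ss ≡ Vec.lookup ss (fromℕ< r<)
      go {r = zero}  (s ∷ ss) r< = refl
      go {r = suc r} (s ∷ ss) r< = go ss (s≤s⁻¹ r<)

    embed-first : ∀ {p q s ts t ts′ t′ ts″} → Exits p s ts t ts′ → Exits (p ⨾ q) (inj₂ (startOf q)) ts′ t′ ts″ →
                  Exits (p ⨾ q) (inj₁ s) ts (t + t′) ts″
    embed-first {p} {q} {s} {ts} (exit e) E = next (lemma e) E
      where
      lemma : ∀ {as} → transition p s (scan ts) ≡ (nothing , as) →
              transition (p ⨾ q) (inj₁ s) (scan ts) ≡ (just (inj₂ (startOf q)) , as)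
      lemma e rewrite e = refl
    embed-first {p} {q} {s} {ts} (next e D) E = next (lemma e) (embed-first D E)
      where
      lemma : ∀ {s′ as} → transition p s (scan ts) ≡ (just s′ , as) →
              transition (p ⨾ q) (inj₁ s) (scan ts) ≡ (just (inj₁ s′) , as)
      lemma e rewrite e = refl

    embed-second : ∀ {p q s ts t ts′} → Exits q s ts t ts′ → Exits (p ⨾ q) (inj₂ s) ts t ts′
    embed-second {p} {q} {s} {ts} (exit e) = exit (lemma e)
      where
      lemma : ∀ {as} → transition q s (scan ts) ≡ (nothing , as) →
              transition (p ⨾ q) (inj₂ s) (scan ts) ≡ (nothing , as)
      lemma e rewrite e = refl
    embed-second {p} {q} {s} {ts} (next e D) = next (lemma e) (embed-second D)
      where
      lemma : ∀ {s′ as} → transition q s (scan ts) ≡ (just s′ , as) →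
              transition (p ⨾ q) (inj₂ s) (scan ts) ≡ (just (inj₂ s′) , as)
      lemma e rewrite e = refl

    embed-when : ∀ {r P p s ts t ts′} → Exits p s ts t ts′ → Exits (when r P p) (inj₂ s) ts t ts′
    embed-when {r} {P} {p} {s} {ts} (exit e) = exit (lemma e)
      where
      lemma : ∀ {as} → transition p s (scan ts) ≡ (nothing , as) →
              transition (when r P p) (inj₂ s) (scan ts) ≡ (nothing , as)
      lemma e rewrite e = refl
    embed-when {r} {P} {p} {s} {ts} (next e D) = next (lemma e) (embed-when D)
      where
      lemma : ∀ {s′ as} → transition p s (scan ts) ≡ (just s′ , as) →
              transition (when r P p) (inj₂ s) (scan ts) ≡ (just (inj₂ s′) , as)
      lemma e rewrite e = refl

    embed-while : ∀ {r P p s ts t ts′ t′ ts″} → Exits p s ts t ts′ →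
                  Exits (while r P p) (inj₁ tt) ts′ t′ ts″ →
                  Exits (while r P p) (inj₂ s) ts (t + t′) ts″
    embed-while {r} {P} {p} {s} {ts} (exit e) E = next (lemma e) E
      where
      lemma : ∀ {as} → transition p s (scan ts) ≡ (nothing , as) →
              transition (while r P p) (inj₂ s) (scan ts) ≡ (just (inj₁ tt) , as)
      lemma e rewrite e = refl
    embed-while {r} {P} {p} {s} {ts} (next e D) E = next (lemma e) (embed-while D E)
      where
      lemma : ∀ {s′ as} → transition p s (scan ts) ≡ (just s′ , as) →
              transition (while r P p) (inj₂ s) (scan ts) ≡ (just (inj₂ s′) , as)
      lemma e rewrite e = refl

    branch : ∀ {A : Set} {P : Maybe Bool → Bool} {r ts ρ b} {a a′ : A} {as : Actions {2 + K}} →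
             r < 2 + K → Represents ts ρ → P (F r (ρ r)) ≡ b →
             ((if P (symbolAt r (scan ts)) then a else a′) , as) ≡ ((if b then a else a′) , as)
    branch {P = P} {a = a} {a′} {as} r< R e =
      cong (λ c → (if c then a else a′) , as) (trans (cong P (symbolAt-scan r< R)) e)

    -- Induction on the evaluation. A test writes back what it scans and moves nothing, and the exit
    -- of a loop body leads straight back to the test, so each rule costs the steps of its index.
    simulate : ∀ {p ρ ρ′ t ts} → p ⊢ ρ ⇓ ρ′ / t → registers p ≤ 2 + K → Represents ts ρ →
               ∃[ ts′ ] Exits p (startOf p) ts t ts′ × Represents ts′ ρ′
    simulate inc r≤ R = -, exit refl , inc-represents R
    simulate dec r≤ R = -, exit refl , dec-represents R
    simulate {p ⨾ q} (D then E) r≤ R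
      with _ , X , R₁ ← simulate D (ℕ.m+n≤o⇒m≤o _ r≤) R
      with _ , Y , R₂ ← simulate E (ℕ.m+n≤o⇒n≤o (registers p) r≤) R₁
      = -, embed-first X (embed-second Y) , R₂
    simulate {when r P p} {ts = ts} (when₀ e) r≤ R =
      -, subst (Exits _ _ _ _) (act-idle ts) (exit (branch {P = P} (ℕ.m+n≤o⇒m≤o _ r≤) R e)) , R
    simulate {when r P p} {ts = ts} (when₁ e D) r≤ R
      with _ , X , R₁ ← simulate {ts = ts} D (ℕ.m+n≤o⇒n≤o (suc r) r≤) R
      = -, next (branch {P = P} (ℕ.m+n≤o⇒m≤o _ r≤) R e)
             (embed-when (subst (λ ts → Exits _ _ ts _ _) (sym (act-idle ts)) X)) , R₁
    simulate {while r P p} {ts = ts} (while₀ e) r≤ R =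
      -, subst (Exits _ _ _ _) (act-idle ts) (exit (branch {P = P} (ℕ.m+n≤o⇒m≤o _ r≤) R e)) , R
    simulate {while r P p} {ts = ts} (while₁ e D E) r≤ R
      with _ , X , R₁ ← simulate {ts = ts} D (ℕ.m+n≤o⇒n≤o (suc r) r≤) R
      with _ , Y , R₂ ← simulate E r≤ R₁
      = -, next (branch {P = P} (ℕ.m+n≤o⇒m≤o _ r≤) R e)
             (embed-while (subst (λ ts → Exits _ _ ts _ _) (sym (act-idle ts)) X) Y) , R₂
    simulate (respect e D e′) r≤ R
      with _ , X , R₁ ← simulate D r≤ (≗-represents e R)
      = -, X , ≗-represents e′ R₁

    run-Exits : ∀ {s ts t ts′} → Exits p₀ s ts t ts′ →
                run t (inj₂ (inj₂ s) , ts) ≡ (inj₂ (inj₁ true) , ts′)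
    run-Exits {s} {ts} (exit e) rewrite e = refl
    run-Exits {s} {ts} (next e D) rewrite e = run-Exits D

  run-+ : ∀ s t c → run (s + t) c ≡ run t (run s c)
  run-+ zero    t c = refl
  run-+ (suc s) t c = run-+ s t (step c)

  verdictOf : Config → Maybe Bool
  verdictOf (q , _) = TuringMachine.verdict (machine p₀ result K) q

  verdict-persists : ∀ {b} t c → verdictOf c ≡ just b → verdictOf (run t c) ≡ just b
  verdict-persists zero    c              e = e
  verdict-persists (suc t) (inj₁ b , ts)  e = verdict-persists t (inj₁ b , ts) e

  Ahead-cells : ∀ w i f → (∀ j → f (i + j) ≡ cell w j) → Ahead f i (map just w)
  Ahead-cells []      i f h = [] λ j i≤j → trans (cong f (sym (ℕ.m+[n∸m]≡n i≤j))) (h (j ∸ i))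
  Ahead-cells (b ∷ w) i f h = sym (trans (cong f (sym (ℕ.+-identityʳ i))) (h 0)) ∷
    Ahead-cells w (suc i) f λ j → trans (cong f (sym (ℕ.+-suc i j))) (h (suc j))

  HeadAt-input : ∀ w → HeadAt (cell w) 0 (inputTape w)
  HeadAt-input []      = refl , refl , [] λ _ _ → refl
  HeadAt-input (b ∷ w) = refl , refl , Ahead-cells w 1 (cell (b ∷ w)) λ _ → refl

  module _ {x u : Word} {ρ t} (D : Evaluation._⊢_⇓_/_ (contents x u) p₀ (λ _ → 0) ρ t)
           (p≤ : registers p₀ ≤ 2 + K) (r< : result < 2 + K) where

    private
      ts₀ : Tapes
      ts₀ = inputTape x ∷ inputTape u ∷ Vec.replicate K (tape [] (just true) [])

      represents₀ : Represents (contents x u) ts₀ (λ _ → 0)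
      represents₀ = represents λ where
        zero          → HeadAt-input x
        (suc zero)    → HeadAt-input u
        (suc (suc i)) → subst (HeadAt counterCell 0) (sym (Vec.lookup-replicate i _))
                          (refl , refl , [] λ { (suc j) _ → refl })

      first-step : step (initial x u) ≡ (inj₂ (inj₂ (startOf p₀)) , ts₀)
      first-step = trans (cong₂ (λ a b → inj₂ (inj₂ (startOf p₀)) , a ∷ b ∷
                     Vec.zipWith writeMove (Vec.replicate K (just true , stay)) (Vec.replicate K (tape [] nothing [])))
                     (rewritten x) (rewritten u))
                   (cong (λ ts → inj₂ (inj₂ (startOf p₀)) , inputTape x ∷ inputTape u ∷ ts) (marked K))
        where
        rewritten : ∀ w → writeMove (Tape.scanned (inputTape w) , stay) (inputTape w) ≡ inputTape w
        rewritten []      = refl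
        rewritten (b ∷ w) = refl
        marked : ∀ n → Vec.zipWith writeMove (Vec.replicate n (just true , stay))
                 (Vec.replicate n (tape [] nothing [])) ≡ Vec.replicate n (tape [] (just true) [])
        marked zero    = refl
        marked (suc n) = cong (_ ∷_) (marked n)

    -- One step marks the work tapes, `t` steps run the program and one step reads the result.
    halts : HaltsWithin (suc (t + 1)) x u (isBlank (contents x u result (ρ result)))
    halts with ts′ , X , R ← simulate (contents x u) D p≤ represents₀ = begin
      verdictOf (run (t + 1) (step (initial x u)))
        ≡⟨ cong (λ c → verdictOf (run (t + 1) c)) first-step ⟩
      verdictOf (run (t + 1) (inj₂ (inj₂ (startOf p₀)) , ts₀))
        ≡⟨ cong verdictOf (run-+ t 1 _) ⟩
      verdictOf (run 1 (run t (inj₂ (inj₂ (startOf p₀)) , ts₀)))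
        ≡⟨ cong (λ c → verdictOf (run 1 c)) (run-Exits _ X) ⟩
      just (isBlank (symbolAt result (scan ts′)))
        ≡⟨ cong (λ s → just (isBlank s)) (symbolAt-scan _ r< R) ⟩
      just (isBlank (contents x u result (ρ result))) ∎
      where open ≡-Reasoning

  halts-later : ∀ {s t x u b} → s ≤ t → HaltsWithin s x u b → HaltsWithin t x u b
  halts-later {s} {t} {x} {u} s≤t h = subst (λ n → HaltsWithin n x u _) (ℕ.m+[n∸m]≡n s≤t)
    (trans (cong verdictOf (run-+ s (t ∸ s) (initial x u)))
           (verdict-persists (t ∸ s) (run s (initial x u)) h))

  -- Acceptance allows any number of steps. As verdicts persist, two runs can be compared at a
  -- common later time, and the verdict within the proven time bound is decisive.
  verdict-unique : ∀ {s t x u b b′} → HaltsWithin s x u b → HaltsWithin t x u b′ → b ≡ b′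
  verdict-unique {s} {t} {x} {u} h h′ with trans (sym (halts-later {t = s + t} {x} {u} (ℕ.m≤m+n s t) h))
    (halts-later {t = s + t} {x} {u} (ℕ.m≤n+m t s) h′)
  ... | refl = refl

-- Polynomial bounds

infixl 6 _⊕_
infixl 7 _⊗_

_⊕_ : Polynomial → Polynomial → Polynomial
[]      ⊕ q       = q
(a ∷ p) ⊕ []      = a ∷ p
(a ∷ p) ⊕ (b ∷ q) = a + b ∷ p ⊕ q

scale : ℕ → Polynomial → Polynomial
scale a = map (a *_)

_⊗_ : Polynomial → Polynomial → Polynomial
[]      ⊗ q = []
(a ∷ p) ⊗ q = scale a q ⊕ (0 ∷ p ⊗ q)

substitute : Polynomial → Polynomial → Polynomial
substitute []      q = []
substitute (a ∷ p) q = (a ∷ []) ⊕ q ⊗ substitute p q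

⟦⊕⟧ : ∀ p q n → ⟦ p ⊕ q ⟧ n ≡ ⟦ p ⟧ n + ⟦ q ⟧ n
⟦⊕⟧ []      q       n = refl
⟦⊕⟧ (a ∷ p) []      n = sym (ℕ.+-identityʳ _)
⟦⊕⟧ (a ∷ p) (b ∷ q) n rewrite ⟦⊕⟧ p q n =
  solve 5 (λ a b n p q → a :+ b :+ n :* (p :+ q) := a :+ n :* p :+ (b :+ n :* q)) refl
    a b n (⟦ p ⟧ n) (⟦ q ⟧ n)

⟦scale⟧ : ∀ a p n → ⟦ scale a p ⟧ n ≡ a * ⟦ p ⟧ n
⟦scale⟧ a []      n = sym (ℕ.*-zeroʳ a)
⟦scale⟧ a (b ∷ p) n rewrite ⟦scale⟧ a p n =
  solve 4 (λ a b n p → a :* b :+ n :* (a :* p) := a :* (b :+ n :* p)) refl a b n (⟦ p ⟧ n)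

⟦⊗⟧ : ∀ p q n → ⟦ p ⊗ q ⟧ n ≡ ⟦ p ⟧ n * ⟦ q ⟧ n
⟦⊗⟧ []      q n = refl
⟦⊗⟧ (a ∷ p) q n rewrite ⟦⊕⟧ (scale a q) (0 ∷ p ⊗ q) n | ⟦scale⟧ a q n | ⟦⊗⟧ p q n =
  solve 4 (λ a n p q → a :* q :+ n :* (p :* q) := (a :+ n :* p) :* q) refl a n (⟦ p ⟧ n) (⟦ q ⟧ n)

⟦substitute⟧ : ∀ p q n → ⟦ substitute p q ⟧ n ≡ ⟦ p ⟧ (⟦ q ⟧ n)
⟦substitute⟧ []      q n = refl
⟦substitute⟧ (a ∷ p) q n rewrite ⟦⊕⟧ (a ∷ []) (q ⊗ substitute p q) n
  | ⟦⊗⟧ q (substitute p q) n | ⟦substitute⟧ p q n | ℕ.*-zeroʳ n | ℕ.+-identityʳ a = refl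

⟦⟧-mono : ∀ p {m n} → m ≤ n → ⟦ p ⟧ m ≤ ⟦ p ⟧ n
⟦⟧-mono []      m≤n = z≤n
⟦⟧-mono (a ∷ p) m≤n = ℕ.+-monoʳ-≤ a (ℕ.*-mono-≤ m≤n (⟦⟧-mono p m≤n))

-- Equality instead of an inequality makes closure under composition hold without a monotonicity
-- assumption.
IsPolynomial : (ℕ → ℕ) → Set
IsPolynomial f = ∃[ p ] ∀ n → f n ≡ ⟦ p ⟧ n

poly-const : ∀ c → IsPolynomial λ _ → c
poly-const c = c ∷ [] , λ n → sym (trans (cong (c +_) (ℕ.*-zeroʳ n)) (ℕ.+-identityʳ c))

poly-id : IsPolynomial λ n → n
poly-id = 0 ∷ 1 ∷ [] , λ n → sym (trans (cong (n *_) (cong suc (ℕ.*-zeroʳ n))) (ℕ.*-identityʳ n))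

poly-+ : ∀ {f g} → IsPolynomial f → IsPolynomial g → IsPolynomial λ n → f n + g n
poly-+ (p , e) (q , e′) = p ⊕ q , λ n → trans (cong₂ _+_ (e n) (e′ n)) (sym (⟦⊕⟧ p q n))

poly-* : ∀ {f g} → IsPolynomial f → IsPolynomial g → IsPolynomial λ n → f n * g n
poly-* (p , e) (q , e′) = p ⊗ q , λ n → trans (cong₂ _*_ (e n) (e′ n)) (sym (⟦⊗⟧ p q n))

poly-∘ : ∀ {f g} → IsPolynomial f → IsPolynomial g → IsPolynomial λ n → f (g n)
poly-∘ {f} (p , e) (q , e′) = substitute p q , λ n →
  trans (cong f (e′ n)) (trans (e _) (sym (⟦substitute⟧ p q n)))

-- Arithmetic terms over a pair of words

data Input : Set where
  instance′ certificate : Input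

tapeOf : Input → ℕ
tapeOf instance′   = 0
tapeOf certificate = 1

-- Only `sum` binds a variable. Renaming is a constructor so that weakening compiles to a mere
-- change of the register assignment and disappears definitionally under evaluation.
data Term (n : ℕ) : Set where
  var : Fin n → Term n
  one : Term n
  _⊞_ : Term n → Term n → Term n
  _⊟_ : Term n → Term n → Term n
  sum : Term n → Term (suc n) → Term n
  bit : Input → Bool → Term n → Term n
  ren : ∀ {k} → (Fin k → Fin n) → Term k → Term n

infixl 6 _⊞_ _⊟_

Env : ℕ → Set
Env n = Fin n → ℕ

infixr 5 _▸_

_▸_ : ∀ {n} → ℕ → Env n → Env (suc n)
(a ▸ ρ) zero    = a
(a ▸ ρ) (suc i) = ρ i

sumBelow : ℕ → (ℕ → ℕ) → ℕ
sumBelow zero    f = 0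
sumBelow (suc n) f = sumBelow n f + f n

isBit : Bool → Maybe Bool → Bool
isBit true  (just true)  = true
isBit false (just false) = true
isBit _     _            = false

fromBool : Bool → ℕ
fromBool b = if b then 1 else 0

module Semantics (x u : Word) where

  wordOf : Input → Word
  wordOf instance′   = x
  wordOf certificate = u

  eval : ∀ {n} → Term n → Env n → ℕ
  eval (var i)     ρ = ρ i
  eval one         ρ = 1
  eval (t ⊞ s)     ρ = eval t ρ + eval s ρ
  eval (t ⊟ s)     ρ = eval t ρ ∸ eval s ρ
  eval (sum t s)   ρ = sumBelow (eval t ρ) λ i → eval s (i ▸ ρ)
  eval (bit a β t) ρ = fromBool (isBit β (cell (wordOf a) (eval t ρ)))
  eval (ren f t)   ρ = eval t (ρ ∘ f)

sumBelow-cong : ∀ n {f g : ℕ → ℕ} → f ≗ g → sumBelow n f ≡ sumBelow n g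
sumBelow-cong zero    e = refl
sumBelow-cong (suc n) e = cong₂ _+_ (sumBelow-cong n e) (e n)

sumBelow-≤ : ∀ n {f : ℕ → ℕ} {c} → (∀ i → i < n → f i ≤ c) → sumBelow n f ≤ n * c
sumBelow-≤ zero    h = z≤n
sumBelow-≤ (suc n) {f} {c} h = subst (sumBelow n f + f n ≤_) (ℕ.+-comm (n * c) c)
  (ℕ.+-mono-≤ (sumBelow-≤ n λ i i<n → h i (ℕ.m<n⇒m<1+n i<n)) (h n ℕ.≤-refl))

valueBound : ∀ {n} → Term n → ℕ → ℕ
valueBound (var i)     B = B
valueBound one         B = 1
valueBound (t ⊞ s)     B = valueBound t B + valueBound s B
valueBound (t ⊟ s)     B = valueBound t B
-- The index stays below the value of `t`. Adding its bound to `B`, where a maximum would do, stays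
-- within polynomials.
valueBound (sum t s)   B = valueBound t B * valueBound s (B + valueBound t B)
valueBound (bit a β t) B = 1
valueBound (ren f t)   B = valueBound t B

valueBound-poly : ∀ {n} (t : Term n) → IsPolynomial (valueBound t)
valueBound-poly (var i)     = poly-id
valueBound-poly one         = poly-const 1
valueBound-poly (t ⊞ s)     = poly-+ (valueBound-poly t) (valueBound-poly s)
valueBound-poly (t ⊟ s)     = valueBound-poly t
valueBound-poly (sum t s)   = poly-* (valueBound-poly t)
  (poly-∘ (valueBound-poly s) (poly-+ poly-id (valueBound-poly t)))
valueBound-poly (bit a β t) = poly-const 1
valueBound-poly (ren f t)   = valueBound-poly t

fromBool-≤ : ∀ b → fromBool b ≤ 1
fromBool-≤ true  = ℕ.≤-refl
fromBool-≤ false = z≤n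

▸-≤ : ∀ {n B C i} {ρ : Env n} → i < C → (∀ j → ρ j ≤ B) → ∀ j → (i ▸ ρ) j ≤ B + C
▸-≤ {B = B} i<C h zero    = ℕ.≤-trans (ℕ.<⇒≤ i<C) (ℕ.m≤n+m _ B)
▸-≤         i<C h (suc j) = ℕ.≤-trans (h j) (ℕ.m≤m+n _ _)

module _ {x u : Word} where

  open Semantics x u

  eval-cong : ∀ {n} (t : Term n) {ρ ρ′} → ρ ≗ ρ′ → eval t ρ ≡ eval t ρ′
  eval-cong (var i)     e = e i
  eval-cong one         e = refl
  eval-cong (t ⊞ s)     e = cong₂ _+_ (eval-cong t e) (eval-cong s e)
  eval-cong (t ⊟ s)     e = cong₂ _∸_ (eval-cong t e) (eval-cong s e)
  eval-cong (sum t s) {ρ} {ρ′} e = trans (cong (λ n → sumBelow n λ i → eval s (i ▸ ρ)) (eval-cong t e))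
    (sumBelow-cong (eval t ρ′) λ i → eval-cong s λ { zero → refl ; (suc j) → e j })
  eval-cong (bit a β t) e = cong (fromBool ∘ isBit β ∘ cell (wordOf a)) (eval-cong t e)
  eval-cong (ren f t)   e = eval-cong t (e ∘ f)

  eval-≤ : ∀ {n} (t : Term n) {ρ B} → (∀ i → ρ i ≤ B) → eval t ρ ≤ valueBound t B
  eval-≤ (var i)     h = h i
  eval-≤ one         h = ℕ.≤-refl
  eval-≤ (t ⊞ s)     h = ℕ.+-mono-≤ (eval-≤ t h) (eval-≤ s h)
  eval-≤ (t ⊟ s)     {ρ} h = ℕ.≤-trans (ℕ.m∸n≤m _ (eval s ρ)) (eval-≤ t h)
  eval-≤ (sum t s)   {ρ} h = ℕ.≤-trans
    (sumBelow-≤ (eval t ρ) λ i i< → eval-≤ s (▸-≤ (ℕ.<-≤-trans i< (eval-≤ t h)) h))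
    (ℕ.*-monoˡ-≤ _ (eval-≤ t h))
  eval-≤ (bit a β t) h = fromBool-≤ _
  eval-≤ (ren f t)   h = eval-≤ t (h ∘ f)

-- Compilation of terms to counter programs

skip : Program
skip = when 0 (λ _ → false) (inc 0)

countdown : ℕ → Program → Program
countdown r p = while r isBlank (dec r ⨾ p)

-- Variable `i` sits in register `e i`, the registers from `b` on are zero, and the value is added
-- to register `d` while everything else is restored. Because results accumulate, `⊞` is mere
-- sequencing and a sum just repeats its summand.
compile : ∀ {n} → Term n → (Fin n → ℕ) → (fresh result : ℕ) → Program
-- Counting a register down destroys it, so a copy is made in `b` on the way and moved back
-- afterwards.
compile (var i)     e b d = countdown (e i) (inc d ⨾ inc b) ⨾ countdown b (inc (e i))
compile one         e b d = inc d
compile (t ⊞ s)     e b d = compile t e b d ⨾ compile s e b d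
compile (t ⊟ s)     e b d = compile t e (1 + b) b ⨾ compile s e (2 + b) (1 + b) ⨾
  countdown (1 + b) (when b isBlank (dec b)) ⨾ countdown b (inc d)
compile (sum t s)   e b d = compile t e (1 + b) b ⨾
  countdown b (compile s ((1 + b) ▸ e) (2 + b) d ⨾ inc (1 + b)) ⨾ countdown (1 + b) skip
compile (bit a β t) e b d = compile t e (1 + b) b ⨾
  -- The input head walks to the queried cell, and `1 + b` remembers the distance for the way back.
  countdown b (inc (1 + b) ⨾ inc (tapeOf a)) ⨾
  when (tapeOf a) (isBit β) (inc d) ⨾ countdown (1 + b) (dec (tapeOf a))
compile (ren f t)   e b d = compile t (e ∘ f) b d

-- A turn of a countdown costs one step for the test, one for `dec` and the cost of the body: the
-- factors 4 and 3 belong to bodies of cost at most 2 and 1. The last, failing test is the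
-- additional 1.
timeBound : ∀ {n} → Term n → ℕ → ℕ
timeBound (var i)     B = (B * 4 + 1) + (B * 3 + 1)
timeBound one         B = 1
timeBound (t ⊞ s)     B = timeBound t B + timeBound s B
timeBound (t ⊟ s)     B =
  timeBound t B + (timeBound s B + ((valueBound s B * 4 + 1) + (valueBound t B * 3 + 1)))
timeBound (sum t s)   B = timeBound t B +
  ((valueBound t B * (2 + (timeBound s (B + valueBound t B) + 1)) + 1) + (valueBound t B * 3 + 1))
timeBound (bit a β t) B =
  timeBound t B + ((valueBound t B * 4 + 1) + (2 + (valueBound t B * 3 + 1)))
timeBound (ren f t)   B = timeBound t B

poly-linear : ∀ {f} c → IsPolynomial f → IsPolynomial λ n → f n * c + 1
poly-linear c p = poly-+ (poly-* p (poly-const c)) (poly-const 1)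

timeBound-poly : ∀ {n} (t : Term n) → IsPolynomial (timeBound t)
timeBound-poly (var i)     = poly-+ (poly-linear 4 poly-id) (poly-linear 3 poly-id)
timeBound-poly one         = poly-const 1
timeBound-poly (t ⊞ s)     = poly-+ (timeBound-poly t) (timeBound-poly s)
timeBound-poly (t ⊟ s)     = poly-+ (timeBound-poly t) (poly-+ (timeBound-poly s)
  (poly-+ (poly-linear 4 (valueBound-poly s)) (poly-linear 3 (valueBound-poly t))))
timeBound-poly (sum t s)   = poly-+ (timeBound-poly t) (poly-+
  (poly-+ (poly-* (valueBound-poly t) (poly-+ (poly-const 2) (poly-+
    (poly-∘ (timeBound-poly s) (poly-+ poly-id (valueBound-poly t))) (poly-const 1)))) (poly-const 1))
  (poly-linear 3 (valueBound-poly t)))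
timeBound-poly (bit a β t) = poly-+ (timeBound-poly t)
  (poly-+ (poly-linear 4 (valueBound-poly t)) (poly-+ (poly-const 2) (poly-linear 3 (valueBound-poly t))))
timeBound-poly (ren f t)   = timeBound-poly t

-- Stores as sums of unit vectors

unit-self : ∀ r v → unit r v r ≡ v
unit-self r v rewrite dec-true (r ℕ.≟ r) refl = refl

unit-other : ∀ {r i} v → i ≢ r → unit r v i ≡ 0
unit-other {r} {i} v i≢r rewrite dec-false (i ℕ.≟ r) i≢r = refl

unit-+ : ∀ r v w i → unit r (v + w) i ≡ unit r v i + unit r w i
unit-+ r v w i with i ≡ᵇ r
... | true  = refl
... | false = refl

unit-0 : ∀ r i → unit r 0 i ≡ 0
unit-0 r i with i ≡ᵇ r
... | true  = refl
... | false = refl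

add-0 : ∀ r ρ → add r 0 ρ ≗ ρ
add-0 r ρ i = cong (_+ ρ i) (unit-0 r i)

add-cong : ∀ r v {ρ ρ′} → ρ ≗ ρ′ → add r v ρ ≗ add r v ρ′
add-cong r v e i = cong (unit r v i +_) (e i)

add-comm : ∀ r v s w ρ → add r v (add s w ρ) ≗ add s w (add r v ρ)
add-comm r v s w ρ i = solve 3 (λ a b c → a :+ (b :+ c) := b :+ (a :+ c)) refl
  (unit r v i) (unit s w i) (ρ i)

add-+ : ∀ r v w ρ → add r v (add r w ρ) ≗ add r (v + w) ρ
add-+ r v w ρ i = trans (sym (ℕ.+-assoc (unit r v i) _ _)) (cong (_+ ρ i) (sym (unit-+ r v w i)))

add-self : ∀ r v {ρ} → ρ r ≡ 0 → add r v ρ r ≡ v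
add-self r v e = trans (cong₂ _+_ (unit-self r v) e) (ℕ.+-identityʳ v)

add-other : ∀ {r i} v ρ → i ≢ r → add r v ρ i ≡ ρ i
add-other v ρ i≢r = cong (_+ ρ _) (unit-other v i≢r)

_≗∙_ : {f g h : Store} → f ≗ g → g ≗ h → f ≗ h
(e ≗∙ e′) i = trans (e i) (e′ i)

infixr 4 _≗∙_

≗-sym : {f g : Store} → f ≗ g → g ≗ f
≗-sym e i = sym (e i)

clear : ℕ → Store → Store
clear r ρ i = if i ≡ᵇ r then 0 else ρ i

clear-self : ∀ r ρ → clear r ρ r ≡ 0
clear-self r ρ rewrite dec-true (r ℕ.≟ r) refl = refl

add-clear : ∀ r ρ → ρ ≗ add r (ρ r) (clear r ρ)
add-clear r ρ i with i ℕ.≟ r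
... | yes refl rewrite dec-true (i ℕ.≟ i) refl = sym (ℕ.+-identityʳ (ρ i))
... | no i≢r   rewrite dec-false (i ℕ.≟ r) i≢r = refl

-- Correctness and running time of compiled terms

module Correctness (x u : Word) where

  open Evaluation (contents x u)
  open Semantics x u

  Runs : Program → Store → Store → ℕ → Set
  Runs p ρ ρ′ c = ∃[ s ] s ≤ c × p ⊢ ρ ⇓ ρ′ / s

  run-inc : ∀ {r ρ} → Runs (inc r) ρ (add r 1 ρ) 1
  run-inc = -, ℕ.≤-refl , inc

  run-dec : ∀ {r ρ} → Runs (dec r) (add r 1 ρ) ρ 1
  run-dec = -, ℕ.≤-refl , dec

  run-skip : ∀ {ρ} → Runs skip ρ ρ 1
  run-skip = -, ℕ.≤-refl , when₀ refl

  run-then : ∀ {p q ρ ρ′ ρ″ c c′} → Runs p ρ ρ′ c → Runs q ρ′ ρ″ c′ → Runs (p ⨾ q) ρ ρ″ (c + c′)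
  run-then (_ , s≤ , D) (_ , t≤ , E) = -, ℕ.+-mono-≤ s≤ t≤ , (D then E)

  run-respect : ∀ {p ρ ρ₁ ρ₂ ρ′ c} → ρ ≗ ρ₁ → Runs p ρ₁ ρ₂ c → ρ₂ ≗ ρ′ → Runs p ρ ρ′ c
  run-respect e (_ , s≤ , D) e′ = -, s≤ , respect e D e′

  run-≤ : ∀ {p ρ ρ′ c c′} → c ≤ c′ → Runs p ρ ρ′ c → Runs p ρ ρ′ c′
  run-≤ c≤ (_ , s≤ , D) = -, ℕ.≤-trans s≤ c≤ , D

  counter-nonzero : ∀ {r n} → 2 ≤ r → isBlank (contents x u r (suc n)) ≡ true
  counter-nonzero (s≤s (s≤s _)) = refl

  counter-zero : ∀ {r} → 2 ≤ r → isBlank (contents x u r 0) ≡ false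
  counter-zero (s≤s (s≤s _)) = refl

  -- `σ i` is the store after `i` turns with the counter `r` itself taken out; the number `j` of
  -- turns still to come is added on top of it.
  module _ {r p c} (σ : ℕ → Store) {n} (2≤r : 2 ≤ r) (zero-r : ∀ i → σ i r ≡ 0)
           (body : ∀ i j → i + suc j ≡ n → Runs p (add r j (σ i)) (add r j (σ (suc i))) c) where

    private
      iterate : ∀ i j → i + j ≡ n → Runs (countdown r p) (add r j (σ i)) (σ n) (j * (2 + c) + 1)
      iterate i zero e = -, ℕ.≤-refl , respect (λ _ → refl) (while₀ stop)
        (add-0 r (σ i) ≗∙ λ k → cong (λ m → σ m k) (trans (sym (ℕ.+-identityʳ i)) e))
        where
        stop : isBlank (contents x u r (add r 0 (σ i) r)) ≡ false
        stop = trans (cong (isBlank ∘ contents x u r) (add-self r 0 {σ i} (zero-r i))) (counter-zero 2≤r)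
      iterate i (suc j) e
        with _ , s≤ , D ← run-then (run-respect (≗-sym (add-+ r 1 j (σ i))) run-dec (λ _ → refl)) (body i j e)
        with _ , t≤ , E ← iterate (suc i) j (trans (sym (ℕ.+-suc i j)) e)
        = -, s≤s (ℕ.≤-trans (ℕ.+-mono-≤ s≤ t≤) (ℕ.≤-reflexive (sym (ℕ.+-assoc (suc c) _ 1)))) , while₁ go D E
        where
        go : isBlank (contents x u r (add r (suc j) (σ i) r)) ≡ true
        go = trans (cong (isBlank ∘ contents x u r) (add-self r (suc j) {σ i} (zero-r i))) (counter-nonzero 2≤r)

    run-countdown : Runs (countdown r p) (add r n (σ 0)) (σ n) (n * (2 + c) + 1)
    run-countdown = iterate 0 n refl

  loop-≤ : ∀ {m n} c → m ≤ n → m * c + 1 ≤ n * c + 1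
  loop-≤ c m≤n = ℕ.+-monoˡ-≤ 1 (ℕ.*-monoˡ-≤ c m≤n)

  -- The invariant under which compiled code may run. `home` places both input heads on their first
  -- cells, from which a `bit` query counts.
  record Frame {n} (e : Fin n → ℕ) (b d : ℕ) (ρ : Store) : Set where
    field
      vars-≥    : ∀ i → 2 ≤ e i
      vars-<    : ∀ i → e i < b
      result-≥  : 2 ≤ d
      result-<  : d < b
      disjoint  : ∀ i → e i ≢ d
      fresh     : ∀ r → b ≤ r → ρ r ≡ 0
      home      : ∀ a → ρ (tapeOf a) ≡ 0

    2≤b : 2 ≤ b
    2≤b = ℕ.≤-trans result-≥ (ℕ.<⇒≤ result-<)

  <⇒≢′ : ∀ {m n} → m < n → n ≢ m
  <⇒≢′ m<n refl = ℕ.<-irrefl refl m<n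

  tape< : ∀ a {r} → 2 ≤ r → tapeOf a ≢ r
  tape< instance′   (s≤s (s≤s _)) ()
  tape< certificate (s≤s (s≤s _)) ()

  Frame-fresh : ∀ {n} {e : Fin n → ℕ} {b d ρ r} → Frame e b d ρ → b ≤ r → Frame e (suc r) r ρ
  Frame-fresh {b = b} F b≤r = record
    { vars-≥ = vars-≥ ; vars-< = λ i → ℕ.<-trans (vars-< i) (s≤s b≤r)
    ; result-≥ = ℕ.≤-trans 2≤b b≤r ; result-< = ℕ.≤-refl
    ; disjoint = λ i h → ℕ.<-irrefl h (ℕ.<-≤-trans (vars-< i) b≤r)
    ; fresh = λ s s≥ → fresh s (ℕ.≤-trans b≤r (ℕ.<⇒≤ s≥)) ; home = home }
    where open Frame F

  Frame-add : ∀ {n} {e : Fin n → ℕ} {b d ρ r} v → Frame e b d ρ → 2 ≤ r → r < b → Frame e b d (add r v ρ)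
  Frame-add {ρ = ρ} v F 2≤r r<b = record
    { vars-≥ = vars-≥ ; vars-< = vars-< ; result-≥ = result-≥ ; result-< = result-< ; disjoint = disjoint
    ; fresh = λ s s≥ → trans (add-other v ρ (<⇒≢′ (ℕ.<-≤-trans r<b s≥))) (fresh s s≥)
    ; home = λ a → trans (add-other v ρ (tape< a 2≤r)) (home a) }
    where open Frame F

  -- Induction on the term. Wherever there are two countdowns, `σ` and `τ` are their loop
  -- invariants.
  compile-runs : ∀ {n} (t : Term n) {e b d ρ B} → Frame e b d ρ → (∀ i → ρ (e i) ≤ B) →
                 Runs (compile t e b d) ρ (add d (eval t (ρ ∘ e)) ρ) (timeBound t B)
  compile-runs (var i) {e} {b} {d} {ρ} F h =
    run-then (run-≤ (loop-≤ 4 (h i)) (run-respect (add-clear r ρ ≗∙ add-cong r v (≗-sym (add-0 d _ ≗∙ add-0 b ρ₀)))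
               (run-countdown σ (vars-≥ i) zero₁ body₁) λ _ → refl))
             (run-≤ (loop-≤ 3 (h i)) (run-respect (add-comm d v b v ρ₀ ≗∙ add-cong b v (add-cong d v (≗-sym (add-0 r ρ₀))))
               (run-countdown τ 2≤b zero₂ body₂) (add-cong d v (≗-sym (add-clear r ρ)))))
    where
    open Frame F
    r = e i
    v = ρ r
    ρ₀ = clear r ρ
    b≢r = <⇒≢′ (vars-< i)
    σ τ : ℕ → Store
    σ m = add d m (add b m ρ₀)
    τ m = add d v (add r m ρ₀)
    zero₁ : ∀ m → σ m r ≡ 0
    zero₁ m = trans (add-other {d} {r} m (add b m ρ₀) (disjoint i)) (trans (add-other {b} m ρ₀ (b≢r ∘ sym)) (clear-self r ρ))
    zero₂ : ∀ m → τ m b ≡ 0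
    zero₂ m = trans (add-other {d} {b} v (add r m ρ₀) (<⇒≢′ result-<)) (trans (add-other {r} m ρ₀ b≢r)
      (trans (sym (add-other {r} {b} v ρ₀ b≢r)) (trans (sym (add-clear r ρ b)) (fresh b ℕ.≤-refl))))
    body₁ : ∀ m j → m + suc j ≡ v → Runs (inc d ⨾ inc b) (add r j (σ m)) (add r j (σ (suc m))) 2
    body₁ m j _ = run-respect (λ _ → refl) (run-then run-inc run-inc)
      λ k → trans (solve 6 (λ b₁ d₁ r₁ d₂ b₂ z → b₁ :+ (d₁ :+ (r₁ :+ (d₂ :+ (b₂ :+ z)))) := r₁ :+ (d₁ :+ d₂ :+ (b₁ :+ b₂ :+ z)))
              refl (unit b 1 k) (unit d 1 k) (unit r j k) (unit d m k) (unit b m k) (ρ₀ k))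
              (cong₂ (λ y z → unit r j k + (y + (z + ρ₀ k))) (sym (unit-+ d 1 m k)) (sym (unit-+ b 1 m k)))
    body₂ : ∀ m j → m + suc j ≡ v → Runs (inc r) (add b j (τ m)) (add b j (τ (suc m))) 1
    body₂ m j _ = run-respect (λ _ → refl) run-inc (add-comm r 1 b j _ ≗∙ add-cong b j
      (add-comm r 1 d v _ ≗∙ add-cong d v (add-+ r 1 m ρ₀)))
  compile-runs one F h = run-inc
  compile-runs (t ⊞ s) {e} {b} {d} {ρ} {B} F h = run-respect (λ _ → refl)
    (run-then (compile-runs t F h) (compile-runs s (Frame-add v F result-≥ result-<)
       λ i → subst (_≤ B) (sym (unchanged i)) (h i)))
    (add-+ d _ v ρ ≗∙ λ k → cong (λ w → add d w ρ k) (trans (ℕ.+-comm _ v) (cong (v +_) (eval-cong s unchanged))))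
    where
    open Frame F
    v = eval t (ρ ∘ e)
    unchanged : ∀ i → add d v ρ (e i) ≡ ρ (e i)
    unchanged i = add-other v ρ (disjoint i)
  compile-runs (t ⊟ s) {e} {b} {d} {ρ} {B} F h =
    run-then (compile-runs t (Frame-fresh F ℕ.≤-refl) h)
    (run-then (run-respect (λ _ → refl)
       (compile-runs s (Frame-fresh (Frame-add v (Frame-fresh F ℕ.≤-refl) 2≤b ℕ.≤-refl) ℕ.≤-refl)
         λ i → subst (_≤ B) (sym (unchanged i)) (h i))
       λ k → cong (λ w → add (1 + b) w (add b v ρ) k) (eval-cong s unchanged))
    (run-then (run-≤ (loop-≤ 4 (eval-≤ s h)) (run-countdown σ 2≤1+b zero₁ body₁))
    (run-≤ (loop-≤ 3 (ℕ.≤-trans (ℕ.m∸n≤m v w) (eval-≤ t h))) (run-respect (add-cong b _ (≗-sym (add-0 d ρ)))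
      (run-countdown τ 2≤b zero₂ body₂) λ _ → refl))))
    where
    open Frame F
    v = eval t (ρ ∘ e)
    w = eval s (ρ ∘ e)
    2≤1+b = ℕ.m≤n⇒m≤1+n 2≤b
    unchanged : ∀ i → add b v ρ (e i) ≡ ρ (e i)
    unchanged i = add-other v ρ (<⇒≢′ (vars-< i) ∘ sym)
    σ τ : ℕ → Store
    σ m = add b (v ∸ m) ρ
    τ m = add d m ρ
    zero₁ : ∀ m → σ m (1 + b) ≡ 0
    zero₁ m = trans (add-other (v ∸ m) ρ (<⇒≢′ ℕ.≤-refl)) (fresh (1 + b) (ℕ.n≤1+n b))
    zero₂ : ∀ m → τ m b ≡ 0
    zero₂ m = trans (add-other m ρ (<⇒≢′ result-<)) (fresh b ℕ.≤-refl)
    value-b : ∀ m j → add (1 + b) j (σ m) b ≡ v ∸ m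
    value-b m j = trans (add-other {1 + b} {b} j (σ m) (ℕ.1+n≢n ∘ sym)) (add-self b (v ∸ m) {ρ} (fresh b ℕ.≤-refl))
    body₁ : ∀ m j → m + suc j ≡ w → Runs (when b isBlank (dec b)) (add (1 + b) j (σ m)) (add (1 + b) j (σ (suc m))) 2
    -- This is where subtraction becomes truncated: once `b` is empty, the guarded decrement does
    -- nothing.
    body₁ m j _ with v ∸ m in eq | v ∸ suc m in eq′ | value-b m j
    ... | zero  | n | z = -, s≤s z≤n , respect (λ _ → refl)
      (when₀ (trans (cong (isBlank ∘ contents x u b) z) (counter-zero 2≤b)))
      λ k → cong (λ y → add (1 + b) j (add b y ρ) k) (sym (trans (sym eq′) (trans (sym (ℕ.pred[m∸n]≡m∸[1+n] v m)) (cong pred eq))))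
    ... | suc l | n | z = -, ℕ.≤-refl , when₁ (trans (cong (isBlank ∘ contents x u b) z) (counter-nonzero 2≤b))
      (respect (add-cong (1 + b) j (≗-sym (add-+ b 1 l ρ)) ≗∙ add-comm (1 + b) j b 1 _) dec
        λ k → cong (λ y → add (1 + b) j (add b y ρ) k) (sym (trans (sym eq′) (trans (sym (ℕ.pred[m∸n]≡m∸[1+n] v m)) (cong pred eq)))))
    body₂ : ∀ m j → m + suc j ≡ v ∸ w → Runs (inc d) (add b j (τ m)) (add b j (τ (suc m))) 1
    body₂ m j _ = run-respect (λ _ → refl) run-inc (add-comm d 1 b j _ ≗∙ add-cong b j (add-+ d 1 m ρ))
  compile-runs (sum t s) {e} {b} {d} {ρ} {B} F h =
    run-then (compile-runs t (Frame-fresh F ℕ.≤-refl) h)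
    (run-then (run-≤ (loop-≤ _ (eval-≤ t h)) (run-respect (add-cong b n (≗-sym (add-0 (1 + b) _ ≗∙ add-0 d ρ)))
      (run-countdown σ 2≤b zero₁ body₁) λ _ → refl))
    (run-≤ (loop-≤ 3 (eval-≤ t h)) (run-countdown (λ _ → τ) (ℕ.m≤n⇒m≤1+n 2≤b) (λ _ → zero₂) λ _ _ _ → run-skip)))
    where
    open Frame F
    n = eval t (ρ ∘ e)
    f : ℕ → ℕ
    f i = eval s (i ▸ ρ ∘ e)
    τ : Store
    τ = add d (sumBelow n f) ρ
    σ : ℕ → Store
    σ m = add (1 + b) m (add d (sumBelow m f) ρ)
    d<1+b = ℕ.m<n⇒m<1+n result-<
    zero₁ : ∀ m → σ m b ≡ 0
    zero₁ m = trans (add-other {1 + b} {b} m (add d (sumBelow m f) ρ) (ℕ.1+n≢n ∘ sym))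
      (trans (add-other {d} {b} (sumBelow m f) ρ (<⇒≢′ result-<)) (fresh b ℕ.≤-refl))
    zero₂ : τ (1 + b) ≡ 0
    zero₂ = trans (add-other {d} {1 + b} (sumBelow n f) ρ (<⇒≢′ d<1+b)) (fresh (1 + b) (ℕ.n≤1+n b))
    state : ℕ → ℕ → Store
    state m j = add b j (σ m)
    env : ∀ m j i → state m j (((1 + b) ▸ e) i) ≡ (m ▸ ρ ∘ e) i
    env m j zero    = trans (add-other {b} {1 + b} j (σ m) ℕ.1+n≢n) (add-self (1 + b) m {add d (sumBelow m f) ρ}
      (trans (add-other {d} {1 + b} (sumBelow m f) ρ (<⇒≢′ d<1+b)) (fresh (1 + b) (ℕ.n≤1+n b))))
    env m j (suc i) = trans (add-other {b} {e i} j (σ m) (<⇒≢′ (vars-< i) ∘ sym)) (trans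
      (add-other {1 + b} {e i} m (add d (sumBelow m f) ρ) (<⇒≢′ (ℕ.m<n⇒m<1+n (vars-< i)) ∘ sym))
      (add-other {d} {e i} (sumBelow m f) ρ (disjoint i)))
    frame : ∀ m j → Frame ((1 + b) ▸ e) (2 + b) d (state m j)
    frame m j = Frame-add j (Frame-add m (Frame-add (sumBelow m f) F′ result-≥ (ℕ.m<n⇒m<1+n d<1+b))
      (ℕ.m≤n⇒m≤1+n 2≤b) ℕ.≤-refl) 2≤b (ℕ.n≤1+n _)
      where
      F′ : Frame ((1 + b) ▸ e) (2 + b) d ρ
      F′ = record
        { vars-≥ = λ { zero → ℕ.m≤n⇒m≤1+n 2≤b ; (suc i) → vars-≥ i }
        ; vars-< = λ { zero → ℕ.≤-refl ; (suc i) → ℕ.m<n⇒m<1+n (ℕ.m<n⇒m<1+n (vars-< i)) }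
        ; result-≥ = result-≥ ; result-< = ℕ.m<n⇒m<1+n d<1+b
        ; disjoint = λ { zero → <⇒≢′ d<1+b ; (suc i) → disjoint i }
        ; fresh = λ r r≥ → fresh r (ℕ.≤-trans (ℕ.n≤1+n b) (ℕ.≤-trans (ℕ.n≤1+n _) r≥)) ; home = home }
    body₁ : ∀ m j → m + suc j ≡ n → Runs (compile s ((1 + b) ▸ e) (2 + b) d ⨾ inc (1 + b))
            (state m j) (state (suc m) j) (timeBound s (B + valueBound t B) + 1)
    body₁ m j q = run-respect (λ _ → refl) (run-then (compile-runs s (frame m j)
        λ i → subst (_≤ _) (sym (env m j i)) (▸-≤ (ℕ.<-≤-trans m<n (eval-≤ t h)) h i)) run-inc)
      λ k → trans (cong (λ y → add (1 + b) 1 (add d y (state m j)) k) (eval-cong s (env m j)))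
        (trans (solve 6 (λ b₁ d₁ r₁ b₂ d₂ z → b₁ :+ (d₁ :+ (r₁ :+ (b₂ :+ (d₂ :+ z)))) := r₁ :+ (b₁ :+ b₂ :+ (d₂ :+ d₁ :+ z)))
           refl (unit (1 + b) 1 k) (unit d (f m) k) (unit b j k) (unit (1 + b) m k) (unit d (sumBelow m f) k) (ρ k))
          (cong₂ (λ y z → unit b j k + (y + (z + ρ k))) (sym (unit-+ (1 + b) 1 m k)) (sym (unit-+ d (sumBelow m f) (f m) k))))
      where
      m<n : m < n
      m<n = subst (m <_) q (ℕ.m<m+n m (s≤s z≤n))
  compile-runs (bit a β t) {e} {b} {d} {ρ} {B} F h =
    run-then (compile-runs t (Frame-fresh F ℕ.≤-refl) h)
    (run-then (run-≤ (loop-≤ 4 (eval-≤ t h)) (run-respect (add-cong b n (≗-sym (add-0 c _ ≗∙ add-0 (1 + b) ρ)))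
      (run-countdown σ 2≤b zero₁ body₁) λ _ → refl))
    (run-then test
    (run-≤ (loop-≤ 3 (eval-≤ t h)) (run-respect shuffle
      (run-countdown τ (ℕ.m≤n⇒m≤1+n 2≤b) zero₂ body₂)
      λ k → trans (cong (λ y → add c y (add d w ρ) k) (ℕ.n∸n≡0 n)) (add-0 c (add d w ρ) k)))))
    where
    open Frame F
    c = tapeOf a
    n = eval t (ρ ∘ e)
    w = fromBool (isBit β (cell (wordOf a) n))
    σ τ : ℕ → Store
    σ m = add c m (add (1 + b) m ρ)
    τ m = add c (n ∸ m) (add d w ρ)
    c≢1+b = tape< a (ℕ.m≤n⇒m≤1+n 2≤b)
    zero₁ : ∀ m → σ m b ≡ 0
    zero₁ m = trans (add-other {c} {b} m (add (1 + b) m ρ) (tape< a 2≤b ∘ sym))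
      (trans (add-other {1 + b} {b} m ρ (ℕ.1+n≢n ∘ sym)) (fresh b ℕ.≤-refl))
    zero₂ : ∀ m → τ m (1 + b) ≡ 0
    zero₂ m = trans (add-other {c} {1 + b} (n ∸ m) (add d w ρ) (c≢1+b ∘ sym))
      (trans (add-other {d} {1 + b} w ρ (<⇒≢′ (ℕ.m<n⇒m<1+n result-<))) (fresh (1 + b) (ℕ.n≤1+n b)))
    body₁ : ∀ m j → m + suc j ≡ n → Runs (inc (1 + b) ⨾ inc c) (add b j (σ m)) (add b j (σ (suc m))) 2
    body₁ m j _ = run-respect (λ _ → refl) (run-then run-inc run-inc)
      λ k → trans (solve 6 (λ c₁ b₁ r₁ c₂ b₂ z → c₁ :+ (b₁ :+ (r₁ :+ (c₂ :+ (b₂ :+ z)))) := r₁ :+ (c₁ :+ c₂ :+ (b₁ :+ b₂ :+ z)))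
              refl (unit c 1 k) (unit (1 + b) 1 k) (unit b j k) (unit c m k) (unit (1 + b) m k) (ρ k))
              (cong₂ (λ y z → unit b j k + (y + (z + ρ k))) (sym (unit-+ c 1 m k)) (sym (unit-+ (1 + b) 1 m k)))
    scanned : contents x u c (σ n c) ≡ cell (wordOf a) n
    scanned = trans (cong (contents x u c) (add-self c n {add (1 + b) n ρ} (trans (add-other {1 + b} {c} n ρ c≢1+b) (home a)))) (read a)
      where
      read : ∀ a → contents x u (tapeOf a) n ≡ cell (wordOf a) n
      read instance′   = refl
      read certificate = refl
    test : Runs (when c (isBit β) (inc d)) (σ n) (add d w (σ n)) 2
    test with isBit β (cell (wordOf a) n) in eq
    ... | true  = -, ℕ.≤-refl , when₁ (trans (cong (isBit β) scanned) eq) inc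
    ... | false = -, s≤s z≤n , respect (λ _ → refl) (when₀ (trans (cong (isBit β) scanned) eq)) (≗-sym (add-0 d (σ n)))
    shuffle : add d w (σ n) ≗ add (1 + b) n (τ 0)
    shuffle k = solve 4 (λ d₁ c₁ b₁ z → d₁ :+ (c₁ :+ (b₁ :+ z)) := b₁ :+ (c₁ :+ (d₁ :+ z))) refl
      (unit d w k) (unit c n k) (unit (1 + b) n k) (ρ k)
    body₂ : ∀ m j → m + suc j ≡ n → Runs (dec c) (add (1 + b) j (τ m)) (add (1 + b) j (τ (suc m))) 1
    body₂ m j q = run-respect
      (add-cong (1 + b) j ((λ k → cong (λ y → add c y (add d w ρ) k) eq₁) ≗∙ ≗-sym (add-+ c 1 j _)) ≗∙ add-comm (1 + b) j c 1 _)
      run-dec (add-cong (1 + b) j λ k → cong (λ y → add c y (add d w ρ) k) (sym eq₂))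
      where
      eq₁ : n ∸ m ≡ suc j
      eq₁ = trans (cong (_∸ m) (sym q)) (ℕ.m+n∸m≡n m (suc j))
      eq₂ : n ∸ suc m ≡ j
      eq₂ = trans (sym (ℕ.pred[m∸n]≡m∸[1+n] n m)) (cong pred eq₁)
  compile-runs (ren f t) F h = compile-runs t F′ (h ∘ f)
    where
    open Frame F
    F′ = record
      { vars-≥ = vars-≥ ∘ f ; vars-< = vars-< ∘ f ; result-≥ = result-≥ ; result-< = result-<
      ; disjoint = disjoint ∘ f ; fresh = fresh ; home = home }

isPresent : Maybe Bool → Bool
isPresent = not ∘ isBlank

-- The term is evaluated with its variable set to the length of the instance.
program : Term 1 → Program
program t = while 0 isPresent (inc 2 ⨾ inc 3 ⨾ inc 0) ⨾ countdown 3 (dec 0) ⨾ compile t (λ _ → 2) 4 3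

programTime : Term 1 → ℕ → ℕ
programTime t n = (n * 4 + 1) + ((n * 3 + 1) + timeBound t n)

cell-< : ∀ w {i} → i < length w → isPresent (cell w i) ≡ true
cell-< (b ∷ w) {zero}  h = refl
cell-< (b ∷ w) {suc i} h = cell-< w (s≤s⁻¹ h)

cell-end : ∀ w → isPresent (cell w (length w)) ≡ false
cell-end []      = refl
cell-end (b ∷ w) = cell-end w

module _ (x u : Word) where

  open Evaluation (contents x u)
  open Semantics x u
  open Correctness x u

  private
    ρ₁ : Store
    ρ₁ = add 2 (length x) λ _ → 0

    scanning : ℕ → Store
    scanning i = add 0 i (add 2 i (add 3 i λ _ → 0))

    advance : ∀ i → add 0 1 (add 3 1 (add 2 1 (scanning i))) ≗ scanning (suc i)
    advance i k = trans (solve 6 (λ a b c a′ b′ c′ → a :+ (c :+ (b :+ (a′ :+ (b′ :+ (c′ :+ con 0))))) :=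
               a :+ a′ :+ (b :+ b′ :+ (c :+ c′ :+ con 0))) refl
               (unit 0 1 k) (unit 2 1 k) (unit 3 1 k) (unit 0 i k) (unit 2 i k) (unit 3 i k))
             (cong₂ _+_ (sym (unit-+ 0 1 i k)) (cong₂ _+_ (sym (unit-+ 2 1 i k)) (cong (_+ 0) (sym (unit-+ 3 1 i k)))))

    scan-input : ∀ i n → i + n ≡ length x →
                 Runs (while 0 isPresent (inc 2 ⨾ inc 3 ⨾ inc 0)) (scanning i) (scanning (length x)) (n * 4 + 1)
    scan-input i zero e = -, ℕ.≤-refl , respect (λ _ → refl)
      (while₀ (subst (λ m → isPresent (cell x (m + 0)) ≡ false) (sym i≡) (trans (cong (isPresent ∘ cell x) (ℕ.+-identityʳ _)) (cell-end x))))
      λ k → cong (λ m → scanning m k) i≡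
      where
      i≡ : i ≡ length x
      i≡ = trans (sym (ℕ.+-identityʳ i)) e
    scan-input i (suc n) e
      with _ , s≤ , D ← run-respect (λ _ → refl) (run-then run-inc (run-then run-inc run-inc)) (advance i)
      with _ , t≤ , E ← scan-input (suc i) n (trans (sym (ℕ.+-suc i n)) e)
      = -, s≤s (ℕ.+-mono-≤ s≤ t≤) , while₁ present D E
      where
      present : isPresent (cell x (i + 0)) ≡ true
      present = cell-< x (subst₂ _<_ (sym (ℕ.+-identityʳ i)) e (ℕ.m<m+n i (s≤s z≤n)))

    rewind : Runs (countdown 3 (dec 0)) (scanning (length x)) ρ₁ (length x * 3 + 1)
    rewind = run-respect shuffle (run-countdown σ (s≤s (s≤s z≤n)) zero₃ body)
      λ k → trans (cong (λ m → add 0 m ρ₁ k) (ℕ.n∸n≡0 (length x))) (add-0 0 ρ₁ k)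
      where
      σ : ℕ → Store
      σ m = add 0 (length x ∸ m) ρ₁
      zero₃ : ∀ m → σ m 3 ≡ 0
      zero₃ m = refl
      shuffle : scanning (length x) ≗ add 3 (length x) (σ 0)
      shuffle k = solve 3 (λ a b c → a :+ (b :+ (c :+ con 0)) := c :+ (a :+ (b :+ con 0))) refl
        (unit 0 (length x) k) (unit 2 (length x) k) (unit 3 (length x) k)
      body : ∀ m j → m + suc j ≡ length x → Runs (dec 0) (add 3 j (σ m)) (add 3 j (σ (suc m))) 1
      body m j q = run-respect
        (add-cong 3 j ((λ k → cong (λ y → add 0 y ρ₁ k) eq₁) ≗∙ ≗-sym (add-+ 0 1 j _)) ≗∙ add-comm 3 j 0 1 _)
        run-dec (add-cong 3 j λ k → cong (λ y → add 0 y ρ₁ k) (sym eq₂))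
        where
        eq₁ : length x ∸ m ≡ suc j
        eq₁ = trans (cong (_∸ m) (sym q)) (ℕ.m+n∸m≡n m (suc j))
        eq₂ : length x ∸ suc m ≡ j
        eq₂ = trans (sym (ℕ.pred[m∸n]≡m∸[1+n] (length x) m)) (cong pred eq₁)

    frame : Frame {1} (λ _ → 2) 4 3 ρ₁
    frame = record
      { vars-≥ = λ _ → ℕ.≤-refl ; vars-< = λ _ → s≤s (s≤s (s≤s z≤n)) ; result-≥ = s≤s (s≤s z≤n)
      ; result-< = ℕ.≤-refl ; disjoint = λ _ () ; fresh = λ { (suc (suc (suc r))) _ → refl ; (suc zero) (s≤s ()) ; (suc (suc zero)) (s≤s (s≤s ())) }
      ; home = λ { instance′ → refl ; certificate → refl } }

  -- Register 3 receives a second copy of the length, is used up by rewinding the input head and is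
  -- thus empty again when the result is put there.
  program-runs : ∀ t → ∃[ ρ ] ρ 3 ≡ eval t (λ _ → length x) × Runs (program t) (λ _ → 0) ρ (programTime t (length x))
  program-runs t = add 3 v ρ₁ , ℕ.+-identityʳ v ,
    run-then (run-respect (≗-sym (add-0 0 _ ≗∙ add-0 2 _ ≗∙ add-0 3 _)) (scan-input 0 (length x) refl) λ _ → refl)
    (run-then rewind (run-respect (λ _ → refl) (compile-runs t frame λ _ → ℕ.≤-reflexive (ℕ.+-identityʳ _))
      λ k → cong (λ v → add 3 v ρ₁ k) (eval-cong t λ _ → ℕ.+-identityʳ (length x))))
    where v = eval t (λ _ → length x)

-- Bounded formulas

infix  5 _≈′_ _<′_
infixr 4 _∧′_
infixr 3 _∨′_
infixr 2 _⇒′_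

data Formula (n : ℕ) : Set where
  _≈′_ _<′_      : Term n → Term n → Formula n
  bit′           : Input → Bool → Term n → Formula n
  _∧′_ _∨′_ _⇒′_ : Formula n → Formula n → Formula n
  all′ any′      : Term n → Formula (suc n) → Formula n

-- The values are 0 and 1. `one ⊟ t` is negation and also cuts larger numbers down to a truth value;
-- a universal quantifier counts counterexamples, an existential one counts witnesses.
truth : ∀ {n} → Formula n → Term n
truth (t ≈′ s)     = one ⊟ ((t ⊟ s) ⊞ (s ⊟ t))
truth (t <′ s)     = one ⊟ (one ⊞ t ⊟ s)
truth (bit′ a β t) = bit a β t
truth (φ ∧′ ψ)     = one ⊟ ((one ⊟ truth φ) ⊞ (one ⊟ truth ψ))
truth (φ ∨′ ψ)     = one ⊟ (one ⊟ (truth φ ⊞ truth ψ))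
truth (φ ⇒′ ψ)     = one ⊟ (truth φ ⊟ truth ψ)
truth (all′ t φ)   = one ⊟ sum t (one ⊟ truth φ)
truth (any′ t φ)   = one ⊟ (one ⊟ sum t (truth φ))

data Reflects (P : Set) : ℕ → Set where
  holds : P → Reflects P 1
  fails  : ¬ P → Reflects P 0

module _ (x u : Word) where

  open Semantics x u

  sat : ∀ {n} → Formula n → Env n → Set
  sat (t ≈′ s)     ρ = eval t ρ ≡ eval s ρ
  sat (t <′ s)     ρ = eval t ρ < eval s ρ
  sat (bit′ a β t) ρ = cell (wordOf a) (eval t ρ) ≡ just β
  sat (φ ∧′ ψ)     ρ = sat φ ρ × sat ψ ρ
  sat (φ ∨′ ψ)     ρ = sat φ ρ ⊎ sat ψ ρ
  sat (φ ⇒′ ψ)     ρ = sat φ ρ → sat ψ ρ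
  sat (all′ t φ)   ρ = ∀ i → i < eval t ρ → sat φ (i ▸ ρ)
  sat (any′ t φ)   ρ = ∃[ i ] i < eval t ρ × sat φ (i ▸ ρ)

reflects-≡ : ∀ m n → Reflects (m ≡ n) (1 ∸ ((m ∸ n) + (n ∸ m)))
reflects-≡ zero    zero    = holds refl
reflects-≡ zero    (suc n) rewrite ℕ.0∸n≡0 n = fails λ ()
reflects-≡ (suc m) zero    rewrite ℕ.0∸n≡0 (m + 0) = fails λ ()
reflects-≡ (suc m) (suc n) with 1 ∸ ((m ∸ n) + (n ∸ m)) | reflects-≡ m n
... | _ | holds e = holds (cong suc e)
... | _ | fails ¬e = fails (¬e ∘ ℕ.suc-injective)

reflects-< : ∀ m n → Reflects (m < n) (1 ∸ (1 + m ∸ n))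
reflects-< m       zero    rewrite ℕ.0∸n≡0 m = fails λ ()
reflects-< zero    (suc n) rewrite ℕ.0∸n≡0 n = holds (s≤s z≤n)
reflects-< (suc m) (suc n) with 1 ∸ (1 + m ∸ n) | reflects-< m n
... | _ | holds h = holds (s≤s h)
... | _ | fails ¬h = fails (¬h ∘ s≤s⁻¹)

reflects-bit : ∀ β c → Reflects (c ≡ just β) (fromBool (isBit β c))
reflects-bit true  nothing      = fails λ ()
reflects-bit true  (just true)  = holds refl
reflects-bit true  (just false) = fails λ ()
reflects-bit false nothing      = fails λ ()
reflects-bit false (just true)  = fails λ ()
reflects-bit false (just false) = holds refl

-- `k` is the number of counterexamples so far. Only its vanishing matters, and the split into 0, 1
-- and more lets the subtractions compute.
reflects-∀-suc : ∀ {A B C : Set} k {v} → Reflects A (1 ∸ k) → Reflects B v → (A → B → C) → (C → A × B) →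
                 Reflects C (1 ∸ (k + (1 ∸ v)))
reflects-∀-suc zero          (holds a)  (holds b)  f g = holds (f a b)
reflects-∀-suc zero          (holds a)  (fails ¬b) f g = fails (¬b ∘ proj₂ ∘ g)
reflects-∀-suc (suc zero) {v} (fails ¬a) r         f g rewrite ℕ.0∸n≡0 (1 ∸ v) = fails (¬a ∘ proj₁ ∘ g)
reflects-∀-suc (suc (suc k)) (fails ¬a) r          f g = fails (¬a ∘ proj₁ ∘ g)

reflects-all : ∀ {P : ℕ → Set} {f : ℕ → ℕ} → (∀ i → Reflects (P i) (f i)) →
               ∀ n → Reflects (∀ i → i < n → P i) (1 ∸ sumBelow n λ i → 1 ∸ f i)
reflects-all         R zero    = holds λ i ()
reflects-all {P} {f} R (suc n) = reflects-∀-suc (sumBelow n λ i → 1 ∸ f i) (reflects-all {P} R n) (R n)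
  (λ h p i i< → [ h i , (λ { refl → p }) ]′ (ℕ.m<1+n⇒m<n∨m≡n i<))
  (λ g → (λ i i< → g i (ℕ.m<n⇒m<1+n i<)) , g n ℕ.≤-refl)

reflects-∃-suc : ∀ {A B C : Set} k {v} → Reflects A (1 ∸ (1 ∸ k)) → Reflects B v → (A ⊎ B → C) → (C → A ⊎ B) →
                 Reflects C (1 ∸ (1 ∸ (k + v)))
reflects-∃-suc zero          (fails ¬a) (holds b)  f g = holds (f (inj₂ b))
reflects-∃-suc zero          (fails ¬a) (fails ¬b) f g = fails ([ ¬a , ¬b ]′ ∘ g)
reflects-∃-suc (suc zero) {v} (holds a)  r         f g rewrite ℕ.0∸n≡0 v = holds (f (inj₁ a))
reflects-∃-suc (suc (suc k)) (holds a)  r          f g = holds (f (inj₁ a))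

reflects-any : ∀ {P : ℕ → Set} {f : ℕ → ℕ} → (∀ i → Reflects (P i) (f i)) →
               ∀ n → Reflects (∃[ i ] i < n × P i) (1 ∸ (1 ∸ sumBelow n f))
reflects-any         R zero    = fails λ ()
reflects-any {P} {f} R (suc n) = reflects-∃-suc (sumBelow n f) (reflects-any {P} R n) (R n)
  [ (λ (i , i< , p) → i , ℕ.m<n⇒m<1+n i< , p) , (λ p → n , ℕ.≤-refl , p) ]′
  (λ (i , i< , p) → [ (λ i<n → inj₁ (i , i<n , p)) , (λ { refl → inj₂ p }) ]′ (ℕ.m<1+n⇒m<n∨m≡n i<))

module _ {x u : Word} where

  open Semantics x u

  truth-reflects : ∀ {n} (φ : Formula n) ρ → Reflects (sat x u φ ρ) (eval (truth φ) ρ)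
  truth-reflects (t ≈′ s)     ρ = reflects-≡ (eval t ρ) (eval s ρ)
  truth-reflects (t <′ s)     ρ = reflects-< (eval t ρ) (eval s ρ)
  truth-reflects (bit′ a β t) ρ = reflects-bit β (cell (wordOf a) (eval t ρ))
  truth-reflects (φ ∧′ ψ)     ρ with eval (truth φ) ρ | truth-reflects φ ρ | eval (truth ψ) ρ | truth-reflects ψ ρ
  ... | _ | holds p | _ | holds q = holds (p , q)
  ... | _ | holds _ | _ | fails ¬q = fails (¬q ∘ proj₂)
  ... | _ | fails ¬p | _ | holds _ = fails (¬p ∘ proj₁)
  ... | _ | fails ¬p | _ | fails _  = fails (¬p ∘ proj₁)
  truth-reflects (φ ∨′ ψ)     ρ with eval (truth φ) ρ | truth-reflects φ ρ | eval (truth ψ) ρ | truth-reflects ψ ρ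
  ... | _ | holds p | _ | holds _ = holds (inj₁ p)
  ... | _ | holds p | _ | fails _  = holds (inj₁ p)
  ... | _ | fails _  | _ | holds q = holds (inj₂ q)
  ... | _ | fails ¬p | _ | fails ¬q = fails [ ¬p , ¬q ]′
  truth-reflects (φ ⇒′ ψ)     ρ with eval (truth φ) ρ | truth-reflects φ ρ | eval (truth ψ) ρ | truth-reflects ψ ρ
  ... | _ | holds _ | _ | holds q = holds λ _ → q
  ... | _ | holds p | _ | fails ¬q = fails λ f → ¬q (f p)
  ... | _ | fails ¬p | _ | holds _ = holds λ p → contradiction p ¬p
  ... | _ | fails ¬p | _ | fails _  = holds λ p → contradiction p ¬p
  truth-reflects (all′ t φ)   ρ = reflects-all {λ i → sat x u φ (i ▸ ρ)} (λ i → truth-reflects φ (i ▸ ρ)) (eval t ρ)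
  truth-reflects (any′ t φ)   ρ = reflects-any {λ i → sat x u φ (i ▸ ρ)} (λ i → truth-reflects φ (i ▸ ρ)) (eval t ρ)

-- The running time depends on the instance alone, since a certificate is inspected only at computed
-- cells. An overlong certificate therefore does no harm to the bound.
decider : ∀ p (time : ℕ → ℕ) → IsPolynomial time → (value : Word → Word → ℕ) →
          (∀ x u → ∃[ ρ ] ρ 3 ≡ value x u × Correctness.Runs x u p (λ _ → 0) ρ (time (length x))) →
          Σ TuringMachine λ V → PolynomialTime V × (∀ x u → Execution.Accepts V x u ⇔ value x u ≢ 0)
decider p time time-poly value runs = V , (q , λ x u → result x u , halts-later {time′ (length x)} {⟦ q ⟧ _} {x} {u}
    (subst (_≤ ⟦ q ⟧ (length x + length u)) (sym (q≡ (length x))) (⟦⟧-mono q (ℕ.m≤m+n (length x) (length u))))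
    (halts-in-time x u)) ,
  λ x u → mk⇔
    (λ (t , h) → to x u (verdict-unique {time′ (length x)} {t} {x} {u} (halts-in-time x u) h))
    (λ h → time′ (length x) , subst (Execution.HaltsWithin V (time′ (length x)) x u) (from x u h) (halts-in-time x u))
  where
  K : ℕ
  -- There are `4 + registers p` tapes in all, so the result register 3 exists whatever the program
  -- is.
  K = 2 + registers p
  open Simulation p 3 K
  V : TuringMachine
  V = machine p 3 K
  time′ : ℕ → ℕ
  time′ n = suc (time n + 1)
  q,q≡ : IsPolynomial time′
  q,q≡ = poly-+ (poly-const 1) (poly-+ time-poly (poly-const 1))
  q = proj₁ q,q≡
  q≡ = proj₂ q,q≡
  result : Word → Word → Bool
  result x u = isBlank (counterCell (value x u))
  halts-in-time : ∀ x u → Execution.HaltsWithin V (time′ (length x)) x u (result x u)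
  halts-in-time x u with ρ , e , s , s≤ , D ← runs x u =
    subst (λ v → Execution.HaltsWithin V (time′ (length x)) x u (isBlank (counterCell v))) e
      (halts-later {suc (s + 1)} {time′ (length x)} {x} {u} (s≤s (ℕ.+-monoˡ-≤ 1 s≤))
        (halts {x} {u} D (ℕ.m≤n+m (registers p) 4) (s≤s (s≤s (s≤s (s≤s z≤n))))))
  to : ∀ x u → result x u ≡ true → value x u ≢ 0
  to x u h e rewrite e = case h of λ ()
  from : ∀ x u → value x u ≢ 0 → result x u ≡ true
  from x u h with value x u
  ... | zero  = contradiction refl h
  ... | suc _ = refl

programTime-poly : ∀ t → IsPolynomial (programTime t)
programTime-poly t = poly-+ (poly-linear 4 poly-id) (poly-+ (poly-linear 3 poly-id) (timeBound-poly t))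

term-decider : ∀ (t : Term 1) → Σ TuringMachine λ V → PolynomialTime V ×
               (∀ x u → Execution.Accepts V x u ⇔ Semantics.eval x u t (λ _ → length x) ≢ 0)
term-decider t = decider (program t) (programTime t) (programTime-poly t)
  (λ x u → Semantics.eval x u t (λ _ → length x)) (λ x u → program-runs x u t)

truth≢0 : ∀ {n} (φ : Formula n) {x u ρ} → Semantics.eval x u (truth φ) ρ ≢ 0 ⇔ sat x u φ ρ
truth≢0 φ {x} {u} {ρ} with Semantics.eval x u (truth φ) ρ | truth-reflects {x} {u} φ ρ
... | _ | holds h  = mk⇔ (λ _ → h) (λ _ ())
... | _ | fails ¬h = mk⇔ (contradiction refl) (λ h → contradiction h ¬h)

-- Soundness covers certificates of every length, so the verifier does not measure them; the bound
-- is met by those that completeness supplies.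
certificates⇒InNP : ∀ {L : Language} {Valid : Word → Word → Set} {bound} →
  (Σ TuringMachine λ V → PolynomialTime V × (∀ x u → Execution.Accepts V x u ⇔ Valid x u)) →
  IsPolynomial bound → (∀ x u → Valid x u → L x) →
  (∀ x → L x → ∃[ u ] length u ≤ bound (length x) × Valid x u) → InNP L
certificates⇒InNP (V , polytime , accepts) (r , r≡) sound complete = V , polytime , r , λ x → mk⇔
  (λ l → let u , u≤ , h = complete x l in u , ℕ.≤-trans u≤ (ℕ.≤-reflexive (r≡ (length x))) ,
                                          Equivalence.from (accepts x u) h)
  (λ (u , _ , h) → sound x u (Equivalence.to (accepts x u) h))

formula⇒InNP : ∀ (φ : Formula 1) (s : Term 1) {L : Language} →
               (∀ x u → sat x u φ (λ _ → length x) → L x) →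
               (∀ x → L x → ∃[ u ] length u ≤ Semantics.eval x u s (λ _ → length x) ×
                                   sat x u φ (λ _ → length x)) →
               InNP L
formula⇒InNP φ s sound complete = certificates⇒InNP (term-decider (truth φ)) (valueBound-poly s)
  (λ x u → sound x u ∘ Equivalence.to (truth≢0 φ {x} {u}))
  (λ x l → let u , u≤ , h = complete x l in
     u , ℕ.≤-trans u≤ (eval-≤ {x} {u} s λ _ → ℕ.≤-refl) , Equivalence.from (truth≢0 φ {x} {u}) h)

-- Lattice paths as sequences of points

Pt : Set
Pt = ℕ × ℕ

data _~_ : Pt → Pt → Set where
  east  : ∀ {x y} → (x , y) ~ (suc x , y)
  west  : ∀ {x y} → (suc x , y) ~ (x , y)
  north : ∀ {x y} → (x , y) ~ (x , suc y)
  south : ∀ {x y} → (x , suc y) ~ (x , y)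

infix 4 _~_

-- Twice the midpoint determines a unit edge, independently of its orientation.
code : Pt → Pt → Pt
code (x , y) (x′ , y′) = x + x′ , y + y′

codes : List Pt → List Pt
codes (p ∷ q ∷ ps) = code p q ∷ codes (q ∷ ps)
codes _            = []

heading : Pt → Pt → Direction
heading (x , _) (x′ , _) = if x ≡ᵇ x′ then vertical else horizontal

turns : List Pt → ℕ
turns (p ∷ q ∷ r ∷ ps) = turn (heading p q) (heading q r) + turns (q ∷ r ∷ ps)
turns _                = 0

-- For lists with at least one edge, distinctness of the points takes the place of the conditions of
-- `IsPath` on shared points. Both directions are proved in `Embedding`.
record Path (ps : List Pt) : Set where
  field
    linked : Linked _~_ ps
    unique : Unique ps
    long   : 2 ≤ length ps

-- Edge hypergraphs of representations

Share : ∀ {V E : Set} → (V → E → Set) → V → V → Set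
Share R u v = ∃[ e ] R u e × R v e

-- The Helly property is stated for nonempty subsets because a common edge can be carried over to
-- another family only as an edge of some member.
record Represents-by {n} (adj : Fin n → Fin n → Bool) {E : Set} (R : Fin n → E → Set) : Set where
  field
    adjacent : ∀ u v → u ≢ v → T (adj u v) ⇔ Share R u v
    helly    : (S : Subset n) → (∀ u v → u ∈ₛ S → v ∈ₛ S → u ≢ v → Share R u v) →
               ∃ (_∈ₛ S) → ∃[ e ] ∀ v → v ∈ₛ S → R v e

-- Weaker than a bijection of edges, as contraction merges two edges into one. It is enough that
-- each used edge has a counterpart on at least the same paths, in both directions.
record Similar {V E E′ : Set} (R : V → E → Set) (R′ : V → E′ → Set) : Set where
  field
    lift : ∀ {v e′} → R′ v e′ → ∃[ e ] ∀ u → R′ u e′ → R u e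
    drop : ∀ {v e} → R v e → ∃[ e′ ] ∀ u → R u e → R′ u e′

module _ {V E E′ : Set} {R : V → E → Set} {R′ : V → E′ → Set} where

  Similar-share : Similar R R′ → ∀ {u v} → Share R′ u v → Share R u v
  Similar-share s (e′ , r , r′) with e , f ← Similar.lift s r = e , f _ r , f _ r′

Similar-sym : ∀ {V E E′ : Set} {R : V → E → Set} {R′ : V → E′ → Set} → Similar R R′ → Similar R′ R
Similar-sym s = record { lift = Similar.drop s ; drop = Similar.lift s }

Similar-represents : ∀ {n adj} {E E′ : Set} {R : Fin n → E → Set} {R′ : Fin n → E′ → Set} →
                     (∀ v → ∃ (R v)) → Similar R R′ → Represents-by adj R → Represents-by adj R′
Similar-represents nonempty s rep = record
  { adjacent = λ u v u≢v → mk⇔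
      (λ a → Similar-share (Similar-sym s) (Equivalence.to (adjacent u v u≢v) a))
      (λ r → Equivalence.from (adjacent u v u≢v) (Similar-share s r))
  ; helly = λ S pairwise (v , v∈S) →
      let e , common  = helly S (λ u v u∈ v∈ u≢v → Similar-share s (pairwise u v u∈ v∈ u≢v)) (v , v∈S)
          e′ , common′ = Similar.drop s (common v v∈S)
      in e′ , λ u u∈S → common′ u (common u u∈S)
  }
  where open Represents-by rep

Edges : ∀ {n} → (Fin n → List Pt) → Fin n → Pt → Set
Edges P v e = e ∈ codes (P v)

record Family {n} (adj : Fin n → Fin n → Bool) (k : ℕ) (P : Fin n → List Pt) : Set where
  field
    path       : ∀ v → Path (P v)
    turns≤k    : ∀ v → turns (P v) ≤ k
    represents : Represents-by adj (Edges P)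

Path-edge : ∀ {ps} → Path ps → ∃ (_∈ codes ps)
Path-edge {p ∷ q ∷ ps} π = -, here refl
Path-edge {p ∷ []}     π with s≤s () ← Path.long π

≡ᵇ-refl : ∀ x → (x ≡ᵇ x) ≡ true
≡ᵇ-refl x = dec-true (x ℕ.≟ x) refl

≢⇒≡ᵇ : ∀ {x y} → x ≢ y → (x ≡ᵇ y) ≡ false
≢⇒≡ᵇ {x} {y} = dec-false (x ℕ.≟ y)

turn-self : ∀ d → turn d d ≡ 0
turn-self horizontal = refl
turn-self vertical   = refl

heading-horizontal : ∀ {x x′ y y′} → x ≢ x′ → heading (x , y) (x′ , y′) ≡ horizontal
heading-horizontal x≢x′ rewrite ≢⇒≡ᵇ x≢x′ = refl

heading-vertical : ∀ {x y y′} → heading (x , y) (x , y′) ≡ vertical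
heading-vertical {x} rewrite ≡ᵇ-refl x = refl

directionOf : ∀ {p q} → p ~ q → Direction
directionOf east  = horizontal
directionOf west  = horizontal
directionOf north = vertical
directionOf south = vertical

heading-~ : ∀ {p q} (a : p ~ q) → heading p q ≡ directionOf a
heading-~ (east {x} {y})  = heading-horizontal {x} {suc x} {y} {y} (ℕ.1+n≢n ∘ sym)
heading-~ (west {x} {y})  = heading-horizontal {suc x} {x} {y} {y} ℕ.1+n≢n
heading-~ (north {x} {y}) = heading-vertical {x} {y} {suc y}
heading-~ (south {x} {y}) = heading-vertical {x} {suc y} {y}

-- With the previous heading carried along, deleting a point of a straight stretch changes nothing,
-- which is what an induction along the path needs.
turnsFrom : Direction → List Pt → ℕ
turnsFrom d (p ∷ q ∷ ps) = turn d (heading p q) + turnsFrom (heading p q) (q ∷ ps)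
turnsFrom d _            = 0

turnsFrom-turns : ∀ p q ps → turnsFrom (heading p q) (q ∷ ps) ≡ turns (p ∷ q ∷ ps)
turnsFrom-turns p q []       = refl
turnsFrom-turns p q (r ∷ ps) = cong (turn (heading p q) (heading q r) +_) (turnsFrom-turns q r ps)

-- Contraction of a column without endpoints and turns

lastX : Pt → List Pt → ℕ
lastX p []       = proj₁ p
lastX p (q ∷ ps) = lastX q ps

-- `replicate` lists the column of `q` once at a turn and not at all elsewhere, so the length of the
-- list is the number of turns.
turnXs : List Pt → List ℕ
turnXs (p ∷ q ∷ r ∷ ps) = replicate (turn (heading p q) (heading q r)) (proj₁ q) ++ turnXs (q ∷ r ∷ ps)
turnXs _                = []

criticalXs : List Pt → List ℕ
criticalXs []       = []
criticalXs (p ∷ ps) = proj₁ p ∷ lastX p ps ∷ turnXs (p ∷ ps)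

length-turnXs : ∀ ps → length (turnXs ps) ≡ turns ps
length-turnXs []               = refl
length-turnXs (p ∷ [])         = refl
length-turnXs (p ∷ q ∷ [])     = refl
length-turnXs (p ∷ q ∷ r ∷ ps) = trans (List.length-++ (replicate t (proj₁ q)) {turnXs (q ∷ r ∷ ps)})
  (cong₂ _+_ (List.length-replicate t) (length-turnXs (q ∷ r ∷ ps)))
  where t = turn (heading p q) (heading q r)

module Contraction (c : ℕ) where

  data _↦_ : ℕ → ℕ → Set where
    below : ∀ {x} → x < c → x ↦ x
    above : ∀ {x} → c ≤ x → suc x ↦ x

  _↦ₚ_ : Pt → Pt → Set
  (x , y) ↦ₚ (x′ , y′) = x ↦ x′ × y ≡ y′

  contract : ∀ {x} → x ≢ c → ∃ (x ↦_)
  contract {x} x≢c with ℕ.<-cmp x c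
  ... | tri< x<c _ _ = x , below x<c
  ... | tri≈ _ x≡c _ = contradiction x≡c x≢c
  contract {suc x} x≢c | tri> _ _ x>c = x , above (s≤s⁻¹ x>c)

  ↦-injective : ∀ {x y z} → x ↦ z → y ↦ z → x ≡ y
  ↦-injective (below _) (below _) = refl
  ↦-injective (above _) (above _) = refl
  ↦-injective (below h) (above g) = contradiction h (ℕ.≤⇒≯ g)
  ↦-injective (above g) (below h) = contradiction h (ℕ.≤⇒≯ g)

  ↦-functional : ∀ {x y z} → x ↦ y → x ↦ z → y ≡ z
  ↦-functional (below _) (below _) = refl
  ↦-functional (above _) (above _) = refl
  ↦-functional (below h) (above g) = contradiction (ℕ.≤-trans (ℕ.n≤1+n _) h) (ℕ.≤⇒≯ g)
  ↦-functional (above g) (below h) = contradiction (ℕ.≤-trans (ℕ.n≤1+n _) h) (ℕ.≤⇒≯ g)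

  -- Points outside column `c` are moved one by one. Column `c` is met only in the middle of a
  -- straight horizontal crossing, whose three points become two.
  data Contracted : List Pt → List Pt → Set where
    end   : ∀ {p p′} → p ↦ₚ p′ → Contracted (p ∷ []) (p′ ∷ [])
    keep  : ∀ {p q p′ q′ ps qs} → p ~ q → p ↦ₚ p′ → Contracted (q ∷ ps) (q′ ∷ qs) →
            Contracted (p ∷ q ∷ ps) (p′ ∷ q′ ∷ qs)
    skip→ : ∀ {b y q′ ps qs} → c ≡ suc b → Contracted ((2 + b , y) ∷ ps) (q′ ∷ qs) →
            Contracted ((b , y) ∷ (suc b , y) ∷ (2 + b , y) ∷ ps) ((b , y) ∷ q′ ∷ qs)
    skip← : ∀ {b y q′ ps qs} → c ≡ suc b → Contracted ((b , y) ∷ ps) (q′ ∷ qs) →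
            Contracted ((2 + b , y) ∷ (suc b , y) ∷ (b , y) ∷ ps) ((suc b , y) ∷ q′ ∷ qs)

  head-↦ : ∀ {p p′ ps ps′} → Contracted (p ∷ ps) (p′ ∷ ps′) → p ↦ₚ p′
  head-↦ (end m)        = m
  head-↦ (keep _ m _)   = m
  head-↦ (skip→ refl _) = below ℕ.≤-refl , refl
  head-↦ (skip← refl _) = above ℕ.≤-refl , refl

  ~-preserved : ∀ {p q p′ q′} → p ~ q → p ↦ₚ p′ → q ↦ₚ q′ → p′ ~ q′
  ~-preserved east  (below _ , refl) (below _ , refl) = east
  ~-preserved east  (below h , refl) (above g , refl) = contradiction h (ℕ.≤⇒≯ g)
  ~-preserved east  (above g , refl) (below h , refl) = contradiction (ℕ.<-trans (ℕ.n<1+n _) h) (ℕ.≤⇒≯ (ℕ.≤-trans g (ℕ.n≤1+n _)))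
  ~-preserved east  (above _ , refl) (above _ , refl) = east
  ~-preserved west  (below _ , refl) (below _ , refl) = west
  ~-preserved west  (below h , refl) (above g , refl) = contradiction (ℕ.<-trans (ℕ.n<1+n _) h) (ℕ.≤⇒≯ (ℕ.≤-trans g (ℕ.n≤1+n _)))
  ~-preserved west  (above g , refl) (below h , refl) = contradiction h (ℕ.≤⇒≯ g)
  ~-preserved west  (above _ , refl) (above _ , refl) = west
  ~-preserved north (m , refl) (m′ , refl) with refl ← ↦-functional m m′ = north
  ~-preserved south (m , refl) (m′ , refl) with refl ← ↦-functional m m′ = south

  linked-preserved : ∀ {ps ps′} → Contracted ps ps′ → Linked _~_ ps′
  linked-preserved (end _)          = [-]
  linked-preserved (keep a m C)     = ~-preserved a m (head-↦ C) ∷ linked-preserved C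
  linked-preserved (skip→ refl C) with head-↦ C
  ... | above _ , refl = east ∷ linked-preserved C
  ... | below h , refl = contradiction h (ℕ.≤⇒≯ (ℕ.n≤1+n _))
  linked-preserved (skip← refl C) with head-↦ C
  ... | below _ , refl = west ∷ linked-preserved C
  ... | above h , refl = contradiction h (ℕ.<⇒≱ (ℕ.≤-trans (ℕ.n≤1+n _) ℕ.≤-refl))

  ∈-contracted : ∀ {ps ps′ p′} → Contracted ps ps′ → p′ ∈ ps′ → ∃[ p ] p ∈ ps × p ↦ₚ p′
  ∈-contracted (end m)      (here refl) = -, here refl , m
  ∈-contracted (keep _ m _) (here refl) = -, here refl , m
  ∈-contracted (skip→ e C)  (here refl) = -, here refl , head-↦ (skip→ e C)
  ∈-contracted (skip← e C)  (here refl) = -, here refl , head-↦ (skip← e C)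
  ∈-contracted (keep _ _ C) (there h) with _ , i , m ← ∈-contracted C h = -, there i , m
  ∈-contracted (skip→ _ C)  (there h) with _ , i , m ← ∈-contracted C h = -, there (there i) , m
  ∈-contracted (skip← _ C)  (there h) with _ , i , m ← ∈-contracted C h = -, there (there i) , m

  fresh-preserved : ∀ {p p′ ps ps′} → p ↦ₚ p′ → All (p ≢_) ps → Contracted ps ps′ → All (p′ ≢_) ps′
  fresh-preserved (m , refl) a C = All.tabulate λ { h refl →
    let _ , i , m′ , e = ∈-contracted C h in All.lookup a i (cong₂ _,_ (↦-injective m m′) (sym e)) }

  unique-preserved : ∀ {ps ps′} → Contracted ps ps′ → Unique ps → Unique ps′
  unique-preserved (end _)      _       = [] ∷ []
  unique-preserved (keep _ m C) (a ∷ u) = fresh-preserved m a C ∷ unique-preserved C u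
  unique-preserved (skip→ e C)  ((_ ∷ a) ∷ _ ∷ u) = fresh-preserved (head-↦ (skip→ e C)) a C ∷ unique-preserved C u
  unique-preserved (skip← e C)  ((_ ∷ a) ∷ _ ∷ u) = fresh-preserved (head-↦ (skip← e C)) a C ∷ unique-preserved C u

  -- These act on doubled midpoints. The edges on the two sides of the deleted column, at
  -- `2 * c - 1` and `2 * c + 1`, both drop to `2 * c - 1`, and `liftX` chooses the left one of
  -- them.
  dropX liftX : ℕ → ℕ
  dropX s = if s <ᵇ 2 * c then s else s ∸ 2
  liftX s = if s <ᵇ 2 * c then s else 2 + s

  <ᵇ-true : ∀ {m n} → m < n → (m <ᵇ n) ≡ true
  <ᵇ-true {m} {n} = dec-true (m ℕ.<? n)

  <ᵇ-false : ∀ {m n} → n ≤ m → (m <ᵇ n) ≡ false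
  <ᵇ-false {m} {n} h = dec-false (m ℕ.<? n) (ℕ.≤⇒≯ h)

  <ᵇ-decode : ∀ {s s′} → (s < 2 * c × s ≡ s′) ⊎ (2 * c ≤ s′ × s ≡ 2 + s′) → dropX s ≡ s′ × liftX s′ ≡ s
  <ᵇ-decode (inj₁ (h , refl)) rewrite <ᵇ-true h = refl , refl
  <ᵇ-decode {s} {s′} (inj₂ (h , refl)) rewrite <ᵇ-false h
    | <ᵇ-false {2 + s′} (ℕ.≤-trans h (ℕ.m≤n+m s′ 2)) = refl , refl

  -- A unit step cannot jump over the deleted column, so both ends of a kept edge lie on the same
  -- side and the doubled abscissa changes by 0 or by 2.
  code-↦ : ∀ {p q p′ q′} → p ~ q → p ↦ₚ p′ → q ↦ₚ q′ →
           let s , t = code p q; s′ , t′ = code p′ q′ in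
           (dropX s ≡ s′ × liftX s′ ≡ s) × t ≡ t′
  code-↦ {x , _} {x₁ , _} {x′ , _} {x₁′ , _} a (m , refl) (m₁ , refl) = <ᵇ-decode (go a m m₁) , refl
    where
    double : 2 * c ≡ c + c
    double = cong (c +_) (ℕ.+-identityʳ c)
    low : ∀ {a b} → a < c → b < c → a + b < 2 * c
    low {a} {b} h g = subst (a + b <_) (sym double) (ℕ.+-mono-< h g)
    high : ∀ {a b} → c ≤ a → c ≤ b → 2 * c ≤ a + b × suc a + suc b ≡ 2 + (a + b)
    high {a} {b} h g = subst (_≤ a + b) (sym double) (ℕ.+-mono-≤ h g) , cong suc (ℕ.+-suc a b)
    go : (x , _) ~ (x₁ , _) → x ↦ x′ → x₁ ↦ x₁′ →
         (x + x₁ < 2 * c × x + x₁ ≡ x′ + x₁′) ⊎ (2 * c ≤ x′ + x₁′ × x + x₁ ≡ 2 + (x′ + x₁′))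
    go a     (below h) (below g) = inj₁ (low h g , refl)
    go a     (above h) (above g) = inj₂ (high h g)
    go east  (below h) (above g) = contradiction h (ℕ.≤⇒≯ g)
    go east  (above g) (below h) = contradiction (ℕ.<-trans (ℕ.n<1+n _) h) (ℕ.≤⇒≯ (ℕ.≤-trans g (ℕ.n≤1+n _)))
    go west  (below h) (above g) = contradiction (ℕ.<-trans (ℕ.n<1+n _) h) (ℕ.≤⇒≯ (ℕ.≤-trans g (ℕ.n≤1+n _)))
    go west  (above g) (below h) = contradiction h (ℕ.≤⇒≯ g)
    go north (below h) (above g) = contradiction (ℕ.≤-trans (ℕ.n≤1+n _) h) (ℕ.≤⇒≯ g)
    go north (above h) (below g) = contradiction (ℕ.≤-trans (ℕ.n≤1+n _) g) (ℕ.≤⇒≯ h)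
    go south (below h) (above g) = contradiction (ℕ.≤-trans (ℕ.n≤1+n _) h) (ℕ.≤⇒≯ g)
    go south (above h) (below g) = contradiction (ℕ.≤-trans (ℕ.n≤1+n _) g) (ℕ.≤⇒≯ h)

  dropCode liftCode : Pt → Pt
  dropCode (s , t) = dropX s , t
  liftCode (s , t) = liftX s , t

  code-drop : ∀ {p q p′ q′} → p ~ q → p ↦ₚ p′ → q ↦ₚ q′ → dropCode (code p q) ≡ code p′ q′
  code-drop a m m′ with (e , _) , e′ ← code-↦ a m m′ = cong₂ _,_ e e′

  code-lift : ∀ {p q p′ q′} → p ~ q → p ↦ₚ p′ → q ↦ₚ q′ → liftCode (code p′ q′) ≡ code p q
  code-lift a m m′ with (_ , e) , e′ ← code-↦ a m m′ = cong₂ _,_ e (sym e′)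

  -- The two edges at a deleted point become one edge of the contracted path.
  left-edge : ∀ {b} → c ≡ suc b → dropX (b + suc b) ≡ b + suc b × liftX (b + suc b) ≡ b + suc b
  left-edge {b} refl = <ᵇ-decode (inj₁ (subst (b + suc b <_) (sym (cong (suc b +_) (ℕ.+-identityʳ (suc b)))) ℕ.≤-refl , refl))

  right-edge : ∀ {b} → c ≡ suc b → dropX (suc b + (2 + b)) ≡ b + suc b
  right-edge {b} refl rewrite <ᵇ-false {suc b + (2 + b)} {2 * suc b}
      (subst (_≤ suc b + (2 + b)) (sym (cong (suc b +_) (ℕ.+-identityʳ (suc b)))) (ℕ.+-monoʳ-≤ (suc b) (ℕ.n≤1+n _)))
    = cong pred (ℕ.+-suc b (suc b))

  drop-∈ : ∀ {ps ps′ e} → Contracted ps ps′ → e ∈ codes ps → dropCode e ∈ codes ps′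
  drop-∈ (keep a m C) (here refl) = here (code-drop a m (head-↦ C))
  drop-∈ (keep a m C) (there h)   = there (drop-∈ C h)
  drop-∈ (skip→ {b} {y} e C) h with head-↦ C | e
  ... | below g , refl | refl = contradiction g (ℕ.≤⇒≯ (ℕ.n≤1+n _))
  drop-∈ (skip→ {b} {y} e C) (here refl)         | above g , refl | refl = here (cong (_, y + y) (proj₁ (left-edge {b} e)))
  drop-∈ (skip→ {b} {y} e C) (there (here refl)) | above g , refl | refl = here (cong (_, y + y) (right-edge {b} e))
  drop-∈ (skip→ {b} {y} e C) (there (there h))   | above g , refl | refl = there (drop-∈ C h)
  drop-∈ (skip← {b} {y} e C) h with head-↦ C | e
  ... | above g , refl | refl = contradiction g (ℕ.<⇒≱ (ℕ.≤-trans (ℕ.n≤1+n _) ℕ.≤-refl))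
  drop-∈ (skip← {b} {y} e C) (here refl)         | below g , refl | refl =
    here (cong (_, y + y) (trans (cong dropX (ℕ.+-comm (2 + b) (suc b))) (trans (right-edge {b} e) (ℕ.+-comm b (suc b)))))
  drop-∈ (skip← {b} {y} e C) (there (here refl)) | below g , refl | refl =
    here (cong (_, y + y) (trans (cong dropX (ℕ.+-comm (suc b) b)) (trans (proj₁ (left-edge {b} e)) (ℕ.+-comm b (suc b)))))
  drop-∈ (skip← {b} {y} e C) (there (there h))   | below g , refl | refl = there (drop-∈ C h)

  lift-∈ : ∀ {ps ps′ e} → Contracted ps ps′ → e ∈ codes ps′ → liftCode e ∈ codes ps
  lift-∈ (keep a m C) (here refl) = here (code-lift a m (head-↦ C))
  lift-∈ (keep a m C) (there h)   = there (lift-∈ C h)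
  lift-∈ (skip→ {b} {y} e C) (there h) = there (there (lift-∈ C h))
  lift-∈ (skip→ {b} {y} e C) (here refl) with head-↦ C | e
  ... | below g , refl | refl = contradiction g (ℕ.≤⇒≯ (ℕ.n≤1+n _))
  ... | above g , refl | refl = here (cong (_, y + y) (proj₂ (left-edge {b} e)))
  lift-∈ (skip← {b} {y} e C) (there h) = there (there (lift-∈ C h))
  lift-∈ (skip← {b} {y} e C) (here refl) with head-↦ C | e
  ... | above g , refl | refl = contradiction g (ℕ.<⇒≱ (ℕ.≤-trans (ℕ.n≤1+n _) ℕ.≤-refl))
  ... | below g , refl | refl =
    there (here (cong (_, y + y) (trans (cong liftX (ℕ.+-comm (suc b) b)) (trans (proj₂ (left-edge {b} e)) (ℕ.+-comm b (suc b))))))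

  heading-preserved : ∀ {p q p′ q′} → p ~ q → p ↦ₚ p′ → q ↦ₚ q′ → heading p′ q′ ≡ heading p q
  heading-preserved {x , _} {x₁ , _} {x′ , _} {x₁′ , _} a (m , _) (m₁ , _) with x ℕ.≟ x₁
  ... | yes refl rewrite ↦-functional m m₁ | ≡ᵇ-refl x₁′ | ≡ᵇ-refl x = refl
  ... | no x≢x₁ rewrite ≢⇒≡ᵇ x≢x₁ | ≢⇒≡ᵇ {x′} {x₁′} (λ { refl → x≢x₁ (↦-injective m m₁) }) = refl

  turnsFrom-preserved : ∀ {ps ps′} d → Contracted ps ps′ → turnsFrom d ps′ ≡ turnsFrom d ps
  turnsFrom-preserved d (end _)      = refl
  turnsFrom-preserved d (keep {p} {q} a m C)
    rewrite heading-preserved a m (head-↦ C) = cong (turn d (heading p q) +_) (turnsFrom-preserved _ C)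
  turnsFrom-preserved d (skip→ {b} {y} e C) with head-↦ C | e
  ... | below g , refl | refl = contradiction g (ℕ.≤⇒≯ (ℕ.n≤1+n _))
  ... | above g , refl | refl
    rewrite heading-horizontal {b} {suc b} {y} {y} (ℕ.1+n≢n ∘ sym)
          = cong (turn d horizontal +_) (turnsFrom-preserved horizontal C)
  turnsFrom-preserved d (skip← {b} {y} e C) with head-↦ C | e
  ... | above g , refl | refl = contradiction g (ℕ.<⇒≱ (ℕ.≤-trans (ℕ.n≤1+n _) ℕ.≤-refl))
  ... | below g , refl | refl
    rewrite heading-horizontal {suc b} {b} {y} {y} ℕ.1+n≢n
          = cong (turn d horizontal +_) (turnsFrom-preserved horizontal C)

  -- When `turnsFrom` starts with the heading of the first original step, it counts nothing extra
  -- for the original path and possibly one extra turn for the contracted one; hence an inequality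
  -- suffices.
  turns-preserved : ∀ {p q ps p′ q′ ps′} → Contracted (p ∷ q ∷ ps) (p′ ∷ q′ ∷ ps′) →
                    turns (p′ ∷ q′ ∷ ps′) ≤ turns (p ∷ q ∷ ps)
  turns-preserved {p} {q} {ps} {p′} {q′} {ps′} C = begin
    turns (p′ ∷ q′ ∷ ps′)                                 ≡⟨ turnsFrom-turns p′ q′ ps′ ⟨
    turnsFrom (heading p′ q′) (q′ ∷ ps′)                  ≤⟨ ℕ.m≤n+m _ (turn d (heading p′ q′)) ⟩
    turnsFrom d (p′ ∷ q′ ∷ ps′)                           ≡⟨ turnsFrom-preserved d C ⟩
    turn d d + turnsFrom d (q ∷ ps)                       ≡⟨ cong₂ _+_ (turn-self d) (turnsFrom-turns p q ps) ⟩
    turns (p ∷ q ∷ ps)                                    ∎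
    where
    open ℕ.≤-Reasoning
    d = heading p q

  turning : ∀ {p q r ps} (a : p ~ q) (b : q ~ r) → directionOf a ≡ horizontal → directionOf b ≡ vertical →
            proj₁ q ∈ turnXs (p ∷ q ∷ r ∷ ps)
  turning a b e e′ rewrite heading-~ a | heading-~ b | e | e′ = here refl

  turnXs-tail : ∀ p q ps {x} → x ∈ turnXs (q ∷ ps) → x ∈ turnXs (p ∷ q ∷ ps)
  turnXs-tail p q (r ∷ ps) h = ∈-++⁺ʳ (replicate (turn (heading p q) (heading q r)) (proj₁ q)) h

  Contractible : List Pt → Set
  Contractible ps = ∃[ p′ ] ∃[ ps′ ] Contracted ps (p′ ∷ ps′)

  -- A path that comes to `q` in column `c` from outside arrives horizontally. It cannot turn there,
  -- since `c` is not the abscissa of a turn, nor go back, since points are distinct, so it leaves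
  -- on the other side.
  straight : ∀ {p q r ps} → p ~ q → q ~ r → p ≢ r → proj₁ q ≡ c → proj₁ p ≢ c → c ∉ turnXs (p ∷ q ∷ r ∷ ps) →
         (proj₁ r ≢ c → Contractible (r ∷ ps)) → Contractible (p ∷ q ∷ r ∷ ps)
  straight east  east  _   e _   _  f with _ , _ , C ← f (λ e′ → ℕ.1+n≢n (trans e′ (sym e))) = _ , _ , skip→ (sym e) C
  straight west  west  _   e _   _  f with _ , _ , C ← f (λ e′ → ℕ.1+n≢n (trans e (sym e′))) = _ , _ , skip← (sym e) C
  straight east  west  p≢r _ _   _  _ = contradiction refl p≢r
  straight west  east  p≢r _ _   _  _ = contradiction refl p≢r
  straight {ps = ps} a@east  b@north _ e _ nt _ = contradiction (subst (_∈ _) e (turning {ps = ps} a b refl refl)) nt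
  straight {ps = ps} a@east  b@south _ e _ nt _ = contradiction (subst (_∈ _) e (turning {ps = ps} a b refl refl)) nt
  straight {ps = ps} a@west  b@north _ e _ nt _ = contradiction (subst (_∈ _) e (turning {ps = ps} a b refl refl)) nt
  straight {ps = ps} a@west  b@south _ e _ nt _ = contradiction (subst (_∈ _) e (turning {ps = ps} a b refl refl)) nt
  straight north _     _   e p≢c _  _ = contradiction e p≢c
  straight south _     _   e p≢c _  _ = contradiction e p≢c

  contraction : ∀ p ps → Linked _~_ (p ∷ ps) → Unique (p ∷ ps) → proj₁ p ≢ c → lastX p ps ≢ c →
                c ∉ turnXs (p ∷ ps) → Contractible (p ∷ ps)
  contraction p [] _ _ p≢c _ _ with x′ , m ← contract p≢c = _ , _ , end {p′ = x′ , proj₂ p} (m , refl)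
  contraction p (q ∷ ps) (a ∷ l) (h ∷ u) p≢c last≢c no-turn with proj₁ q ℕ.≟ c
  ... | no q≢c
    with x′ , m ← contract p≢c
    with _ , _ , C ← contraction q ps l u q≢c last≢c (no-turn ∘ turnXs-tail p q ps)
    = _ , _ , keep {p′ = x′ , proj₂ p} a (m , refl) C
  contraction p (q ∷ [])     _ _ p≢c last≢c no-turn | yes e = contradiction e last≢c
  contraction p (q ∷ r ∷ ps) (a ∷ a′ ∷ l) ((_ ∷ p≢r ∷ _) ∷ _ ∷ u) p≢c last≢c no-turn | yes e =
    straight a a′ p≢r e p≢c no-turn λ r≢c → contraction r ps l u r≢c last≢c
      (no-turn ∘ turnXs-tail p q (r ∷ ps) ∘ turnXs-tail q r ps)

  two-points : ∀ {p q ps ps′} → Contracted (p ∷ q ∷ ps) ps′ → ∃[ p′ ] ∃[ q′ ] ∃[ qs ] ps′ ≡ p′ ∷ q′ ∷ qs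
  two-points (keep _ _ _) = -, -, -, refl
  two-points (skip→ _ _)  = -, -, -, refl
  two-points (skip← _ _)  = -, -, -, refl

  contract-path : ∀ {ps} → Path ps → c ∉ criticalXs ps → ∃[ ps′ ] Contracted ps ps′ × Path ps′ × turns ps′ ≤ turns ps
  contract-path {p ∷ []} π _ with s≤s () ← Path.long π
  contract-path {p ∷ q ∷ ps} π c∉
    with p′ , ps′ , C ← contraction p (q ∷ ps) (Path.linked π) (Path.unique π) (λ e → c∉ (here (sym e)))
                          (λ e → c∉ (there (here (sym e)))) (c∉ ∘ there ∘ there)
    with _ , _ , _ , refl ← two-points C
    = _ , C , record
      { linked = linked-preserved C ; unique = unique-preserved C (Path.unique π) ; long = s≤s (s≤s z≤n) } ,
    turns-preserved C

  contract-family : ∀ {n adj k} {P : Fin n → List Pt} → Family adj k P → (∀ v → c ∉ criticalXs (P v)) →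
                    ∃[ P′ ] Family adj k P′ × (∀ v → Contracted (P v) (P′ v))
  contract-family {P = P} F c∉ = P′ , record
      { path = λ v → proj₁ (proj₂ (proj₂ (contracted v)))
      ; turns≤k = λ v → ℕ.≤-trans (proj₂ (proj₂ (proj₂ (contracted v)))) (turns≤k v)
      ; represents = Similar-represents (Path-edge ∘ path) (record
          { lift = λ {_} {e′} _ → liftCode e′ , λ u → lift-∈ (proj₁ (proj₂ (contracted u)))
          ; drop = λ {_} {e} _ → dropCode e , λ u → drop-∈ (proj₁ (proj₂ (contracted u))) }) represents
      } , λ v → proj₁ (proj₂ (contracted v))
    where
    open Family F
    contracted : ∀ v → ∃[ ps′ ] Contracted (P v) ps′ × Path ps′ × turns ps′ ≤ turns (P v)
    contracted v = contract-path (path v) (c∉ v)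
    P′ = proj₁ ∘ contracted

  shrink : ∀ {M ps ps′} → c ≤ M → Contracted ps ps′ → All (λ p → proj₁ p < suc M) ps → All (λ p → proj₁ p < M) ps′
  shrink {M} c≤M C a = All.tabulate λ h → let _ , i , m , _ = ∈-contracted C h in bound m (All.lookup a i)
    where
    bound : ∀ {x x′} → x ↦ x′ → x < suc M → x′ < M
    bound (below x<c) _ = ℕ.<-≤-trans x<c c≤M
    bound (above _)   h = s≤s⁻¹ h

  keep-ys : ∀ {H ps ps′} → Contracted ps ps′ → All (λ p → proj₂ p < H) ps → All (λ p → proj₂ p < H) ps′
  keep-ys {H} C a = All.tabulate λ h → let _ , i , _ , e = ∈-contracted C h in subst (_< H) e (All.lookup a i)

-- Finding a contractible column

remove-∈ : ∀ {A : Set} {x : A} {ys} → x ∈ ys →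
           ∃[ zs ] length ys ≡ suc (length zs) × (∀ {y} → y ∈ ys → x ≢ y → y ∈ zs)
remove-∈ {ys = y ∷ ys} (here refl) = ys , refl , λ where
  (here refl) x≢y → contradiction refl x≢y
  (there h)   _   → h
remove-∈ {ys = y ∷ ys} (there x∈) with zs , e , f ← remove-∈ x∈ = y ∷ zs , cong suc e , λ where
  (here refl) _   → here refl
  (there h)   x≢y → there (f h x≢y)

unique-⊆ : ∀ {A : Set} {xs ys : List A} → Unique xs → (∀ {x} → x ∈ xs → x ∈ ys) → length xs ≤ length ys
unique-⊆ []      _ = z≤n
unique-⊆ {xs = x ∷ xs} {ys} (a ∷ u) f with zs , e , g ← remove-∈ (f (here refl)) =
  subst (suc (length xs) ≤_) (sym e) (s≤s (unique-⊆ u λ h → g (f (there h)) (All.lookup a h)))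

length-concat-tabulate : ∀ {A : Set} {B} n (f : Fin n → List A) → (∀ i → length (f i) ≤ B) →
                         length (concat (tabulate f)) ≤ n * B
length-concat-tabulate zero    f h = z≤n
length-concat-tabulate (suc n) f h = subst (_≤ _) (sym (List.length-++ (f zero)))
  (ℕ.+-mono-≤ (h zero) (length-concat-tabulate n (f ∘ suc) (h ∘ suc)))

-- Pigeonhole: the `M` numbers below `M` are distinct and too many to lie all in `L`.
missing : ∀ {M} (L : List ℕ) → length L < M → ∃[ c ] c < M × c ∉ L
missing {M} L L<M with ℕ.anyUpTo? (λ c → ¬? (c ∈? L)) M
... | yes found  = found
... | no none  = contradiction L<M (ℕ.≤⇒≯ (subst (_≤ length L) (List.length-upTo M)
  (unique-⊆ (Unique.upTo⁺ M) λ {c} c∈ → decidable-stable (c ∈? L) λ c∉ → none (c , ∈-upTo⁻ c∈ , c∉))))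

Bounded : ∀ {n} → (ℕ → Set) → (ℕ → Set) → (Fin n → List Pt) → Set
Bounded X Y P = ∀ v → All (λ p → X (proj₁ p)) (P v) × All (λ p → Y (proj₂ p)) (P v)

-- The 2 accounts for the endpoints, `k` for the turns.
length-critical : ∀ {k} ps → turns ps ≤ k → length (criticalXs ps) ≤ 2 + k
length-critical     []       _ = z≤n
length-critical {k} (p ∷ ps) h = s≤s (s≤s (subst (_≤ k) (sym (length-turnXs (p ∷ ps))) h))

-- A width above `n * (2 + k)` exceeds the number of critical abscissas of all paths, so a free
-- column exists; each round lowers the width by one.
contract-columns : ∀ {n adj k H} M {P : Fin n → List Pt} → Family adj k P → Bounded (_< M) (_< H) P →
                   ∃[ P′ ] Family adj k P′ × Bounded (_< n * (2 + k)) (_< H) P′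
contract-columns {n} {k = k} M {P} F b with M ℕ.≤? n * (2 + k)
... | yes M≤ = P , F , λ v → All.map (λ h → ℕ.<-≤-trans h M≤) (proj₁ (b v)) , proj₂ (b v)
contract-columns {n} zero F b | no M≰ = contradiction z≤n M≰
contract-columns {n} {k = k} (suc M) {P} F b | no M≰
  with c , s≤s c≤M , c∉ ← missing (concat (tabulate (criticalXs ∘ P))) (ℕ.≤-<-trans
         (length-concat-tabulate n (criticalXs ∘ P) λ v → length-critical (P v) (Family.turns≤k F v)) (ℕ.≰⇒> M≰))
  with P′ , F′ , C ← Contraction.contract-family c F (λ v h → c∉ (∈-concat⁺′ h (∈-tabulate⁺ v)))
  = contract-columns M F′ λ v → Contraction.shrink c c≤M (C v) (proj₁ (b v)) , Contraction.keep-ys c (C v) (proj₂ (b v))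

-- Transposition

~-swap : ∀ {p q} → p ~ q → swap p ~ swap q
~-swap east  = north
~-swap west  = south
~-swap north = east
~-swap south = west

codes-swap : ∀ ps → codes (map swap ps) ≡ map swap (codes ps)
codes-swap []           = refl
codes-swap (p ∷ [])     = refl
codes-swap (p ∷ q ∷ ps) = cong (_ ∷_) (codes-swap (q ∷ ps))

turn-swap : ∀ {p q r} → p ~ q → q ~ r →
            turn (heading (swap p) (swap q)) (heading (swap q) (swap r)) ≡ turn (heading p q) (heading q r)
turn-swap a b rewrite heading-~ a | heading-~ b | heading-~ (~-swap a) | heading-~ (~-swap b) = go a b
  where
  go : ∀ {p q r} (a : p ~ q) (b : q ~ r) →
       turn (directionOf (~-swap a)) (directionOf (~-swap b)) ≡ turn (directionOf a) (directionOf b)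
  go east  east  = refl
  go east  west  = refl
  go east  north = refl
  go east  south = refl
  go west  east  = refl
  go west  west  = refl
  go west  north = refl
  go west  south = refl
  go north east  = refl
  go north west  = refl
  go north north = refl
  go north south = refl
  go south east  = refl
  go south west  = refl
  go south north = refl
  go south south = refl

turns-swap : ∀ {ps} → Linked _~_ ps → turns (map swap ps) ≡ turns ps
turns-swap []              = refl
turns-swap [-]             = refl
turns-swap (a ∷ [-])       = refl
turns-swap (a ∷ l@(b ∷ _)) = cong₂ _+_ (turn-swap a b) (turns-swap l)

swap-injective : ∀ {p q : Pt} → swap p ≡ swap q → p ≡ q
swap-injective refl = refl

transpose : ∀ {n adj k} {P : Fin n → List Pt} → Family adj k P → Family adj k (map swap ∘ P)
transpose {P = P} F = record
  { path       = λ v → record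
      { linked = Linked.map⁺ (Linked.map ~-swap (Path.linked (path v)))
      ; unique = Unique.map⁺ swap-injective (Path.unique (path v))
      ; long   = subst (2 ≤_) (sym (List.length-map swap (P v))) (Path.long (path v)) }
  ; turns≤k    = λ v → subst (_≤ _) (sym (turns-swap (Path.linked (path v)))) (turns≤k v)
  ; represents = Similar-represents (Path-edge ∘ path) (record
      { lift = λ {_} {e} _ → swap e , λ u h → lift (P u) h
      ; drop = λ {_} {e} _ → swap e , λ u h → subst (swap e ∈_) (sym (codes-swap (P u))) (∈-map⁺ swap h) }) represents
  }
  where
  open Family F
  lift : ∀ ps {e} → e ∈ codes (map swap ps) → swap e ∈ codes ps
  lift ps {e} h with _ , i , refl ← ∈-map⁻ swap (subst (e ∈_) (codes-swap ps) h) = i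

Bounded-swap : ∀ {n X Y} {P : Fin n → List Pt} → Bounded X Y P → Bounded Y X (map swap ∘ P)
Bounded-swap b v = All.map⁺ (proj₂ (b v)) , All.map⁺ (proj₁ (b v))

-- The result stays transposed, which is harmless because the final bounds agree in both
-- coordinates.
compress : ∀ {n adj k M} {P : Fin n → List Pt} → Family adj k P → Bounded (_< M) (_< M) P →
           ∃[ P′ ] Family adj k P′ × Bounded (_< n * (2 + k)) (_< n * (2 + k)) P′
compress {M = M} F b
  with _ , F₁ , b₁ ← contract-columns M F b
  = contract-columns M (transpose F₁) (Bounded-swap b₁)

length-cartesianProduct : ∀ {A B : Set} (xs : List A) (ys : List B) →
                          length (cartesianProduct xs ys) ≡ length xs * length ys
length-cartesianProduct []       ys = refl
length-cartesianProduct (x ∷ xs) ys = trans (List.length-++ (map (x ,_) ys))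
  (cong₂ _+_ (List.length-map (x ,_) ys) (length-cartesianProduct xs ys))

-- Distinct points in a square of side `C`. This limits how many points of a path the certificate
-- must hold.
length-path : ∀ {C ps} → Path ps → All (λ p → proj₁ p < C) ps → All (λ p → proj₂ p < C) ps → length ps ≤ C * C
length-path {C} {ps} π xs ys = subst (length ps ≤_)
  (trans (length-cartesianProduct (upTo C) (upTo C)) (cong₂ _*_ (List.length-upTo C) (List.length-upTo C)))
  (unique-⊆ (Path.unique π) λ h → ∈-cartesianProduct⁺ (∈-upTo⁺ (All.lookup xs h)) (∈-upTo⁺ (All.lookup ys h)))

-- Helly families and triples of edges

does-true : ∀ {P : Set} (P? : Dec P) → does P? ≡ true → P
does-true (yes p) _ = p

module _ {n : ℕ} {E : Set} (R : Fin n → E → Set) where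

  TwoOf : E → E → E → Fin n → Set
  TwoOf d e f v = (R v d × R v e) ⊎ (R v d × R v f) ⊎ (R v e × R v f)

  -- All four edges are required to lie on some path, so that the quantifiers can run over entries
  -- of the certificate.
  Triples : Set
  Triples = ∀ d e f → ∃[ u ] R u d → ∃[ u ] R u e → ∃[ u ] R u f →
            ∃[ g ] (∃[ u ] R u g) × (∀ v → TwoOf d e f v → R v g)

  -- Any two 2-element subsets of a 3-element set meet.
  share-TwoOf : ∀ {d e f u v} → TwoOf d e f u → TwoOf d e f v → Share R u v
  share-TwoOf (inj₁ (p , _))        (inj₁ (q , _))        = -, p , q
  share-TwoOf (inj₁ (p , _))        (inj₂ (inj₁ (q , _))) = -, p , q
  share-TwoOf (inj₁ (_ , p))        (inj₂ (inj₂ (q , _))) = -, p , q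
  share-TwoOf (inj₂ (inj₁ (p , _))) (inj₁ (q , _))        = -, p , q
  share-TwoOf (inj₂ (inj₁ (p , _))) (inj₂ (inj₁ (q , _))) = -, p , q
  share-TwoOf (inj₂ (inj₁ (_ , p))) (inj₂ (inj₂ (_ , q))) = -, p , q
  share-TwoOf (inj₂ (inj₂ (p , _))) (inj₁ (_ , q))        = -, p , q
  share-TwoOf (inj₂ (inj₂ (_ , p))) (inj₂ (inj₁ (_ , q))) = -, p , q
  share-TwoOf (inj₂ (inj₂ (p , _))) (inj₂ (inj₂ (q , _))) = -, p , q

  Helly-nonempty : Set
  Helly-nonempty = (S : Subset n) → (∀ u v → u ∈ₛ S → v ∈ₛ S → u ≢ v → Share R u v) →
                   ∃ (_∈ₛ S) → ∃[ e ] ∀ v → v ∈ₛ S → R v e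

  -- The vertices satisfying `TwoOf d e f` intersect pairwise, so the Helly property applies to
  -- them; if there are none, `d` itself serves as the common edge.
  helly⇒triples : (∀ v e → Dec (R v e)) → Helly-nonempty → Triples
  helly⇒triples R? helly d e f (u , ud) _ _ = case Fin.any? two? of λ where
      (no none)     → d , (u , ud) , λ v t → contradiction (v , t) none
      (yes (w , t)) → let g , common = helly S (λ u v u∈ v∈ _ → share-TwoOf (from u∈) (from v∈)) (w , to t)
                      in g , (w , common w (to t)) , λ v t → common v (to t)
    where
    two? : ∀ v → Dec (TwoOf d e f v)
    two? v = (R? v d ×-dec R? v e) ⊎-dec (R? v d ×-dec R? v f) ⊎-dec (R? v e ×-dec R? v f)
    S : Subset n
    S = Vec.tabulate (does ∘ two?)
    to : ∀ {v} → TwoOf d e f v → v ∈ₛ S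
    to {v} t = Vec.lookup⇒[]= v S (trans (Vec.lookup∘tabulate (does ∘ two?) v) (dec-true (two? v) t))
    from : ∀ {v} → v ∈ₛ S → TwoOf d e f v
    from {v} h = does-true (two? v) (trans (sym (Vec.lookup∘tabulate (does ∘ two?) v)) (Vec.[]=⇒lookup h))

  omit : ∀ {A : Set} {c : A} ks {L v} → v ∈ ks ++ L → v ∈ ks ++ c ∷ L
  omit []       i         = there i
  omit (k ∷ ks) (here e)  = here e
  omit (k ∷ ks) (there i) = there (omit ks i)

  -- Berge: omitting one of three members in turn gives three common edges,
  -- and every member contains at least two of them.
  common-edge : Triples → ∀ m (L : List (Fin n)) → length L ≤ m → ∃ (_∈ L) →
                (∀ {u v} → u ∈ L → v ∈ L → Share R u v) → ∃[ e ] ∀ {v} → v ∈ L → R v e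
  common-edge triples m (a ∷ []) _ _ pairwise with e , r , _ ← pairwise (here refl) (here refl) =
    e , λ { (here refl) → r }
  common-edge triples m (a ∷ b ∷ []) _ _ pairwise with e , r , r′ ← pairwise (here refl) (there (here refl)) =
    e , λ { (here refl) → r ; (there (here refl)) → r′ }
  common-edge triples (suc m) (a ∷ b ∷ c ∷ L) (s≤s L≤m) _ pairwise
    with d , h₁ ← common-edge triples m (a ∷ b ∷ L) L≤m (-, here refl) (λ i j → pairwise (omit (a ∷ b ∷ []) i) (omit (a ∷ b ∷ []) j))
    with e , h₂ ← common-edge triples m (a ∷ c ∷ L) L≤m (-, here refl) (λ i j → pairwise (omit (a ∷ []) i) (omit (a ∷ []) j))
    with f , h₃ ← common-edge triples m (b ∷ c ∷ L) L≤m (-, here refl) (λ i j → pairwise (there i) (there j))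
    with g , _ , h ← triples d e f (-, h₁ (here refl)) (-, h₂ (here refl)) (-, h₃ (here refl))
    = g , λ where
      (here refl)                 → h _ (inj₁ (h₁ (here refl) , h₂ (here refl)))
      (there (here refl))         → h _ (inj₂ (inj₁ (h₁ (there (here refl)) , h₃ (here refl))))
      (there (there (here refl))) → h _ (inj₂ (inj₂ (h₂ (there (here refl)) , h₃ (there (here refl)))))
      (there (there (there i)))   → h _ (inj₁ (h₁ (there (there i)) , h₂ (there (there i))))

  triples⇒helly : (∀ v → ∃ (R v)) → Triples → Helly-nonempty
  triples⇒helly nonempty triples S pairwise (w , w∈S) =
    let e , h = common-edge triples _ members ℕ.≤-refl (w , to w∈S) share in e , λ v v∈S → h (to v∈S)
    where
    members : List (Fin n)
    members = filter (_∈ₛ? S) (allFin n)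
    to : ∀ {v} → v ∈ₛ S → v ∈ members
    to {v} = ∈-filter⁺ (_∈ₛ? S) (∈-allFin v)
    from : ∀ {v} → v ∈ members → v ∈ₛ S
    from v∈ = proj₂ (∈-filter⁻ (_∈ₛ? S) {xs = allFin n} v∈)
    share : ∀ {u v} → u ∈ members → v ∈ members → Share R u v
    share {u} {v} u∈ v∈ with u Fin.≟ v
    -- Pairwise intersection within `S` says nothing about equal vertices, but a nonempty path
    -- shares an edge with itself.
    ... | yes refl = let e , r = nonempty u in e , r , r
    ... | no u≢v   = pairwise u v (from u∈) (from v∈) u≢v

-- Grid paths and their sequences of points

IsPath-tail : ∀ {e es} → IsPath (e ∷ es) → IsPath es
IsPath-tail π = record
  { distinct       = tail distinct
  ; consecutive    = λ i j h → consecutive (suc i) (suc j) (cong suc h)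
  ; nonconsecutive = λ i j h → nonconsecutive (suc i) (suc j) (s≤s h) }
  where
  open IsPath π
  tail : ∀ {e : GridEdge} {es} → Unique (e ∷ es) → Unique es
  tail (_ ∷ u) = u

IsPath-cons : ∀ {e f es} → IsPath (f ∷ es) → All (e ≢_) (f ∷ es) → ∃! _≡_ (SharedPoint e f) →
              (∀ {g} → g ∈ es → ¬ ∃ (SharedPoint e g)) → IsPath (e ∷ f ∷ es)
IsPath-cons {e} {f} {es} π new shared apart = record
  { distinct       = new ∷ distinct
  ; consecutive    = λ where
      zero    (suc zero)    _ → shared
      (suc i) (suc j)       h → consecutive i j (ℕ.suc-injective h)
  ; nonconsecutive = λ where
      zero    (suc (suc j)) _ → apart (∈-lookup j)
      zero    (suc zero)    (s≤s ())
      (suc i) (suc j)       h → nonconsecutive i j (s≤s⁻¹ h)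
  }
  where open IsPath π

IsPath-apart : ∀ {e f es g} → IsPath (e ∷ f ∷ es) → g ∈ es → ¬ ∃ (SharedPoint e g)
IsPath-apart π g∈ (P , a , b) = IsPath.nonconsecutive π zero (suc (suc (Any.index g∈))) (s≤s (s≤s z≤n))
  (P , a , subst (P isEndOf_) (Any.lookup-index g∈) b)

-- The normal form used by `GridEdge`, with natural coordinates: for a unit step the componentwise
-- minimum is its left or lower endpoint.
kind : Pt → Pt → Direction × Pt
kind p q = heading p q , (proj₁ p ⊓ proj₁ q , proj₂ p ⊓ proj₂ q)

kinds : List Pt → List (Direction × Pt)
kinds (p ∷ q ∷ ps) = kind p q ∷ kinds (q ∷ ps)
kinds _            = []

lower : ∀ {p q} → p ~ q → Pt
lower {p} {q} east  = p
lower {p} {q} west  = q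
lower {p} {q} north = p
lower {p} {q} south = q

kind-~ : ∀ {p q} (a : p ~ q) → kind p q ≡ (directionOf a , lower a)
kind-~ a@(east {x} {y})  = cong₂ _,_ (heading-~ a) (cong₂ _,_ (ℕ.m≤n⇒m⊓n≡m (ℕ.n≤1+n x)) (ℕ.⊓-idem y))
kind-~ a@(west {x} {y})  = cong₂ _,_ (heading-~ a) (cong₂ _,_ (ℕ.m≥n⇒m⊓n≡n (ℕ.n≤1+n x)) (ℕ.⊓-idem y))
kind-~ a@(north {x} {y}) = cong₂ _,_ (heading-~ a) (cong₂ _,_ (ℕ.⊓-idem x) (ℕ.m≤n⇒m⊓n≡m (ℕ.n≤1+n y)))
kind-~ a@(south {x} {y}) = cong₂ _,_ (heading-~ a) (cong₂ _,_ (ℕ.⊓-idem x) (ℕ.m≥n⇒m⊓n≡n (ℕ.n≤1+n y)))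

kind-sym : ∀ p q → kind p q ≡ kind q p
kind-sym (x , y) (x′ , y′) = cong₂ _,_ (go x x′) (cong₂ _,_ (ℕ.⊓-comm x x′) (ℕ.⊓-comm y y′))
  where
  go : ∀ x x′ → heading (x , y) (x′ , y′) ≡ heading (x′ , y′) (x , y)
  go x x′ with x ℕ.≟ x′
  ... | yes refl = refl
  ... | no x≢x′ rewrite ≢⇒≡ᵇ x≢x′ | ≢⇒≡ᵇ (x≢x′ ∘ sym) = refl

-- The doubled midpoint computed from the normal form. Injectivity is a matter of parity: the odd
-- coordinate reveals the direction.
kindCode : Direction × Pt → Pt
kindCode (horizontal , (x , y)) = suc (x + x) , y + y
kindCode (vertical   , (x , y)) = x + x , suc (y + y)

double-injective : ∀ x y → x + x ≡ y + y → x ≡ y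
double-injective x y e = trans (ℕ.n≡⌊n+n/2⌋ x) (trans (cong ⌊_/2⌋ e) (sym (ℕ.n≡⌊n+n/2⌋ y)))

double≢odd : ∀ x y → x + x ≢ suc (y + y)
double≢odd x y e = ℕ.even≢odd x y (trans (cong (x +_) (ℕ.+-identityʳ x)) (trans e (cong suc (cong (y +_) (sym (ℕ.+-identityʳ y))))))

kindCode-injective : ∀ {k l} → kindCode k ≡ kindCode l → k ≡ l
kindCode-injective {horizontal , (x , y)} {horizontal , (x′ , y′)} e = cong (horizontal ,_) (cong₂ _,_
  (double-injective x x′ (ℕ.suc-injective (cong proj₁ e))) (double-injective y y′ (cong proj₂ e)))
kindCode-injective {vertical , (x , y)} {vertical , (x′ , y′)} e = cong (vertical ,_) (cong₂ _,_
  (double-injective x x′ (cong proj₁ e)) (double-injective y y′ (ℕ.suc-injective (cong proj₂ e))))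
kindCode-injective {horizontal , (x , y)} {vertical , (x′ , y′)} e = contradiction (sym (cong proj₁ e)) (double≢odd x′ x)
kindCode-injective {vertical , (x , y)} {horizontal , (x′ , y′)} e = contradiction (cong proj₁ e) (double≢odd x x′)

code-kind : ∀ {p q} → p ~ q → code p q ≡ kindCode (kind p q)
code-kind a = trans (go a) (cong kindCode (sym (kind-~ a)))
  where
  go : ∀ {p q} (a : p ~ q) → code p q ≡ kindCode (directionOf a , lower a)
  go (east {x} {y})  = cong (_, y + y) (ℕ.+-suc x x)
  go west            = refl
  go (north {x} {y}) = cong (x + x ,_) (ℕ.+-suc y y)
  go south           = refl

codes-kinds : ∀ {ps} → Linked _~_ ps → codes ps ≡ map kindCode (kinds ps)
codes-kinds []      = refl
codes-kinds [-]     = refl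
codes-kinds (a ∷ l) = cong₂ _∷_ (code-kind a) (codes-kinds l)

Similar-map : ∀ {V E E′ : Set} {f : E → E′} (L : V → List E) → (∀ {a b} → f a ≡ f b → a ≡ b) →
              Similar (λ v e → e ∈ L v) (λ v e → e ∈ map f (L v))
Similar-map {f = f} L f-injective = record
  { lift = λ h → let e , _ , e≡ = ∈-map⁻ f h in e , λ u h′ →
      let _ , i , e≡′ = ∈-map⁻ f h′ in subst (_∈ L u) (f-injective (trans (sym e≡′) e≡)) i
  ; drop = λ {_} {e} _ → f e , λ u → ∈-map⁺ f }

subst-similar : ∀ {V E E′ : Set} {R : V → E → Set} {L L′ : V → List E′} → (∀ v → L′ v ≡ L v) →
                Similar R (λ v e → e ∈ L v) → Similar R (λ v e → e ∈ L′ v)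
subst-similar {L = L} {L′} eq s = record
  { lift = λ {v} {e} h → let e′ , f = Similar.lift s (subst (e ∈_) (eq v) h) in e′ , λ u h′ → f u (subst (e ∈_) (eq u) h′)
  ; drop = λ h → let e′ , f = Similar.drop s h in e′ , λ u r → subst (e′ ∈_) (sym (eq u)) (f u r) }

Kind-edge : ∀ {ps} → Path ps → ∃ (_∈ kinds ps)
Kind-edge {p ∷ q ∷ ps} π = -, here refl
Kind-edge {p ∷ []}     π with s≤s () ← Path.long π

-- The grid is entered through a translated copy of its first quadrant.
module Embedding (i j : ℤ) where

  emb : Pt → Point
  emb (x , y) = i ℤ.+ pos x , j ℤ.+ pos y

  embEdge : Direction × Pt → GridEdge
  embEdge (d , p) = edge d (emb p)

  edges : List Pt → List GridEdge
  edges ps = map embEdge (kinds ps)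

  emb-injective : ∀ {p q} → emb p ≡ emb q → p ≡ q
  emb-injective {x , y} {x′ , y′} e = cong₂ _,_
    (ℤ.+-injective (∙-cancelˡ ℤ.+-0-abelianGroup i _ _ (cong proj₁ e))) (ℤ.+-injective (∙-cancelˡ ℤ.+-0-abelianGroup j _ _ (cong proj₂ e)))

  embEdge-injective : ∀ {k l} → embEdge k ≡ embEdge l → k ≡ l
  embEdge-injective e = cong₂ _,_ (cong GridEdge.direction e) (emb-injective (cong GridEdge.source e))

  emb-suc : ∀ i x → i ℤ.+ pos x ℤ.+ 1ℤ ≡ i ℤ.+ pos (suc x)
  emb-suc i x = trans (ℤ.+-assoc i (pos x) 1ℤ) (cong (λ m → i ℤ.+ pos m) (ℕ.+-comm x 1))

  Ends : Pt → Pt → Direction × Pt → Set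
  Ends p q k = (GridEdge.source (embEdge k) ≡ emb p × GridEdge.target (embEdge k) ≡ emb q) ⊎
               (GridEdge.source (embEdge k) ≡ emb q × GridEdge.target (embEdge k) ≡ emb p)

  ends : ∀ {p q} → p ~ q → Ends p q (kind p q)
  ends a = subst (Ends _ _) (sym (kind-~ a)) (go a)
    where
    go : ∀ {p q} (a : p ~ q) → Ends p q (directionOf a , lower a)
    go (east {x} {y})  = inj₁ (refl , cong (_, j ℤ.+ pos y) (emb-suc i x))
    go (west {x} {y})  = inj₂ (refl , cong (_, j ℤ.+ pos y) (emb-suc i x))
    go (north {x} {y}) = inj₁ (refl , cong (i ℤ.+ pos x ,_) (emb-suc j y))
    go (south {x} {y}) = inj₂ (refl , cong (i ℤ.+ pos x ,_) (emb-suc j y))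

  end-cases : ∀ {p q P} → p ~ q → P isEndOf embEdge (kind p q) → P ≡ emb p ⊎ P ≡ emb q
  end-cases a h with ends a | h
  ... | inj₁ (s , t) | inj₁ e = inj₁ (trans e s)
  ... | inj₁ (s , t) | inj₂ e = inj₂ (trans e t)
  ... | inj₂ (s , t) | inj₁ e = inj₂ (trans e s)
  ... | inj₂ (s , t) | inj₂ e = inj₁ (trans e t)

  first-end : ∀ {p q} → p ~ q → emb p isEndOf embEdge (kind p q)
  first-end a with ends a
  ... | inj₁ (s , t) = inj₁ (sym s)
  ... | inj₂ (s , t) = inj₂ (sym t)

  second-end : ∀ {p q} → p ~ q → emb q isEndOf embEdge (kind p q)
  second-end a with ends a
  ... | inj₁ (s , t) = inj₂ (sym t)
  ... | inj₂ (s , t) = inj₁ (sym s)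

  ~-irrefl : ∀ {p q} → p ~ q → p ≢ q
  ~-irrefl east  ()
  ~-irrefl west  ()
  ~-irrefl north ()
  ~-irrefl south ()

  end-∈ : ∀ {ps g P} → Linked _~_ ps → g ∈ edges ps → P isEndOf g → ∃[ p ] p ∈ ps × P ≡ emb p
  end-∈ (a ∷ l) (here refl) h with end-cases a h
  ... | inj₁ e = -, here refl , e
  ... | inj₂ e = -, there (here refl) , e
  end-∈ (a ∷ l) (there g∈)  h with _ , i , e ← end-∈ l g∈ h = -, there i , e

  -- An end of an edge is one of its two points in the list. Distinctness then leaves `q` as the
  -- only point common to the first two edges, and no point common to the first edge and a later
  -- one.
  path⇒IsPath : ∀ {ps} → Linked _~_ ps → Unique ps → IsPath (edges ps)
  path⇒IsPath [] _ = record { distinct = [] ; consecutive = λ () ; nonconsecutive = λ () }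
  path⇒IsPath [-] _ = record { distinct = [] ; consecutive = λ () ; nonconsecutive = λ () }
  path⇒IsPath (a ∷ [-]) _ = record
    { distinct = [] ∷ [] ; consecutive = λ { zero zero () } ; nonconsecutive = λ { zero zero () } }
  path⇒IsPath {p ∷ q ∷ r ∷ ps} (a ∷ l@(b ∷ l′)) (p∉@(p≢q ∷ p≢r ∷ p∉ps) ∷ u@(q∉ ∷ _)) =
    IsPath-cons (path⇒IsPath l u) (All.tabulate λ { g∈ refl → p∉edges g∈ (first-end a) })
      (emb q , (second-end a , first-end b) , λ (h , h′) → only (end-cases a h) (end-cases b h′))
      λ g∈ (P , h , h′) → let s , s∈ , e = end-∈ l′ g∈ h′ in
        [ (λ e′ → All.lookup p∉ (there s∈) (emb-injective (trans (sym e′) e)))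
        , (λ e′ → All.lookup q∉ s∈ (emb-injective (trans (sym e′) e))) ]′ (end-cases a h)
    where
    p∉edges : ∀ {g} → g ∈ edges (q ∷ r ∷ ps) → ¬ emb p isEndOf g
    p∉edges g∈ h with _ , s∈ , e ← end-∈ l g∈ h = All.lookup p∉ s∈ (emb-injective e)
    only : ∀ {P} → P ≡ emb p ⊎ P ≡ emb q → P ≡ emb q ⊎ P ≡ emb r → emb q ≡ P
    only (inj₂ e) _        = sym e
    only _        (inj₁ e) = sym e
    only (inj₁ e) (inj₂ e′) = contradiction (emb-injective (trans (sym e) e′)) p≢r

  point-edge : ∀ {p ps r} → Linked _~_ (p ∷ ps) → r ∈ ps → ∃[ g ] g ∈ edges (p ∷ ps) × emb r isEndOf g
  point-edge (a ∷ l) (here refl) = -, here refl , second-end a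
  point-edge (a ∷ l) (there r∈)  with _ , i , e ← point-edge l r∈ = -, there i , e

  bends-edges : ∀ ps → bends (edges ps) ≡ turns ps
  bends-edges []               = refl
  bends-edges (p ∷ [])         = refl
  bends-edges (p ∷ q ∷ [])     = refl
  bends-edges (p ∷ q ∷ r ∷ ps) = cong (turn (heading p q) (heading q r) +_) (bends-edges (q ∷ r ∷ ps))

  InImage : GridEdge → Set
  InImage e = ∃[ p ] GridEdge.source e ≡ emb p

  as-step : ∀ {e} → InImage e → ∃[ p ] ∃[ q ] p ~ q × e ≡ embEdge (kind p q)
  as-step {edge horizontal _} (_ , refl) = -, -, east  , cong embEdge (sym (kind-~ east))
  as-step {edge vertical   _} (_ , refl) = -, -, north , cong embEdge (sym (kind-~ north))

  ~-sym : ∀ {p q} → p ~ q → q ~ p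
  ~-sym east  = west
  ~-sym west  = east
  ~-sym north = south
  ~-sym south = north

  as-step-to : ∀ {e P} → InImage e → P isEndOf e → ∃[ p ] ∃[ q ] p ~ q × e ≡ embEdge (kind p q) × P ≡ emb q
  as-step-to {e} m h with p , q , a , refl ← as-step {e} m with end-cases a h
  ... | inj₂ e = p , q , a , refl , e
  ... | inj₁ e = q , p , ~-sym a , cong embEdge (kind-sym p q) , e

  PointPath : List GridEdge → Set
  PointPath es = ∃[ p ] ∃[ q ] ∃[ ps ] Linked _~_ (p ∷ q ∷ ps) × Unique (p ∷ q ∷ ps) × edges (p ∷ q ∷ ps) ≡ es

  -- The point s shared with the preceding edge is where the point path starts.
  attach : ∀ {p s q r ps} → p ~ s → Linked _~_ (q ∷ r ∷ ps) → Unique (q ∷ r ∷ ps) →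
           IsPath (embEdge (kind p s) ∷ edges (q ∷ r ∷ ps)) →
           (∀ {P} → SharedPoint (embEdge (kind p s)) (embEdge (kind q r)) P → emb s ≡ P) →
           s ≡ q ⊎ s ≡ r → PointPath (embEdge (kind p s) ∷ edges (q ∷ r ∷ ps))
  attach {p} {s} {r = r} {ps} a l@(b ∷ l′) u π unique (inj₁ refl) =
    p , s , r ∷ ps , a ∷ l , (~-irrefl a ∷ p≢r ∷ All.tabulate p∉) ∷ u , refl
    where
    p≢r : p ≢ r
    p≢r refl = ~-irrefl a (sym (emb-injective (unique (first-end a , second-end b))))
    p∉ : ∀ {t} → t ∈ ps → p ≢ t
    p∉ t∈ refl with g , g∈ , k ← point-edge l′ t∈ = IsPath-apart π g∈ (emb p , first-end a , k)
  attach {p} {s} {q} {ps = []} a (b ∷ l) ((q≢s ∷ _) ∷ _) π unique (inj₂ refl) =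
    p , s , q ∷ [] , a ∷ ~-sym b ∷ [-] , (~-irrefl a ∷ p≢q ∷ []) ∷ ((q≢s ∘ sym) ∷ []) ∷ [] ∷ [] ,
    cong (λ k → embEdge (kind p s) ∷ embEdge k ∷ []) (kind-sym s q)
    where
    p≢q : p ≢ q
    p≢q refl = ~-irrefl a (sym (emb-injective (unique (first-end a , first-end b))))
  attach {s = s} {ps = _ ∷ _} a (b ∷ c ∷ _) u π unique (inj₂ refl) =
    contradiction (emb s , second-end a , first-end c) (IsPath-apart π (here refl))

  extend : ∀ {e f es} → IsPath (e ∷ f ∷ es) → InImage e → PointPath (f ∷ es) → PointPath (e ∷ f ∷ es)
  extend {e₀} π m (q , r , ps , l@(b ∷ l′) , u , refl)
    with P , (h , h′) , unique ← IsPath.consecutive π zero (suc zero) refl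
    with p , s , a , refl , refl ← as-step-to {e₀} m h
    = attach a l u π unique (Sum.map emb-injective emb-injective (end-cases b h′))

  -- Built from the last edge backwards. A single edge is oriented arbitrarily and is reversed once
  -- if the preceding edge meets its other end. With more edges the orientation is forced, since the
  -- wrong end also belongs to the next edge, which is not consecutive to the new one.
  IsPath⇒path : ∀ {e es} → IsPath (e ∷ es) → (∀ {f} → f ∈ e ∷ es → InImage f) → PointPath (e ∷ es)
  IsPath⇒path {e} {[]} π m with p , q , a , e≡ ← as-step {e} (m (here refl)) =
    p , q , [] , a ∷ [-] , (~-irrefl a ∷ []) ∷ [] ∷ [] , cong (_∷ []) (sym e≡)
  IsPath⇒path {e} {f ∷ es} π m = extend π (m (here refl)) (IsPath⇒path (IsPath-tail π) (m ∘ there))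

-- Passage between representations and bounded families of lattice paths

list-bound : ∀ {A : Set} (f : A → ℕ) (xs : List A) → ∃[ M ] ∀ {a} → a ∈ xs → f a ≤ M
list-bound f []       = 0 , λ ()
list-bound f (x ∷ xs) with M , h ← list-bound f xs = f x + M , λ where
  (here refl) → ℕ.m≤m+n (f x) M
  (there i)   → ℕ.≤-trans (h i) (ℕ.m≤n+m M (f x))

family-bound : ∀ {n} {A : Set} (f : A → ℕ) (L : Fin n → List A) → ∃[ M ] ∀ v {a} → a ∈ L v → f a ≤ M
family-bound f L with M , h ← list-bound f (concat (tabulate L)) = M , λ v i → h (∈-concat⁺′ i (∈-tabulate⁺ v))

translate : ∀ X {M} → ℤ.∣ X ∣ ≤ M → ∃[ a ] X ≡ ℤ.- pos M ℤ.+ pos a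
translate X {M} h = let a , e = shifted X h in a , (begin
  X                                 ≡⟨ ℤ.+-identityˡ X ⟨
  0ℤ ℤ.+ X                          ≡⟨ cong (ℤ._+ X) (ℤ.+-inverseˡ (pos M)) ⟨
  (ℤ.- pos M ℤ.+ pos M) ℤ.+ X       ≡⟨ ℤ.+-assoc (ℤ.- pos M) (pos M) X ⟩
  ℤ.- pos M ℤ.+ (pos M ℤ.+ X)       ≡⟨ cong (λ z → ℤ.- pos M ℤ.+ z) (trans (ℤ.+-comm (pos M) X) e) ⟩
  ℤ.- pos M ℤ.+ pos a               ∎)
  where
  open ≡-Reasoning
  shifted : ∀ X → ℤ.∣ X ∣ ≤ M → ∃[ a ] X ℤ.+ pos M ≡ pos a
  shifted (pos m)    _ = m + M , refl
  shifted ℤ.-[1+ m ] h = M ∸ suc m , ℤ.⊖-≥ h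

module _ (G : Graph) {k : ℕ} where

  open Graph G

  family⇒representation : ∀ {P} → Family adj k P → HasHellyBEPG G k
  family⇒representation {P} F = (λ v → edges (P v)) , record
      { isEPG   = record
        { path     = λ v → path⇒IsPath (Path.linked (path v)) (Path.unique (path v))
        ; adjacent = Represents-by.adjacent represents′ }
      ; bends≤k = λ v → subst (_≤ k) (sym (bends-edges (P v))) (turns≤k v) } ,
    λ S pairwise → case nonempty? S of λ where
      (yes v∈S) → Represents-by.helly represents′ S pairwise v∈S
      -- For the empty subset any grid edge is common to all members.
      (no none) → edge horizontal (0ℤ , 0ℤ) , λ v v∈S → contradiction (v , v∈S) none
    where
    open Family F
    open Embedding 0ℤ 0ℤ
    represents′ : Represents-by adj (λ v e → e ∈ edges (P v))
    represents′ = Similar-represents (Kind-edge ∘ path) (Similar-map (kinds ∘ P) embEdge-injective)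
      (Similar-represents (Path-edge ∘ path) (Similar-sym codes-similar) represents)
      where
      codes-similar : Similar (λ v e → e ∈ kinds (P v)) (Edges P)
      codes-similar = subst-similar (λ v → codes-kinds (Path.linked (path v))) (Similar-map (kinds ∘ P) kindCode-injective)

  representation⇒family : HasHellyBEPG G k → ∃[ P ] Family adj k P × Bounded (_< order * (2 + k)) (_< order * (2 + k)) P
  representation⇒family (Es , bepg , helly) = compress family bounded
    where
    open IsBEPG bepg
    open IsEPG isEPG
    size : GridEdge → ℕ
    size e = ℤ.∣ proj₁ (GridEdge.source e) ∣ + ℤ.∣ proj₂ (GridEdge.source e) ∣
    M : ℕ
    M = proj₁ (family-bound size Es)
    size≤M : ∀ v {e} → e ∈ Es v → size e ≤ M
    size≤M = proj₂ (family-bound size Es)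
    -- `M` bounds all absolute values of coordinates, so the quadrant with corner `(- M , - M)`
    -- contains every edge.
    open Embedding (ℤ.- pos M) (ℤ.- pos M)
    -- `IsPath` admits the empty list; it is the Helly property of a singleton that supplies an
    -- edge.
    nonempty : ∀ v → ∃ (_∈ Es v)
    nonempty v with e , h ← helly ⁅ v ⁆ (λ u w u∈ w∈ u≢w → contradiction (trans (x∈⁅y⁆⇒x≡y v u∈) (sym (x∈⁅y⁆⇒x≡y v w∈))) u≢w)
      = e , h v (x∈⁅x⁆ v)
    in-image : ∀ v {e} → e ∈ Es v → InImage e
    in-image v {edge _ (X , Y)} e∈ =
      let a , x≡ = translate X (ℕ.≤-trans (ℕ.m≤m+n _ _) (size≤M v e∈))
          b , y≡ = translate Y (ℕ.≤-trans (ℕ.m≤n+m _ ℤ.∣ X ∣) (size≤M v e∈))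
      in (a , b) , cong₂ _,_ x≡ y≡
    pointPath : ∀ es → ∃ (_∈ es) → IsPath es → (∀ {e} → e ∈ es → InImage e) → PointPath es
    pointPath []       (_ , ()) _ _
    pointPath (e ∷ es) _        π m = IsPath⇒path π m
    found : ∀ v → PointPath (Es v)
    found v = pointPath (Es v) (nonempty v) (path v) (in-image v)
    P : Fin order → List Pt
    P v = let p , q , ps , _ = found v in p ∷ q ∷ ps
    linked : ∀ v → Linked _~_ (P v)
    linked v = let _ , _ , _ , l , _ = found v in l
    edges≡ : ∀ v → edges (P v) ≡ Es v
    edges≡ v = let _ , _ , _ , _ , _ , e = found v in e
    family : Family adj k P
    family = record
      { path       = λ v → record
        { linked = linked v ; unique = let _ , _ , _ , _ , u , _ = found v in u ; long = s≤s (s≤s z≤n) }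
      ; turns≤k    = λ v → subst (_≤ k) (trans (cong bends (sym (edges≡ v))) (bends-edges (P v))) (bends≤k v)
      ; represents = Similar-represents (λ v → -, here refl)
          (subst-similar (codes-kinds ∘ linked) (Similar-map (kinds ∘ P) kindCode-injective))
          (Similar-represents nonempty (Similar-sym (subst-similar (sym ∘ edges≡) (Similar-map (kinds ∘ P) embEdge-injective)))
            record { adjacent = adjacent ; helly = λ S pairwise _ → helly S pairwise }) }
    bounded : Bounded (_< suc (proj₁ (family-bound (λ p → proj₁ p + proj₂ p) P)))
                      (_< suc (proj₁ (family-bound (λ p → proj₁ p + proj₂ p) P))) P
    bounded v = All.tabulate (λ {p} i → s≤s (ℕ.≤-trans (ℕ.m≤m+n _ _) (proj₂ (family-bound (λ p → proj₁ p + proj₂ p) P) v i))) ,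
                All.tabulate (λ {p} i → s≤s (ℕ.≤-trans (ℕ.m≤n+m _ (proj₁ p)) (proj₂ (family-bound (λ p → proj₁ p + proj₂ p) P) v i)))

-- Families of paths given by coordinate functions

build : (ℕ → Pt) → ℕ → List Pt
build f zero    = f 0 ∷ []
build f (suc m) = f 0 ∷ build (f ∘ suc) m

-- The default `(0 , 0)` agrees with the zeros that are read beyond the end of a certificate.
at : List Pt → ℕ → Pt
at []       _       = 0 , 0
at (p ∷ ps) zero    = p
at (p ∷ ps) (suc i) = at ps i

build-at : ∀ p ps → build (at (p ∷ ps)) (length ps) ≡ p ∷ ps
build-at p []       = refl
build-at p (q ∷ ps) = cong (p ∷_) (build-at q ps)

build-cong : ∀ {f g} m → (∀ i → i ≤ m → f i ≡ g i) → build f m ≡ build g m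
build-cong zero    e = cong (_∷ []) (e 0 z≤n)
build-cong (suc m) e = cong₂ _∷_ (e 0 z≤n) (build-cong m λ i i≤m → e (suc i) (s≤s i≤m))

length-build : ∀ f m → length (build f m) ≡ suc m
length-build f zero    = refl
length-build f (suc m) = cong suc (length-build (f ∘ suc) m)

linked-build⁺ : ∀ f m → (∀ i → i < m → f i ~ f (suc i)) → Linked _~_ (build f m)
linked-build⁺ f zero          h = [-]
linked-build⁺ f (suc zero)    h = h 0 ℕ.≤-refl ∷ [-]
linked-build⁺ f (suc (suc m)) h = h 0 (s≤s z≤n) ∷ linked-build⁺ (f ∘ suc) (suc m) λ i i< → h (suc i) (s≤s i<)

linked-build⁻ : ∀ f m → Linked _~_ (build f m) → ∀ i → i < m → f i ~ f (suc i)
linked-build⁻ f (suc zero)    (a ∷ l) zero    _       = a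
linked-build⁻ f (suc zero)    (a ∷ l) (suc i) (s≤s ())
linked-build⁻ f (suc (suc m)) (a ∷ l) zero    _       = a
linked-build⁻ f (suc (suc m)) (a ∷ l) (suc i) (s≤s h) = linked-build⁻ (f ∘ suc) (suc m) l i h

∈-build⁻ : ∀ f m {p} → p ∈ build f m → ∃[ i ] i ≤ m × p ≡ f i
∈-build⁻ f zero    (here e)  = 0 , z≤n , e
∈-build⁻ f (suc m) (here e)  = 0 , z≤n , e
∈-build⁻ f (suc m) (there h) with i , i≤ , e ← ∈-build⁻ (f ∘ suc) m h = suc i , s≤s i≤ , e

∈-build⁺ : ∀ f m {i} → i ≤ m → f i ∈ build f m
∈-build⁺ f zero    {zero}  _       = here refl
∈-build⁺ f (suc m) {zero}  _       = here refl
∈-build⁺ f (suc m) {suc i} (s≤s h) = there (∈-build⁺ (f ∘ suc) m h)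

unique-build⁺ : ∀ f m → (∀ j → j < suc m → ∀ i → i < j → f i ≢ f j) → Unique (build f m)
unique-build⁺ f zero    h = [] ∷ []
unique-build⁺ f (suc m) h =
  All.tabulate (λ i∈ e → let i , i≤ , e′ = ∈-build⁻ (f ∘ suc) m i∈ in h (suc i) (s≤s (s≤s i≤)) 0 (s≤s z≤n) (trans e e′))
  ∷ unique-build⁺ (f ∘ suc) m λ j j< i i< → h (suc j) (s≤s j<) (suc i) (s≤s i<)

unique-build⁻ : ∀ f m → Unique (build f m) → ∀ j → j < suc m → ∀ i → i < j → f i ≢ f j
unique-build⁻ f zero    u       (suc j) (s≤s ())
unique-build⁻ f (suc m) (a ∷ u) (suc j) (s≤s j<) zero    _        e = All.lookup a (∈-build⁺ (f ∘ suc) m (s≤s⁻¹ j<)) e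
unique-build⁻ f (suc m) (a ∷ u) (suc j) (s≤s j<) (suc i) (s≤s i<) e = unique-build⁻ (f ∘ suc) m u j j< i i< e

codes-build⁺ : ∀ f m {i} → i < m → code (f i) (f (suc i)) ∈ codes (build f m)
codes-build⁺ f (suc zero)    {zero}  _       = here refl
codes-build⁺ f (suc zero)    {suc i} (s≤s ())
codes-build⁺ f (suc (suc m)) {zero}  _       = here refl
codes-build⁺ f (suc (suc m)) {suc i} (s≤s h) = there (codes-build⁺ (f ∘ suc) (suc m) h)

codes-build⁻ : ∀ f m {e} → e ∈ codes (build f m) → ∃[ i ] i < m × e ≡ code (f i) (f (suc i))
codes-build⁻ f (suc zero)    (here e)  = 0 , s≤s z≤n , e
codes-build⁻ f (suc (suc m)) (here e)  = 0 , s≤s z≤n , e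
codes-build⁻ f (suc (suc m)) (there h) with i , i< , e ← codes-build⁻ (f ∘ suc) (suc m) h = suc i , s≤s i< , e

sumBelow-suc : ∀ n f → sumBelow (suc n) f ≡ f 0 + sumBelow n (f ∘ suc)
sumBelow-suc zero    f = sym (ℕ.+-identityʳ (f 0))
sumBelow-suc (suc n) f = trans (cong (_+ f (suc n)) (sumBelow-suc n f)) (ℕ.+-assoc (f 0) _ _)

turns-build : ∀ f m → turns (build f m) ≡
  sumBelow (m ∸ 1) λ i → turn (heading (f i) (f (suc i))) (heading (f (suc i)) (f (2 + i)))
turns-build f zero                = refl
turns-build f (suc zero)          = refl
turns-build f (suc (suc zero))    = ℕ.+-identityʳ _
turns-build f (suc (suc (suc m))) = trans (cong (turn (heading (f 0) (f 1)) (heading (f 1) (f 2)) +_) (turns-build (f ∘ suc) (suc (suc m))))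
  (sym (sumBelow-suc (suc m) λ i → turn (heading (f i) (f (suc i))) (heading (f (suc i)) (f (2 + i)))))

equality : ℕ → ℕ → ℕ
equality a b = 1 ∸ ((a ∸ b) + (b ∸ a))

distance : ℕ → ℕ → ℕ
distance a b = (a ∸ b) + (b ∸ a)

-- `equality` is 1 on vertical steps and 0 on horizontal ones, so two successive values differ
-- exactly at a turn.
distance-turn : ∀ a b c {y y′ y″} → distance (equality a b) (equality b c) ≡
                turn (heading (a , y) (b , y′)) (heading (b , y′) (c , y″))
distance-turn a b c with a ℕ.≟ b | b ℕ.≟ c | equality a b | reflects-≡ a b | equality b c | reflects-≡ b c
... | yes refl | yes refl | _ | holds _ | _ | holds _ rewrite ≡ᵇ-refl a = refl
... | yes refl | no b≢c   | _ | holds _ | _ | fails _ rewrite ≡ᵇ-refl a | ≢⇒≡ᵇ b≢c = refl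
... | no a≢b   | yes refl | _ | fails _ | _ | holds _ rewrite ≡ᵇ-refl b | ≢⇒≡ᵇ a≢b = refl
... | no a≢b   | no b≢c   | _ | fails _ | _ | fails _ rewrite ≢⇒≡ᵇ a≢b | ≢⇒≡ᵇ b≢c = refl
... | yes e    | _        | _ | fails ne | _ | _      = contradiction e ne
... | no ne    | _        | _ | holds e | _ | _       = contradiction e ne
... | _        | yes e    | _ | _       | _ | fails ne = contradiction e ne
... | _        | no ne    | _ | _       | _ | holds e = contradiction e ne

-- Definitionally the meaning of `falsum`, as formulas have no constant for falsehood.
False : Set
False = 1 < 1

¬False : ¬ False
¬False (s≤s ())

Step : (x y x′ y′ : ℕ) → Set
Step x y x′ y′ = (x ≡ x′ × (y′ ≡ 1 + y ⊎ y ≡ 1 + y′)) ⊎ (y ≡ y′ × (x′ ≡ 1 + x ⊎ x ≡ 1 + x′))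

Step⇒~ : ∀ {x y x′ y′} → Step x y x′ y′ → (x , y) ~ (x′ , y′)
Step⇒~ (inj₁ (refl , inj₁ refl)) = north
Step⇒~ (inj₁ (refl , inj₂ refl)) = south
Step⇒~ (inj₂ (refl , inj₁ refl)) = east
Step⇒~ (inj₂ (refl , inj₂ refl)) = west

~⇒Step : ∀ {x y x′ y′} → (x , y) ~ (x′ , y′) → Step x y x′ y′
~⇒Step north = inj₁ (refl , inj₁ refl)
~⇒Step south = inj₁ (refl , inj₂ refl)
~⇒Step east  = inj₂ (refl , inj₁ refl)
~⇒Step west  = inj₂ (refl , inj₂ refl)

-- `x v i` and `y v i` stand for the coordinates of point `i` of path `v`, `ℓ v` for its number of
-- edges and `α` for adjacency. Quantifiers over bounded numbers and spellings such as `1 + i` make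
-- each condition literally the meaning of a formula.
module Coordinates (n k : ℕ) (x y : ℕ → ℕ → ℕ) (ℓ : ℕ → ℕ) (α : ℕ → ℕ → Set) where

  Turn : ℕ → ℕ → ℕ
  Turn v i = distance (equality (x v i) (x v (1 + i))) (equality (x v (1 + i)) (x v (2 + i)))

  PathAt : ℕ → Set
  PathAt v = 0 < ℓ v ×
    (∀ i → i < ℓ v → Step (x v i) (y v i) (x v (1 + i)) (y v (1 + i))) ×
    (∀ j → j < 1 + ℓ v → ∀ i → i < j → (x v i ≡ x v j × y v i ≡ y v j) → False) ×
    sumBelow (ℓ v ∸ 1) (Turn v) < 1 + k

  Same : (u i v j : ℕ) → Set
  Same u i v j = x u i + x u (1 + i) ≡ x v j + x v (1 + j) × y u i + y u (1 + i) ≡ y v j + y v (1 + j)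

  Has : (v w l : ℕ) → Set
  Has v w l = ∃[ j ] j < ℓ v × Same w l v j

  Sharing : ℕ → ℕ → Set
  Sharing u v = ∃[ i ] i < ℓ u × Has v u i

  Adjacency : Set
  Adjacency = ∀ u → u < n → ∀ v → v < n → (u ≡ v → False) → (α u v → Sharing u v) × (Sharing u v → α u v)

  HellyTriples : Set
  HellyTriples = ∀ a → a < n → ∀ i → i < ℓ a → ∀ b → b < n → ∀ j → j < ℓ b → ∀ c → c < n → ∀ l → l < ℓ c →
    ∃[ w ] w < n × ∃[ m ] m < ℓ w × ∀ v → v < n →
    ((Has v a i × Has v b j) ⊎ (Has v a i × Has v c l) ⊎ (Has v b j × Has v c l)) → Has v w m

  Valid : Set
  Valid = (∀ v → v < n → PathAt v) × Adjacency × HellyTriples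

  pt : ℕ → ℕ → Pt
  pt v i = x v i , y v i

  paths : Fin n → List Pt
  paths v = build (pt (toℕ v)) (ℓ (toℕ v))

  edgeAt : ℕ → ℕ → Pt
  edgeAt v i = code (pt v i) (pt v (suc i))

  R : Fin n → Pt → Set
  R = Edges paths

  Has⇒∈ : ∀ {v} {w l} → Has (toℕ v) w l → R v (edgeAt w l)
  Has⇒∈ {v} (j , j< , e , e′) = subst (_∈ codes (paths v)) (sym (cong₂ _,_ e e′)) (codes-build⁺ (pt (toℕ v)) (ℓ (toℕ v)) j<)

  ∈⇒Has : ∀ {v w l} → R v (edgeAt w l) → Has (toℕ v) w l
  ∈⇒Has {v} h with j , j< , e ← codes-build⁻ (pt (toℕ v)) (ℓ (toℕ v)) h = j , j< , cong proj₁ e , cong proj₂ e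

  Sharing⇒Share : ∀ {u v} → Sharing (toℕ u) (toℕ v) → Share R u v
  Sharing⇒Share {u} (i , i< , h) = -, codes-build⁺ (pt (toℕ u)) (ℓ (toℕ u)) i< , Has⇒∈ h

  Share⇒Sharing : ∀ {u v} → Share R u v → Sharing (toℕ u) (toℕ v)
  Share⇒Sharing {u} (_ , h , h′) with i , i< , refl ← codes-build⁻ (pt (toℕ u)) (ℓ (toℕ u)) h = i , i< , ∈⇒Has h′

  turns-paths : ∀ v → sumBelow (ℓ v ∸ 1) (Turn v) ≡ turns (build (pt v) (ℓ v))
  turns-paths v = trans (sumBelow-cong (ℓ v ∸ 1) λ i → distance-turn (x v i) (x v (1 + i)) (x v (2 + i))
      {y v i} {y v (1 + i)} {y v (2 + i)})
    (sym (turns-build (pt v) (ℓ v)))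

  forall-vertex : ∀ {A : ℕ → Set} → (∀ (v : Fin n) → A (toℕ v)) → ∀ v → v < n → A v
  forall-vertex {A} h v v< = subst A (Fin.toℕ-fromℕ< v<) (h (fromℕ< v<))

  module _ {adj : Fin n → Fin n → Bool} (α⇔adj : ∀ u v → α (toℕ u) (toℕ v) ⇔ T (adj u v)) where

    valid⇒family : Valid → Family adj k paths
    valid⇒family (isPath , adjacency , triples) = record
      { path       = λ v → let long , steps , distinct , _ = isPath (toℕ v) (Fin.toℕ<n v) in record
        { linked = linked-build⁺ (pt (toℕ v)) (ℓ (toℕ v)) λ i i< → Step⇒~ (steps i i<)
        ; unique = unique-build⁺ (pt (toℕ v)) (ℓ (toℕ v)) λ j j< i i< e →
            ¬False (distinct j j< i i< (cong proj₁ e , cong proj₂ e))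
        ; long   = subst (2 ≤_) (sym (length-build (pt (toℕ v)) (ℓ (toℕ v)))) (s≤s long) }
      ; turns≤k    = λ v → let _ , _ , _ , few = isPath (toℕ v) (Fin.toℕ<n v) in
          subst (_≤ k) (turns-paths (toℕ v)) (s≤s⁻¹ few)
      ; represents = record
        { adjacent = λ u v u≢v →
            let to , from = adjacency (toℕ u) (Fin.toℕ<n u) (toℕ v) (Fin.toℕ<n v) (λ e → ⊥-elim (u≢v (Fin.toℕ-injective e)))
            in mk⇔ (Sharing⇒Share ∘ to ∘ Equivalence.from (α⇔adj u v)) (Equivalence.to (α⇔adj u v) ∘ from ∘ Share⇒Sharing)
        ; helly    = triples⇒helly R
            (λ v → -, codes-build⁺ (pt (toℕ v)) (ℓ (toℕ v)) (proj₁ (isPath (toℕ v) (Fin.toℕ<n v)))) triple } }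
      where
      triple : Triples R
      triple d e f (a , d∈) (b , e∈) (c , f∈)
        with i , i< , refl ← codes-build⁻ (pt (toℕ a)) (ℓ (toℕ a)) d∈
        with j , j< , refl ← codes-build⁻ (pt (toℕ b)) (ℓ (toℕ b)) e∈
        with l , l< , refl ← codes-build⁻ (pt (toℕ c)) (ℓ (toℕ c)) f∈
        with w , w< , m , m< , h ← triples (toℕ a) (Fin.toℕ<n a) i i< (toℕ b) (Fin.toℕ<n b) j j< (toℕ c) (Fin.toℕ<n c) l l<
        = edgeAt w m ,
          (fromℕ< w< , subst (λ w′ → edgeAt w m ∈ codes (build (pt w′) (ℓ w′))) (sym (Fin.toℕ-fromℕ< w<)) (codes-build⁺ (pt w) (ℓ w) m<)) ,
          λ v t → Has⇒∈ (h (toℕ v) (Fin.toℕ<n v) (Sum.map (both v) (Sum.map (both v) (both v)) t))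
        where
        both : ∀ v {w l w′ l′} → R v (edgeAt w l) × R v (edgeAt w′ l′) → Has (toℕ v) w l × Has (toℕ v) w′ l′
        both v (p , q) = ∈⇒Has p , ∈⇒Has q

    family⇒valid : Family adj k paths → Valid
    family⇒valid F = forall-vertex isPath ,
      (λ u u< v v< → forall-vertex {λ u → ∀ v → v < n → (u ≡ v → False) → (α u v → Sharing u v) × (Sharing u v → α u v)}
        (λ u → forall-vertex (adjacency u)) u u< v v<) ,
      λ a a< i i< b b< j j< c c< l l< →
        let g , (w , g∈) , h = helly⇒triples R (λ v e → Any.any? (≡-dec ℕ._≟_ ℕ._≟_ e) (codes (paths v))) helly
              (edgeAt a i) (edgeAt b j) (edgeAt c l)
              (member a a< i<) (member b b< j<) (member c c< l<)
            m , m< , g≡ = codes-build⁻ (pt (toℕ w)) (ℓ (toℕ w)) g∈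
        in toℕ w , Fin.toℕ<n w , m , m< , forall-vertex λ v t →
             ∈⇒Has (subst (R v) g≡ (h v (Sum.map (both v) (Sum.map (both v) (both v)) t)))
      where
      open Family F
      open Represents-by represents
      both : ∀ v {w l w′ l′} → Has (toℕ v) w l × Has (toℕ v) w′ l′ → R v (edgeAt w l) × R v (edgeAt w′ l′)
      both v (p , q) = Has⇒∈ p , Has⇒∈ q
      member : ∀ a → a < n → ∀ {i} → i < ℓ a → ∃[ v ] R v (edgeAt a i)
      member a a< {i} i< = fromℕ< a< , subst (λ b → edgeAt a i ∈ codes (build (pt b) (ℓ b))) (sym (Fin.toℕ-fromℕ< a<))
        (codes-build⁺ (pt a) (ℓ a) i<)
      isPath : ∀ v → PathAt (toℕ v)
      isPath v = s≤s⁻¹ (subst (2 ≤_) (length-build (pt (toℕ v)) (ℓ (toℕ v))) (Path.long (path v))) ,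
        (λ i i< → ~⇒Step (linked-build⁻ (pt (toℕ v)) (ℓ (toℕ v)) (Path.linked (path v)) i i<)) ,
        (λ j j< i i< (e , e′) → contradiction (cong₂ _,_ e e′) (unique-build⁻ (pt (toℕ v)) (ℓ (toℕ v)) (Path.unique (path v)) j j< i i<)) ,
        s≤s (subst (_≤ k) (sym (turns-paths (toℕ v))) (turns≤k v))
      adjacency : ∀ u v → (toℕ u ≡ toℕ v → False) →
                  (α (toℕ u) (toℕ v) → Sharing (toℕ u) (toℕ v)) × (Sharing (toℕ u) (toℕ v) → α (toℕ u) (toℕ v))
      adjacency u v u≢v = let a = adjacent u v (¬False ∘ u≢v ∘ cong toℕ) in
        Share⇒Sharing ∘ Equivalence.to a ∘ Equivalence.to (α⇔adj u v) ,
        Equivalence.from (α⇔adj u v) ∘ Equivalence.from a ∘ Sharing⇒Share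

-- Words

cell-++ˡ : ∀ a b {i} → i < length a → cell (a ++ b) i ≡ cell a i
cell-++ˡ (c ∷ a) b {zero}  _       = refl
cell-++ˡ (c ∷ a) b {suc i} (s≤s h) = cell-++ˡ a b h

cell-++ʳ : ∀ a b i → cell (a ++ b) (length a + i) ≡ cell b i
cell-++ʳ []      b i = refl
cell-++ʳ (c ∷ a) b i = cell-++ʳ a b i

cell-drop : ∀ m x j → cell (List.drop m x) j ≡ cell x (m + j)
cell-drop zero    x       j = refl
cell-drop (suc m) []      j = refl
cell-drop (suc m) (b ∷ x) j = cell-drop m x j

cell-≥ : ∀ w {i} → length w ≤ i → cell w i ≡ nothing
cell-≥ []      _       = refl
cell-≥ (b ∷ w) (s≤s h) = cell-≥ w h

cell-just : ∀ w {i} → i < length w → cell w i ≡ just (isBit true (cell w i))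
cell-just (true  ∷ w) {zero}  _       = refl
cell-just (false ∷ w) {zero}  _       = refl
cell-just (b ∷ w)     {suc i} (s≤s h) = cell-just w h

word-≡ : ∀ x w → (∀ i → cell x i ≡ cell w i) → x ≡ w
word-≡ []      []      e = refl
word-≡ []      (b ∷ w) e with () ← e 0
word-≡ (b ∷ x) []      e with () ← e 0
word-≡ (b ∷ x) (c ∷ w) e with refl ← e 0 = cong (b ∷_) (word-≡ x w (e ∘ suc))

cell-replicate : ∀ n b {i} → i < n → cell (replicate n b) i ≡ just b
cell-replicate (suc n) b {zero}  _       = refl
cell-replicate (suc n) b {suc i} (s≤s h) = cell-replicate n b h

cell-tabulate : ∀ {m} (f : Fin m → Bool) v → cell (tabulate f) (toℕ v) ≡ just (f v)
cell-tabulate f zero    = refl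
cell-tabulate f (suc v) = cell-tabulate (f ∘ suc) v

matrix : ∀ {a b} → (Fin a → Fin b → Bool) → Word
matrix f = concat (tabulate λ u → tabulate (f u))

length-matrix : ∀ {a b} (f : Fin a → Fin b → Bool) → length (matrix f) ≡ a * b
length-matrix {zero}  f = refl
length-matrix {suc a} f = trans (List.length-++ (tabulate (f zero)))
  (cong₂ _+_ (List.length-tabulate (f zero)) (length-matrix (f ∘ suc)))

cell-matrix : ∀ {a b} (f : Fin a → Fin b → Bool) u v → cell (matrix f) (toℕ u * b + toℕ v) ≡ just (f u v)
cell-matrix {suc a} {b} f zero    v = trans (cell-++ˡ (tabulate (f zero)) _
  (subst (toℕ v <_) (sym (List.length-tabulate (f zero))) (Fin.toℕ<n v))) (cell-tabulate (f zero) v)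
cell-matrix {suc a} {b} f (suc u) v = trans
  (cong (cell (matrix f)) (trans (ℕ.+-assoc b (toℕ u * b) (toℕ v))
    (cong (_+ (toℕ u * b + toℕ v)) (sym (List.length-tabulate (f zero))))))
  (trans (cell-++ʳ (tabulate (f zero)) (matrix (f ∘ suc)) _) (cell-matrix (f ∘ suc) u v))

-- A description by single cells, the only access that formulas have to a word. `layout-unique`
-- turns it back into an equality of words.
record Layout (n : ℕ) (f : Fin n → Fin n → Bool) (d x : Word) : Set where
  field
    ones   : ∀ i → i < n → cell x i ≡ just true
    end    : cell x n ≡ just false
    bits   : ∀ u v → cell x (1 + n + (toℕ u * n + toℕ v)) ≡ just (f u v)
    rest   : ∀ j → cell x (1 + n + n * n + j) ≡ cell d j

entry-in-range : ∀ {n} (a b : Fin n) → toℕ a * n + toℕ b < n * n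
entry-in-range {n} a b = ℕ.<-≤-trans (ℕ.+-monoʳ-< (toℕ a * n) (Fin.toℕ<n b))
  (subst (_≤ n * n) (ℕ.+-comm n (toℕ a * n)) (ℕ.*-monoˡ-≤ n (Fin.toℕ<n a)))

encode-layout : ∀ G k → Layout (Graph.order G) (Graph.adj G) (digits (fromℕ k)) (encode G k)
encode-layout G k = record
  { ones = λ i i< → trans (cell-++ˡ (replicate n true) _ (subst (i <_) (sym len) i<)) (cell-replicate n true i<)
  ; end  = trans (cong (cell (encode G k)) (sym (ℕ.+-identityʳ n))) (after 0)
  ; bits = λ u v → trans (after′ (toℕ u * n + toℕ v)) (trans (cell-++ˡ (matrix adj) d
             (subst (toℕ u * n + toℕ v <_) (sym (length-matrix adj)) (entry-in-range u v))) (cell-matrix adj u v))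
  ; rest = λ j → trans (cong (cell (encode G k)) (ℕ.+-assoc (1 + n) (n * n) j)) (trans (after′ (n * n + j))
             (trans (cong (λ m → cell (matrix adj ++ d) (m + j)) (sym (length-matrix adj))) (cell-++ʳ (matrix adj) d j)))
  }
  where
  open Graph G
  n = order
  d = digits (fromℕ k)
  len : length (replicate n true) ≡ n
  len = List.length-replicate n
  after : ∀ i → cell (encode G k) (n + i) ≡ cell (false ∷ matrix adj ++ d) i
  after i = trans (cong (λ m → cell (encode G k) (m + i)) (sym len)) (cell-++ʳ (replicate n true) _ i)
  after′ : ∀ i → cell (encode G k) (1 + n + i) ≡ cell (matrix adj ++ d) i
  after′ i = trans (cong (cell (encode G k)) (sym (ℕ.+-suc n i))) (after (suc i))

data Position (n : ℕ) : ℕ → Set where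
  ones : ∀ {i} → i < n → Position n i
  end  : Position n n
  bits : ∀ (u v : Fin n) → Position n (1 + n + (toℕ u * n + toℕ v))
  rest : ∀ j → Position n (1 + n + n * n + j)

position : ∀ n i → Position n i
position n i with ℕ.<-cmp i n
... | tri< i<n _ _  = ones i<n
... | tri≈ _ refl _ = end
... | tri> _ _ n<i with i ∸ suc n | ℕ.m+[n∸m]≡n n<i
...   | m | refl with m ℕ.<? n * n
...     | no m≮ = subst (Position n) (trans (ℕ.+-assoc (1 + n) (n * n) (m ∸ n * n))
                    (cong (λ j → suc (n + j)) (ℕ.m+[n∸m]≡n (ℕ.≮⇒≥ m≮)))) (rest (m ∸ n * n))
...     | yes m< = subst (Position n) (cong (λ j → suc (n + j)) index) (bits u v)
  where
  u = proj₁ (remQuot {n} n (fromℕ< m<))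
  v = proj₂ (remQuot {n} n (fromℕ< m<))
  index : toℕ u * n + toℕ v ≡ m
  index = trans (cong (_+ toℕ v) (ℕ.*-comm (toℕ u) n)) (trans (sym (Fin.toℕ-combine u v))
    (trans (cong toℕ (Fin.combine-remQuot {n} n (fromℕ< m<))) (Fin.toℕ-fromℕ< m<)))

layout-unique : ∀ {n f d x w} → Layout n f d x → Layout n f d w → x ≡ w
layout-unique {n} {f} {d} {x} {w} A B = word-≡ x w λ i → go (position n i)
  where
  module A = Layout A
  module B = Layout B
  go : ∀ {i} → Position n i → cell x i ≡ cell w i
  go (ones i<)  = trans (A.ones _ i<) (sym (B.ones _ i<))
  go end        = trans A.end (sym B.end)
  go (bits u v) = trans (A.bits u v) (sym (B.bits u v))
  go (rest j)   = trans (A.rest j) (sym (B.rest j))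

-- Bijective numerals

value : Word → ℕ
value []          = 0
value (false ∷ w) = 1 + (value w + value w)
value (true  ∷ w) = 1 + (1 + (value w + value w))

numeral : Word → ℕᵇ
numeral []          = ℕᵇ.zero
numeral (false ∷ w) = 1+[2 numeral w ]
numeral (true  ∷ w) = 2[1+ numeral w ]

digits-numeral : ∀ w → digits (numeral w) ≡ w
digits-numeral []          = refl
digits-numeral (false ∷ w) = cong (false ∷_) (digits-numeral w)
digits-numeral (true  ∷ w) = cong (true ∷_) (digits-numeral w)

numeral-digits : ∀ b → numeral (digits b) ≡ b
numeral-digits ℕᵇ.zero  = refl
numeral-digits 2[1+ b ] = cong 2[1+_] (numeral-digits b)
numeral-digits 1+[2 b ] = cong 1+[2_] (numeral-digits b)

toℕ-numeral : ∀ w → ℕᵇ.toℕ (numeral w) ≡ value w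
toℕ-numeral []          = refl
toℕ-numeral (false ∷ w) rewrite toℕ-numeral w | ℕ.+-identityʳ (value w) = refl
toℕ-numeral (true  ∷ w) rewrite toℕ-numeral w | ℕ.+-identityʳ (value w) = cong suc (ℕ.+-suc (value w) (value w))

-- In bijective numeration every word is the numeral of its value, so the tail of an instance needs
-- no test of well-formedness.
digits-value : ∀ w → digits (fromℕ (value w)) ≡ w
digits-value w = trans (cong digits (trans (cong fromℕ (sym (toℕ-numeral w))) (fromℕ-toℕ (numeral w)))) (digits-numeral w)

value-digits : ∀ k → value (digits (fromℕ k)) ≡ k
value-digits k = trans (sym (toℕ-numeral (digits (fromℕ k)))) (trans (cong ℕᵇ.toℕ (numeral-digits (fromℕ k))) (toℕ-fromℕ k))

-- q lists the values of the suffixes of the numeral w.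
Chain : Word → (ℕ → ℕ) → Set
Chain w q = ∀ i → i < length w →
  (cell w i ≡ just true  × q i ≡ 1 + (1 + (q (1 + i) + q (1 + i)))) ⊎
  (cell w i ≡ just false × q i ≡ 1 + (q (1 + i) + q (1 + i)))

chain-value : ∀ w q → Chain w q → q (length w) ≡ 0 → q 0 ≡ value w
chain-value []      q c e = e
chain-value (b ∷ w) q c e with chain-value w (q ∘ suc) (λ i i< → c (suc i) (s≤s i<)) e | c 0 (s≤s z≤n)
... | h | inj₁ (refl , e′) = trans e′ (cong (λ m → 1 + (1 + (m + m))) h)
... | h | inj₂ (refl , e′) = trans e′ (cong (λ m → 1 + (m + m)) h)

suffix-chain : ∀ w → Chain w λ i → value (List.drop i w)
suffix-chain (true  ∷ w) zero    _       = inj₁ (refl , refl)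
suffix-chain (false ∷ w) zero    _       = inj₂ (refl , refl)
suffix-chain (b ∷ w)     (suc i) (s≤s h) = suffix-chain w i h

value-drop-≤ : ∀ w i → value (List.drop i w) ≤ value w
value-drop-≤ w           zero    = ℕ.≤-refl
value-drop-≤ []          (suc i) = z≤n
value-drop-≤ (false ∷ w) (suc i) = ℕ.≤-trans (value-drop-≤ w i) (ℕ.m≤n⇒m≤1+n (ℕ.m≤m+n _ _))
value-drop-≤ (true  ∷ w) (suc i) = ℕ.≤-trans (value-drop-≤ w i) (ℕ.m≤n⇒m≤1+n (ℕ.m≤n⇒m≤1+n (ℕ.m≤m+n _ _)))

drop-all : ∀ (w : Word) {i} → length w ≤ i → List.drop i w ≡ []
drop-all []      {zero}  _       = refl
drop-all []      {suc i} _       = refl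
drop-all (b ∷ w) {suc i} (s≤s h) = drop-all w h

-- Certificates as arrays of numbers in unary

times : ℕ → ℕ → ℕ
times m n = sumBelow m λ _ → n

times≡* : ∀ m n → times m n ≡ m * n
times≡* zero    n = refl
times≡* (suc m) n = trans (cong (_+ n) (times≡* m n)) (ℕ.+-comm (m * n) n)

-- Counts the ones in block `j` of `B` cells. Every word is therefore a legal array, and blocks
-- beyond its end hold 0.
entry : Word → ℕ → ℕ → ℕ
entry u B j = sumBelow B λ i → fromBool (isBit true (cell u (times j B + i)))

block : ℕ → ℕ → Word
block B v = tabulate {n = B} λ i → toℕ i <ᵇ v

blocks : ℕ → ℕ → (ℕ → ℕ) → Word
blocks B zero    a = []
blocks B (suc J) a = block B (a 0) ++ blocks B J (a ∘ suc)

length-block : ∀ B v → length (block B v) ≡ B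
length-block B v = List.length-tabulate {n = B} _

length-blocks : ∀ B J a → length (blocks B J a) ≡ J * B
length-blocks B zero    a = refl
length-blocks B (suc J) a = trans (List.length-++ (block B (a 0))) (cong₂ _+_ (length-block B (a 0)) (length-blocks B J (a ∘ suc)))

cell-block : ∀ B v {i} → i < B → cell (block B v) i ≡ just (i <ᵇ v)
cell-block B v {i} i< = subst (λ j → cell (block B v) j ≡ just (j <ᵇ v)) (Fin.toℕ-fromℕ< i<)
  (cell-tabulate (λ i → toℕ i <ᵇ v) (fromℕ< i<))

cell-blocks : ∀ B J a {j i} → j < J → i < B → cell (blocks B J a) (j * B + i) ≡ just (i <ᵇ a j)
cell-blocks B (suc J) a {zero}  _        i< = trans (cell-++ˡ (block B (a 0)) _ (subst (_ <_) (sym (length-block B (a 0))) i<)) (cell-block B (a 0) i<)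
cell-blocks B (suc J) a {suc j} {i} (s≤s j<) i< = trans
  (cong (cell (blocks B (suc J) a)) (trans (ℕ.+-assoc B (j * B) i) (cong (_+ (j * B + i)) (sym (length-block B (a 0))))))
  (trans (cell-++ʳ (block B (a 0)) _ _) (cell-blocks B J (a ∘ suc) j< i<))

sumBelow-cong-< : ∀ n {f g : ℕ → ℕ} → (∀ i → i < n → f i ≡ g i) → sumBelow n f ≡ sumBelow n g
sumBelow-cong-< zero    e = refl
sumBelow-cong-< (suc n) e = cong₂ _+_ (sumBelow-cong-< n λ i i< → e i (ℕ.m<n⇒m<1+n i<)) (e n ℕ.≤-refl)

sum-thermometer : ∀ B v → sumBelow B (λ i → fromBool (i <ᵇ v)) ≡ B ⊓ v
sum-thermometer zero    v = refl
sum-thermometer (suc B) v with B ℕ.<? v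
... | yes B<v rewrite dec-true (B ℕ.<? v) B<v | sum-thermometer B v | ℕ.m≤n⇒m⊓n≡m (ℕ.<⇒≤ B<v) | ℕ.m≤n⇒m⊓n≡m B<v = ℕ.+-comm B 1
... | no B≮v  rewrite dec-false (B ℕ.<? v) B≮v | sum-thermometer B v | ℕ.m≥n⇒m⊓n≡n (ℕ.≮⇒≥ B≮v)
  | ℕ.m≥n⇒m⊓n≡n (ℕ.m≤n⇒m≤1+n (ℕ.≮⇒≥ B≮v)) = ℕ.+-identityʳ v

isBit-just : ∀ b → isBit true (just b) ≡ b
isBit-just true  = refl
isBit-just false = refl

entry-blocks : ∀ B J a j → a j ≤ B → (J ≤ j → a j ≡ 0) → entry (blocks B J a) B j ≡ a j
entry-blocks B J a j a≤B out with j ℕ.<? J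
... | yes j<J = trans (sumBelow-cong-< B λ i i< → cong fromBool (trans (cong (isBit true)
                  (trans (cong (λ m → cell (blocks B J a) (m + i)) (times≡* j B)) (cell-blocks B J a j<J i<))) (isBit-just _)))
                (trans (sum-thermometer B (a j)) (ℕ.m≥n⇒m⊓n≡n a≤B))
... | no j≮J  = trans (trans (sumBelow-cong-< B {g = λ _ → 0} λ i i< → cong (fromBool ∘ isBit true)
                  (cell-≥ (blocks B J a) (subst (_≤ times j B + i) (sym (length-blocks B J a))
                    (ℕ.≤-trans (ℕ.*-monoˡ-≤ B (ℕ.≮⇒≥ j≮J)) (ℕ.≤-trans (ℕ.≤-reflexive (sym (times≡* j B))) (ℕ.m≤m+n _ i))))))
                  (zeros B)) (sym (out (ℕ.≮⇒≥ j≮J)))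
  where
  zeros : ∀ B → sumBelow B (λ _ → 0) ≡ 0
  zeros zero    = refl
  zeros (suc B) = trans (ℕ.+-identityʳ _) (zeros B)

interleave : (f g h : ℕ → ℕ) → ℕ → ℕ
interleave f g h 0                   = f 0
interleave f g h 1                   = g 0
interleave f g h 2                   = h 0
interleave f g h (suc (suc (suc j))) = interleave (f ∘ suc) (g ∘ suc) (h ∘ suc) j

thrice-suc : ∀ q → suc q + suc q + suc q ≡ 3 + (q + q + q)
thrice-suc = solve 1 (λ q → con 1 :+ q :+ (con 1 :+ q) :+ (con 1 :+ q) := con 3 :+ (q :+ q :+ q)) refl

interleave-0 : ∀ f g h q → interleave f g h (q + q + q) ≡ f q
interleave-0 f g h zero    = refl
interleave-0 f g h (suc q) = trans (cong (interleave f g h) (thrice-suc q)) (interleave-0 (f ∘ suc) (g ∘ suc) (h ∘ suc) q)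

interleave-1 : ∀ f g h q → interleave f g h (1 + (q + q + q)) ≡ g q
interleave-1 f g h zero    = refl
interleave-1 f g h (suc q) = trans (cong (λ j → interleave f g h (1 + j)) (thrice-suc q)) (interleave-1 (f ∘ suc) (g ∘ suc) (h ∘ suc) q)

interleave-2 : ∀ f g h q → interleave f g h (1 + (1 + (q + q + q))) ≡ h q
interleave-2 f g h zero    = refl
interleave-2 f g h (suc q) = trans (cong (λ j → interleave f g h (2 + j)) (thrice-suc q)) (interleave-2 (f ∘ suc) (g ∘ suc) (h ∘ suc) q)

-- Serves twice: with `Q` zero for the bound on all entries, and with the length of the arrays for
-- the zeros beyond them.
interleave-All : ∀ {P : ℕ → Set} f g h Q → (∀ q → Q ≤ q → P (f q) × P (g q) × P (h q)) →
                 ∀ j → Q + Q + Q ≤ j → P (interleave f g h j)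
interleave-All f g h zero a 0 _ = proj₁ (a 0 z≤n)
interleave-All f g h zero a 1 _ = proj₁ (proj₂ (a 0 z≤n))
interleave-All f g h zero a 2 _ = proj₂ (proj₂ (a 0 z≤n))
interleave-All {P} f g h zero a (suc (suc (suc j))) _ =
  interleave-All {P} (f ∘ suc) (g ∘ suc) (h ∘ suc) zero (λ q _ → a (suc q) z≤n) j z≤n
interleave-All {P} f g h (suc Q) a j Q≤j with subst (_≤ j) (thrice-suc Q) Q≤j
... | s≤s (s≤s (s≤s le)) = interleave-All {P} (f ∘ suc) (g ∘ suc) (h ∘ suc) Q (λ q Q≤q → a (suc q) (s≤s Q≤q)) _ le

-- The verified conditions as a bounded formula

power : ℕ → ℕ → ℕ
power zero    n = 1
power (suc c) n = times n (power c n)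

width : ℕ → ℕ → ℕ
width c n = times n (1 + (1 + power c n))

-- The summands cover the three sorts of stored numbers: numbers of edges are at most the square of
-- the width, coordinates at most the width, and `k` with its suffixes at most the power. It is
-- applied to the length of the instance in place of the order.
bound : ℕ → ℕ → ℕ
bound c n = times (width c n) (width c n) + width c n + power c n

triple : ℕ → ℕ
triple q = q + q + q

-- Cells 3q, 3q + 1 and 3q + 2 of the certificate hold the two coordinates of
-- point i of path v, where q = v (1 + B) + i, and an entry of a third array:
-- the length of path q if q < n, and otherwise the value of the numeral for k
-- without its first q − n digits.
module Decoding (u : Word) (B : ℕ) where

  slot : ℕ → ℕ → ℕ
  slot v i = times v (1 + B) + i

  abscissa ordinate : ℕ → ℕ → ℕ
  abscissa v i = entry u B (triple (slot v i))
  ordinate v i = entry u B (1 + triple (slot v i))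

  auxiliary : ℕ → ℕ
  auxiliary q = entry u B (1 + (1 + triple q))

module _ {Γ : ℕ} where

  infixl 7 _⊠_

  ↑_ : Term Γ → Term (suc Γ)
  ↑ t = ren suc t

  _⊠_ : Term Γ → Term Γ → Term Γ
  t ⊠ s = sum t (↑ s)

  zeroᵗ : Term Γ
  zeroᵗ = one ⊟ one

  falsum : Formula Γ
  falsum = one <′ one

  v₀ : Term (suc Γ)
  v₀ = var zero

  v₁ : Term (2 + Γ)
  v₁ = var (suc zero)

powerᵗ widthᵗ boundᵗ : ℕ → Term 1
powerᵗ zero    = one
powerᵗ (suc c) = v₀ ⊠ powerᵗ c
widthᵗ c = v₀ ⊠ (one ⊞ (one ⊞ powerᵗ c))
boundᵗ c = widthᵗ c ⊠ widthᵗ c ⊞ widthᵗ c ⊞ powerᵗ c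

module _ {Γ : ℕ} where

  entryᵗ : (B j : Term Γ) → Term Γ
  entryᵗ B j = sum B (bit certificate true (↑ (j ⊠ B) ⊞ v₀))

  slotᵗ : (B v i : Term Γ) → Term Γ
  slotᵗ B v i = v ⊠ (one ⊞ B) ⊞ i

  tripleᵗ : Term Γ → Term Γ
  tripleᵗ q = q ⊞ q ⊞ q

  xᵗ yᵗ : (B v i : Term Γ) → Term Γ
  xᵗ B v i = entryᵗ B (tripleᵗ (slotᵗ B v i))
  yᵗ B v i = entryᵗ B (one ⊞ tripleᵗ (slotᵗ B v i))

  auxᵗ : (B q : Term Γ) → Term Γ
  auxᵗ B q = entryᵗ B (one ⊞ (one ⊞ tripleᵗ q))

  equalityᵗ distanceᵗ : (a b : Term Γ) → Term Γ
  equalityᵗ a b = one ⊟ ((a ⊟ b) ⊞ (b ⊟ a))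
  distanceᵗ a b = (a ⊟ b) ⊞ (b ⊟ a)

  turnᵗ : (B v i : Term Γ) → Term Γ
  turnᵗ B v i = distanceᵗ (equalityᵗ (xᵗ B v i) (xᵗ B v (one ⊞ i)))
                          (equalityᵗ (xᵗ B v (one ⊞ i)) (xᵗ B v (one ⊞ (one ⊞ i))))

  step′ : (x y x′ y′ : Term Γ) → Formula Γ
  step′ x y x′ y′ = (x ≈′ x′ ∧′ (y′ ≈′ one ⊞ y ∨′ y ≈′ one ⊞ y′)) ∨′ (y ≈′ y′ ∧′ (x′ ≈′ one ⊞ x ∨′ x ≈′ one ⊞ x′))

  same′ : (B u i v j : Term Γ) → Formula Γ
  same′ B u i v j = xᵗ B u i ⊞ xᵗ B u (one ⊞ i) ≈′ xᵗ B v j ⊞ xᵗ B v (one ⊞ j) ∧′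
                    yᵗ B u i ⊞ yᵗ B u (one ⊞ i) ≈′ yᵗ B v j ⊞ yᵗ B v (one ⊞ j)

  bit₁ : (n u v : Term Γ) → Formula Γ
  bit₁ n u v = bit′ instance′ true (one ⊞ n ⊞ (u ⊠ n ⊞ v))

module _ {Γ : ℕ} where

  has′ : (B v w l : Term Γ) → Formula Γ
  has′ B v w l = any′ (auxᵗ B v) (same′ (↑ B) (↑ w) (↑ l) (↑ v) v₀)

  path′ : (B k v : Term Γ) → Formula Γ
  path′ B k v = (zeroᵗ <′ auxᵗ B v) ∧′
    all′ (auxᵗ B v) (step′ (xᵗ (↑ B) (↑ v) v₀) (yᵗ (↑ B) (↑ v) v₀)
                           (xᵗ (↑ B) (↑ v) (one ⊞ v₀)) (yᵗ (↑ B) (↑ v) (one ⊞ v₀))) ∧′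
    all′ (one ⊞ auxᵗ B v) (all′ v₀
      ((xᵗ (↑ ↑ B) (↑ ↑ v) v₀ ≈′ xᵗ (↑ ↑ B) (↑ ↑ v) v₁ ∧′ yᵗ (↑ ↑ B) (↑ ↑ v) v₀ ≈′ yᵗ (↑ ↑ B) (↑ ↑ v) v₁) ⇒′ falsum)) ∧′
    (sum (auxᵗ B v ⊟ one) (turnᵗ (↑ B) (↑ v) v₀) <′ one ⊞ k)

module _ {Γ : ℕ} where

  sharing′ : (B u v : Term Γ) → Formula Γ
  sharing′ B u v = any′ (auxᵗ B u) (has′ (↑ B) (↑ v) (↑ u) v₀)

  two′ : (B v a i b j c l : Term Γ) → Formula Γ
  two′ B v a i b j c l = (has′ B v a i ∧′ has′ B v b j) ∨′ (has′ B v a i ∧′ has′ B v c l) ∨′ (has′ B v b j ∧′ has′ B v c l)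

module _ {Γ : ℕ} (B n : Term Γ) where

  adjacency′ : Formula Γ
  adjacency′ = all′ n (all′ (↑ n) (((v₁ ≈′ v₀) ⇒′ falsum) ⇒′
    ((bit₁ (↑ ↑ n) v₁ v₀ ⇒′ sharing′ (↑ ↑ B) v₁ v₀) ∧′ (sharing′ (↑ ↑ B) v₁ v₀ ⇒′ bit₁ (↑ ↑ n) v₁ v₀))))

  helly′ : Formula Γ
  helly′ =
    all′ n $ all′ (auxᵗ (↑ B) v₀) $
    all′ (↑ ↑ n) $ all′ (auxᵗ (↑ ↑ ↑ B) v₀) $
    all′ (↑ ↑ ↑ ↑ n) $ all′ (auxᵗ (↑ ↑ ↑ ↑ ↑ B) v₀) $
    any′ (↑ ↑ ↑ ↑ ↑ ↑ n) $ any′ (auxᵗ (↑ ↑ ↑ ↑ ↑ ↑ ↑ B) v₀) $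
    all′ (↑ ↑ ↑ ↑ ↑ ↑ ↑ ↑ n)
      -- The variables 8 to 3 are `a`, `i`, `b`, `j`, `c`, `l` of `HellyTriples`, and 2, 1, 0 are
      -- `w`, `m`, `v`.
      (two′ B₉ v₀ (var (# 8)) (var (# 7)) (var (# 6)) (var (# 5)) (var (# 4)) (var (# 3)) ⇒′
       has′ B₉ v₀ (var (# 2)) (var (# 1)))
    where B₉ = ↑ ↑ ↑ ↑ ↑ ↑ ↑ ↑ ↑ B

  family′ : Term Γ → Formula Γ
  family′ k = all′ n (path′ (↑ B) (↑ k) v₀) ∧′ adjacency′ ∧′ helly′

  numeral′ : (k L : Term Γ) → Formula Γ
  numeral′ k L = auxᵗ B (n ⊞ zeroᵗ) ≈′ k ∧′ auxᵗ B (n ⊞ L) ≈′ zeroᵗ ∧′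
    all′ L ((bit′ instance′ true (offset ⊞ v₀) ∧′ next v₀ ≈′ one ⊞ (one ⊞ (next (one ⊞ v₀) ⊞ next (one ⊞ v₀)))) ∨′
            (bit′ instance′ false (offset ⊞ v₀) ∧′ next v₀ ≈′ one ⊞ (next (one ⊞ v₀) ⊞ next (one ⊞ v₀))))
    where
    offset : Term (suc Γ)
    offset = one ⊞ ↑ n ⊞ ↑ n ⊠ ↑ n
    next : Term (suc Γ) → Term (suc Γ)
    next i = auxᵗ (↑ B) (↑ n ⊞ i)

-- The order `n`, the number `L` of digits and `k` are found by bounded search in this order, so
-- innermost the variables 0 to 3 are `k`, `L`, `n` and the length of the instance.
verification : ℕ → Formula 1
verification c =
  any′ v₀ (all′ v₀ (bit′ instance′ true v₀) ∧′ bit′ instance′ false v₀ ∧′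
  any′ v₁ (var (# 2) ≈′ one ⊞ v₁ ⊞ v₁ ⊠ v₁ ⊞ v₀ ∧′
    all′ v₁ (all′ (var (# 2)) (bit₁ (var (# 3)) v₁ v₀ ⇒′ bit₁ (var (# 3)) v₀ v₁)) ∧′
    all′ v₁ (bit₁ (var (# 2)) v₀ v₀ ⇒′ falsum) ∧′
  any′ (one ⊞ ren (λ _ → # 1) (powerᵗ c))
    (numeral′ (ren (λ _ → # 3) (boundᵗ c)) (var (# 2)) v₀ v₁ ∧′
     family′ (ren (λ _ → # 3) (boundᵗ c)) (var (# 2)) v₀)))

-- With `N` the length of the instance, `N * (1 + B)` slots hold all points, and `N + N` more ensure
-- room for the path lengths and the suffixes of the numeral, whose indices are at most `N + N`.
-- There are three arrays with entries of `B` cells.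
certificateLength : ℕ → Term 1
certificateLength c = tripleᵗ (v₀ ⊠ (one ⊞ boundᵗ c) ⊞ (v₀ ⊞ v₀)) ⊠ boundᵗ c

module _ {x u : Word} where

  open Semantics x u

  eval-power : ∀ c ρ → eval (powerᵗ c) ρ ≡ power c (ρ zero)
  eval-power zero    ρ = refl
  eval-power (suc c) ρ = cong (times (ρ zero)) (eval-power c ρ)

  eval-width : ∀ c ρ → eval (widthᵗ c) ρ ≡ width c (ρ zero)
  eval-width c ρ = cong (λ m → times (ρ zero) (1 + (1 + m))) (eval-power c ρ)

  eval-bound : ∀ c ρ → eval (boundᵗ c) ρ ≡ bound c (ρ zero)
  eval-bound c ρ = cong₂ _+_ (cong₂ _+_ (cong₂ times w w) w) (eval-power c ρ)
    where w = eval-width c ρ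

power≡^ : ∀ c n → power c n ≡ n ^ c
power≡^ zero    n = refl
power≡^ (suc c) n = trans (times≡* n (power c n)) (cong (n *_) (power≡^ c n))

module _ (x : Word) (n : ℕ) where

  adjacentBit : ℕ → ℕ → Set
  adjacentBit a b = cell x (1 + n + (times a n + b)) ≡ just true

  Symmetric Irreflexive : Set
  Symmetric   = ∀ a → a < n → ∀ b → b < n → adjacentBit a b → adjacentBit b a
  Irreflexive = ∀ a → a < n → adjacentBit a a → False

module _ (x u : Word) (n k B : ℕ) where

  open Decoding u B

  Numeral : ℕ → Set
  Numeral L = auxiliary (n + 0) ≡ k × auxiliary (n + L) ≡ 0 × (∀ i → i < L →
    (cell x (1 + n + times n n + i) ≡ just true ×
       auxiliary (n + i) ≡ 1 + (1 + (auxiliary (n + (1 + i)) + auxiliary (n + (1 + i))))) ⊎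
    (cell x (1 + n + times n n + i) ≡ just false ×
       auxiliary (n + i) ≡ 1 + (auxiliary (n + (1 + i)) + auxiliary (n + (1 + i)))))

  ValidFamily : Set
  ValidFamily = Coordinates.Valid n k abscissa ordinate auxiliary (adjacentBit x n)

-- The definitional unfolding of `verification c`. Only the bounds stay under `eval`, since
-- `powerᵗ c` does not reduce while `c` is a variable.
Verified : ℕ → Word → Word → Set
Verified c x u = ∃[ n ] n < N × (∀ i → i < n → cell x i ≡ just true) × cell x n ≡ just false ×
  ∃[ L ] L < N × N ≡ 1 + n + times n n + L × Symmetric x n × Irreflexive x n ×
  ∃[ k ] k < 1 + eval (powerᵗ c) (λ _ → n) × Numeral x u n k B L × ValidFamily x u n k B
  where
  open Semantics x u
  N = length x
  B = eval (boundᵗ c) λ _ → N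

verified⇒sat : ∀ c {x u} → Verified c x u → sat x u (verification c) (λ _ → length x)
verified⇒sat c v = v

sat⇒verified : ∀ c {x u} → sat x u (verification c) (λ _ → length x) → Verified c x u
sat⇒verified c v = v

-- Soundness

isBit-true : ∀ {b} → T (isBit true b) ⇔ b ≡ just true
isBit-true {nothing}    = mk⇔ (λ ()) (λ ())
isBit-true {just true}  = mk⇔ (λ _ → refl) (λ _ → tt)
isBit-true {just false} = mk⇔ (λ ()) (λ ())

T-≡ : ∀ {a b} → (T a → T b) → (T b → T a) → a ≡ b
T-≡ {true}  {true}  _ _ = refl
T-≡ {true}  {false} f _ = ⊥-elim (f tt)
T-≡ {false} {true}  _ g = ⊥-elim (g tt)
T-≡ {false} {false} _ _ = refl

T-false : ∀ {a} → ¬ T a → a ≡ false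
T-false {true}  h = ⊥-elim (h tt)
T-false {false} h = refl

-- The graph is read off the adjacency bits, and `x` is recognised as its encoding cell by cell. The
-- certificate enters only through its decoded arrays, which may be arbitrary functions that satisfy
-- the conditions.
verified⇒problem : ∀ c {x u} → Verified c x u → HellyBEPGProblem c x
verified⇒problem c {x} {u} (n , n<N , initial , stop , L , _ , len , symmetric , irreflexive , k , k< , (first , last , chain) , valid) =
  G , k , layout-unique layout (encode-layout G k) ,
  subst (k ≤_) (trans (eval-power {x} {u} c (λ _ → n)) (power≡^ c n)) (s≤s⁻¹ k<) ,
  family⇒representation G (Coordinates.valid⇒family n k _ _ _ _ (λ a b → mk⇔ (Equivalence.from isBit-true) (Equivalence.to isBit-true)) valid)
  where
  B = Semantics.eval x u (boundᵗ c) λ _ → length x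
  open Decoding u B using (auxiliary)
  adj : Fin n → Fin n → Bool
  adj a b = isBit true (cell x (1 + n + (times (toℕ a) n + toℕ b)))
  to : ∀ a b → T (adj a b) → T (adj b a)
  to a b = Equivalence.from isBit-true ∘ symmetric (toℕ a) (Fin.toℕ<n a) (toℕ b) (Fin.toℕ<n b) ∘ Equivalence.to isBit-true
  G : Graph
  G = record
    { order = n ; adj = adj
    ; adj-sym    = λ a b → T-≡ (to a b) (to b a)
    ; adj-irrefl = λ a → T-false (¬False ∘ irreflexive (toℕ a) (Fin.toℕ<n a) ∘ Equivalence.to isBit-true) }
  offset : ℕ
  offset = 1 + n + n * n
  len′ : length x ≡ offset + L
  len′ = trans len (cong (λ m → 1 + n + m + L) (times≡* n n))
  w : Word
  w = List.drop offset x
  length-w : length w ≡ L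
  length-w = trans (List.length-drop offset x) (trans (cong (_∸ offset) len′) (ℕ.m+n∸m≡n offset L))
  cell-w : ∀ i → cell w i ≡ cell x (1 + n + times n n + i)
  cell-w i = trans (cell-drop offset x i) (cong (λ m → cell x (1 + n + m + i)) (sym (times≡* n n)))
  w-chain : Chain w (λ i → auxiliary (n + i))
  w-chain i i< with chain i (subst (i <_) length-w i<)
  ... | inj₁ (e , e′) = inj₁ (trans (cell-w i) e , e′)
  ... | inj₂ (e , e′) = inj₂ (trans (cell-w i) e , e′)
  value-w : k ≡ value w
  value-w = trans (sym first) (chain-value w (λ i → auxiliary (n + i)) w-chain (trans (cong (λ m → auxiliary (n + m)) length-w) last))
  layout : Layout n adj (digits (fromℕ k)) x
  layout = record
    { ones = initial ; end = stop
    ; bits = λ a b → trans (cell-just x (subst (1 + n + (toℕ a * n + toℕ b) <_) (sym len′)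
               (ℕ.<-≤-trans (ℕ.+-monoʳ-< (1 + n) (entry-in-range a b)) (ℕ.m≤m+n offset L))))
               (cong (λ m → just (isBit true (cell x (1 + n + (m + toℕ b))))) (sym (times≡* (toℕ a) n)))
    ; rest = λ j → trans (sym (cell-drop offset x j)) (cong (λ v → cell v j) (trans (sym (digits-value w)) (cong (digits ∘ fromℕ) (sym value-w)))) }

-- Completeness

length-encode : ∀ G k → let n = Graph.order G in
                length (encode G k) ≡ 1 + n + n * n + length (digits (fromℕ k))
length-encode G k = trans (List.length-++ (replicate n true)) (trans (cong₂ _+_ (List.length-replicate n)
    (cong suc (trans (List.length-++ (matrix adj)) (cong (_+ length (digits (fromℕ k))) (length-matrix adj)))))
  (trans (ℕ.+-suc n _) (cong suc (sym (ℕ.+-assoc n (n * n) _)))))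
  where
  open Graph G
  n = order

Family-cong : ∀ {n adj k} {P P′ : Fin n → List Pt} → (∀ v → P′ v ≡ P v) → Family adj k P → Family adj k P′
Family-cong {k = k} {P} {P′} e F = record
  { path       = λ v → subst Path (sym (e v)) (path v)
  ; turns≤k    = λ v → subst (λ ps → turns ps ≤ k) (sym (e v)) (turns≤k v)
  ; represents = Similar-represents (Path-edge ∘ path)
      (subst-similar (cong codes ∘ e) (record { lift = λ {_} {e} _ → e , λ _ → id ; drop = λ {_} {e} _ → e , λ _ → id }))
      represents }
  where open Family F

at-≤ : ∀ {C} (f : Pt → ℕ) → f (0 , 0) ≡ 0 → ∀ {ps} → All (λ p → f p < C) ps → ∀ i → f (at ps i) ≤ C
at-≤ {C} f f0 []      i       = subst (_≤ C) (sym f0) z≤n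
at-≤     f f0 (h ∷ a) zero    = ℕ.<⇒≤ h
at-≤     f f0 (h ∷ a) (suc i) = at-≤ f f0 a i

-- Offsets up to `B` stay below the stride `1 + B`, so division recovers the path and the remainder
-- recovers the point.
slot-/ : ∀ {B} v {i} → i ≤ B → (times v (1 + B) + i) / suc B ≡ v
slot-/ {B} v {i} i≤B = trans (cong (_/ suc B) (trans (cong (_+ i) (times≡* v (suc B))) (ℕ.+-comm _ i)))
  (trans (+-distrib-/-∣ʳ i (n∣m*n v)) (cong₂ _+_ (m<n⇒m/n≡0 (s≤s i≤B)) (m*n/n≡m v (suc B))))

slot-% : ∀ {B} v {i} → i ≤ B → (times v (1 + B) + i) % suc B ≡ i
slot-% {B} v {i} i≤B = trans (cong (_% suc B) (trans (cong (_+ i) (times≡* v (suc B))) (ℕ.+-comm _ i)))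
  (trans ([m+kn]%n≡m%n i v (suc B)) (m<n⇒m%n≡m (s≤s i≤B)))

module Certificate (G : Graph) (k c : ℕ) (k≤ : k ≤ Graph.order G ^ c) {P : Fin (Graph.order G) → List Pt}
  (F : Family (Graph.adj G) k P) (bounded : Bounded (_< Graph.order G * (2 + k)) (_< Graph.order G * (2 + k)) P) where

  open Graph G renaming (order to n)

  x : Word
  x = encode G k
  N = length x
  d = digits (fromℕ k)
  W = width c N
  B = bound c N
  C = n * (2 + k)

  n<N : n < N
  n<N = subst (n <_) (sym (length-encode G k)) (s≤s (ℕ.≤-trans (ℕ.m≤m+n n (n * n)) (ℕ.m≤m+n _ (length d))))

  k≤power : k ≤ power c N
  k≤power = ℕ.≤-trans k≤ (subst (n ^ c ≤_) (sym (power≡^ c N)) (ℕ.^-monoˡ-≤ c (ℕ.<⇒≤ n<N)))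

  C≤W : C ≤ W
  C≤W = ℕ.≤-trans (ℕ.*-mono-≤ (ℕ.<⇒≤ n<N) (s≤s (s≤s k≤power))) (ℕ.≤-reflexive (sym (times≡* N _)))

  W≤B : W ≤ B
  W≤B = ℕ.≤-trans (ℕ.m≤n+m W (times W W)) (ℕ.m≤m+n _ (power c N))

  C*C≤B : C * C ≤ B
  C*C≤B = ℕ.≤-trans (ℕ.*-mono-≤ C≤W C≤W) (ℕ.≤-trans (ℕ.≤-reflexive (sym (times≡* W W)))
    (ℕ.≤-trans (ℕ.m≤m+n (times W W) W) (ℕ.m≤m+n _ (power c N))))

  pathOf : ℕ → List Pt
  pathOf v with v ℕ.<? n
  ... | yes v< = P (fromℕ< v<)
  ... | no _   = []

  pathOf-toℕ : ∀ v → pathOf (toℕ v) ≡ P v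
  pathOf-toℕ v with toℕ v ℕ.<? n
  ... | yes v< = cong P (Fin.fromℕ<-toℕ v v<)
  ... | no v≮  = contradiction (Fin.toℕ<n v) v≮

  pathOf-≥ : ∀ {v} → n ≤ v → pathOf v ≡ []
  pathOf-≥ {v} n≤v with v ℕ.<? n
  ... | yes v< = contradiction n≤v (ℕ.<⇒≱ v<)
  ... | no _   = refl

  pathOf-bounded : ∀ v → All (λ p → proj₁ p < C) (pathOf v) × All (λ p → proj₂ p < C) (pathOf v) × length (pathOf v) ≤ C * C
  pathOf-bounded v with v ℕ.<? n
  ... | yes v< = let xs , ys = bounded (fromℕ< v<) in xs , ys , length-path (Family.path F (fromℕ< v<)) xs ys
  ... | no _   = [] , [] , z≤n

  xs ys others : ℕ → ℕ
  xs q = proj₁ (at (pathOf (q / suc B)) (q % suc B))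
  ys q = proj₂ (at (pathOf (q / suc B)) (q % suc B))
  others q with q ℕ.<? n
  ... | yes _ = length (pathOf q) ∸ 1
  ... | no _  = value (List.drop (q ∸ n) d)

  Q : ℕ
  Q = times N (1 + B) + (N + N)

  u : Word
  u = blocks B (triple Q) (interleave xs ys others)

  xs≤B : ∀ q → xs q ≤ B
  xs≤B q = ℕ.≤-trans (at-≤ proj₁ refl (proj₁ (pathOf-bounded (q / suc B))) (q % suc B)) (ℕ.≤-trans C≤W W≤B)

  ys≤B : ∀ q → ys q ≤ B
  ys≤B q = ℕ.≤-trans (at-≤ proj₂ refl (proj₁ (proj₂ (pathOf-bounded (q / suc B)))) (q % suc B)) (ℕ.≤-trans C≤W W≤B)

  others≤B : ∀ q → others q ≤ B
  others≤B q with q ℕ.<? n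
  ... | yes _ = ℕ.≤-trans (ℕ.m∸n≤m _ 1) (ℕ.≤-trans (proj₂ (proj₂ (pathOf-bounded q))) C*C≤B)
  ... | no _  = ℕ.≤-trans (value-drop-≤ d (q ∸ n)) (subst (_≤ B) (sym (value-digits k))
                  (ℕ.≤-trans k≤power (ℕ.m≤n+m (power c N) (times W W + W))))

  beyond : ∀ q → Q ≤ q → n ≤ q / suc B
  beyond q Q≤q = ℕ.≤-trans (ℕ.<⇒≤ n<N) (subst (_≤ q / suc B) (m*n/n≡m N (suc B))
    (/-monoˡ-≤ (suc B) (ℕ.≤-trans (ℕ.≤-reflexive (sym (times≡* N (suc B)))) (ℕ.≤-trans (ℕ.m≤m+n _ (N + N)) Q≤q))))

  length-d≤N : length d ≤ N
  length-d≤N = subst (length d ≤_) (sym (length-encode G k)) (ℕ.m≤n+m (length d) _)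

  -- Past the end of the certificate every entry reads as 0, so the stored functions must vanish
  -- there for `stored` to hold at all indices.
  vanish : ∀ q → Q ≤ q → xs q ≡ 0 × ys q ≡ 0 × others q ≡ 0
  vanish q Q≤q = cong (λ ps → proj₁ (at ps (q % suc B))) (pathOf-≥ (beyond q Q≤q)) ,
                 cong (λ ps → proj₂ (at ps (q % suc B))) (pathOf-≥ (beyond q Q≤q)) , no-other
    where
    no-other : others q ≡ 0
    no-other with q ℕ.<? n
    ... | yes q<n = contradiction q<n (ℕ.≤⇒≯ (ℕ.≤-trans (ℕ.<⇒≤ n<N) (ℕ.≤-trans (ℕ.m≤m+n N N) (ℕ.≤-trans (ℕ.m≤n+m (N + N) (times N (1 + B))) Q≤q))))
    ... | no _    = cong value (drop-all d (ℕ.≤-trans length-d≤N (ℕ.≤-trans (ℕ.≤-reflexive (sym (ℕ.m+n∸m≡n n N)))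
                      (ℕ.∸-monoˡ-≤ n (ℕ.≤-trans (ℕ.+-monoˡ-≤ N (ℕ.<⇒≤ n<N)) (ℕ.≤-trans (ℕ.m≤n+m (N + N) (times N (1 + B))) Q≤q))))))

  stored : ∀ j → entry u B j ≡ interleave xs ys others j
  stored j = entry-blocks B (triple Q) (interleave xs ys others) j
    (interleave-All {_≤ B} xs ys others 0 (λ q _ → xs≤B q , ys≤B q , others≤B q) j z≤n)
    (interleave-All {_≡ 0} xs ys others Q vanish j)

  open Decoding u B

  aux≡ : ∀ q → auxiliary q ≡ others q
  aux≡ q = trans (stored (1 + (1 + triple q))) (interleave-2 xs ys others q)

  point≡ : ∀ v {i} → i ≤ B → (abscissa v i , ordinate v i) ≡ at (pathOf v) i
  point≡ v {i} i≤B = cong₂ _,_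
    (trans (stored (triple (slot v i))) (trans (interleave-0 xs ys others (slot v i)) (cong₂ (λ v i → proj₁ (at (pathOf v) i)) (slot-/ v i≤B) (slot-% v i≤B))))
    (trans (stored (1 + triple (slot v i))) (trans (interleave-1 xs ys others (slot v i)) (cong₂ (λ v i → proj₂ (at (pathOf v) i)) (slot-/ v i≤B) (slot-% v i≤B))))

  length≡ : ∀ (v : Fin n) → auxiliary (toℕ v) ≡ length (P v) ∸ 1
  length≡ v = trans (aux≡ (toℕ v)) go
    where
    go : others (toℕ v) ≡ length (P v) ∸ 1
    go with toℕ v ℕ.<? n
    ... | yes _ = cong (λ ps → length ps ∸ 1) (pathOf-toℕ v)
    ... | no v≮ = contradiction (Fin.toℕ<n v) v≮

  suffix≡ : ∀ i → auxiliary (n + i) ≡ value (List.drop i d)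
  suffix≡ i = trans (aux≡ (n + i)) go
    where
    go : others (n + i) ≡ value (List.drop i d)
    go with n + i ℕ.<? n
    ... | yes h = contradiction h (ℕ.m+n≮m n i)
    ... | no _  = cong (λ m → value (List.drop m d)) (ℕ.m+n∸m≡n n i)

  open Coordinates n k abscissa ordinate auxiliary (adjacentBit x n)

  paths≡ : ∀ v → paths v ≡ P v
  paths≡ v = go (ℕ.≤-trans (length-path (Family.path F v) (proj₁ (bounded v)) (proj₂ (bounded v))) C*C≤B)
    where
    rebuild : ∀ ps → 2 ≤ length ps → build (at ps) (length ps ∸ 1) ≡ ps
    rebuild (p ∷ ps) _ = build-at p ps
    go : length (P v) ≤ B → build (pt (toℕ v)) (auxiliary (toℕ v)) ≡ P v
    go le = trans (cong (build (pt (toℕ v))) (length≡ v)) (trans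
      (build-cong (length (P v) ∸ 1) λ i i≤ → trans (point≡ (toℕ v) (ℕ.≤-trans i≤ (ℕ.≤-trans (ℕ.m∸n≤m _ 1) le)))
        (cong (λ ps → at ps i) (pathOf-toℕ v)))
      (rebuild (P v) (Path.long (Family.path F v))))

  layout : Layout n adj d x
  layout = encode-layout G k

  bit≡ : ∀ (a b : Fin n) → cell x (1 + n + (times (toℕ a) n + toℕ b)) ≡ just (adj a b)
  bit≡ a b = trans (cong (λ m → cell x (1 + n + (m + toℕ b))) (times≡* (toℕ a) n)) (Layout.bits layout a b)

  bit⇔adj : ∀ (a b : Fin n) → adjacentBit x n (toℕ a) (toℕ b) ⇔ T (adj a b)
  bit⇔adj a b = mk⇔ (λ e → subst T (sym (just-injective (trans (sym (bit≡ a b)) e))) tt)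
                    (λ t → trans (bit≡ a b) (cong just (T-true t)))
    where
    T-true : ∀ {b} → T b → b ≡ true
    T-true {true} _ = refl

  symmetric : Symmetric x n
  symmetric = λ a a< b b< → forall-vertex {λ a → ∀ b → b < n → adjacentBit x n a b → adjacentBit x n b a}
    (λ a → forall-vertex λ b h → Equivalence.from (bit⇔adj b a) (subst T (adj-sym a b) (Equivalence.to (bit⇔adj a b) h))) a a< b b<

  irreflexive : Irreflexive x n
  irreflexive = forall-vertex λ a h → ⊥-elim (subst T (adj-irrefl a) (Equivalence.to (bit⇔adj a a) h))

  numeral-stored : Numeral x u n k B (length d)
  numeral-stored = trans (suffix≡ 0) (value-digits k) ,
    trans (suffix≡ (length d)) (cong value (drop-all d ℕ.≤-refl)) , λ i i< → convert i (suffix-chain d i i<)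
    where
    cell≡ : ∀ i → cell x (1 + n + times n n + i) ≡ cell d i
    cell≡ i = trans (cong (λ m → cell x (1 + n + m + i)) (times≡* n n)) (Layout.rest layout i)
    convert : ∀ i → _ ⊎ _ → _ ⊎ _
    convert i (inj₁ (e , e′)) = inj₁ (trans (cell≡ i) e ,
      trans (suffix≡ i) (trans e′ (cong (λ m → 1 + (1 + (m + m))) (sym (suffix≡ (1 + i))))))
    convert i (inj₂ (e , e′)) = inj₂ (trans (cell≡ i) e ,
      trans (suffix≡ i) (trans e′ (cong (λ m → 1 + (m + m)) (sym (suffix≡ (1 + i))))))

  length-u : length u ≡ Semantics.eval x u (certificateLength c) (λ _ → N)
  length-u = trans (length-blocks B (triple Q) (interleave xs ys others)) (trans (sym (times≡* (triple Q) B))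
    (cong (λ b → times (triple (times N (1 + b) + (N + N))) b) (sym (eval-bound {x} {u} c (λ _ → N)))))

  verified : Verified c x u
  verified = n , n<N , Layout.ones layout , Layout.end layout , length d ,
    subst (length d <_) (sym (length-encode G k)) (ℕ.m<n+m (length d) (s≤s z≤n)) ,
    trans (length-encode G k) (cong (λ m → 1 + n + m + length d) (sym (times≡* n n))) ,
    symmetric , irreflexive , k ,
    s≤s (subst (k ≤_) (sym (trans (eval-power {x} {u} c (λ _ → n)) (power≡^ c n))) k≤) ,
    -- The certificate was built with `bound c N`, whereas `Verified` has the value of the
    -- corresponding term.
    subst (λ b → Numeral x u n k b (length d)) (sym (eval-bound {x} {u} c (λ _ → N))) numeral-stored ,
    subst (ValidFamily x u n k) (sym (eval-bound {x} {u} c (λ _ → N))) (family⇒valid bit⇔adj (Family-cong paths≡ F))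

  certified : ∃[ u ] length u ≤ Semantics.eval x u (certificateLength c) (λ _ → N) × Verified c x u
  certified = u , ℕ.≤-reflexive length-u , verified

problem⇒certificate : ∀ c x → HellyBEPGProblem c x →
                      ∃[ u ] length u ≤ Semantics.eval x u (certificateLength c) (λ _ → length x) × Verified c x u
problem⇒certificate c _ (G , k , refl , k≤ , representation) =
  let _ , F , bounded = representation⇒family G representation in Certificate.certified G k c k≤ F bounded

theorem3p2 : (c : ℕ) → InNP (HellyBEPGProblem c)
theorem3p2 c = formula⇒InNP (verification c) (certificateLength c)
  (λ x u h → verified⇒problem c (sat⇒verified c h))
  (λ x h → let u , u≤ , v = problem⇒certificate c x h in u , u≤ , verified⇒sat c v)
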